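{- Let $d, k, r$ be positive integers with $k < d$ and $r \ge k+1$. Then, as $n\to\infty$, $f_{\mathrm{lin}}(n,d,k,r) = \Omega(g_{d,k,r}(n))$, where $$g_{d,k,r}(n) = \begin{cases} n^{d(r-k)/(r-1)}, & \text{if } r < d,\\ n^{d(d-k)/(d-1)}/(\log n)^{1/(d-1)}, & \text{otherwise.}\end{cases}$$ In particular, if $r = k+1$, then $f_{\mathrm{lin}}(n,d,k,k+1) = \Omega(g_{d,k}(n))$, where $$g_{d,k}(n) = \begin{cases} n^{d(d-k)/(d-1)}/(\log n)^{1/(d-1)}, & \text{if } k = d-1,\\ n^{d/k}, & \text{otherwise.}\end{cases}$$
   Context: $[n] = \{1,\dots,n\}$. For positive integers $n,d,k,r$ with $k<d$ and $r \ge k+1$, $f_{\mathrm{lin}}(n,d,k,r)$ is the maximum size of a subset of $[n]^d\subset\mathbb{R}^d$ such that every $k$-dimensional linear subspace of $\mathbb{R}^d$ contains at most $r-1$ points of the subset. Here $d,k,r$ are fixed and $n\to\infty$; implied constants may depend on $d,k,r$. -}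

module Defs where

open import Algebra.Bundles using (RawSemiring)
import Algebra.Definitions.RawSemiring as RawSemiringDefs
open import Data.Fin.Base using (Fin; toℕ)
open import Data.Integer.Base as ℤ using (+_)
import Data.Integer.Properties as ℤ
open import Data.List.Base using (List; length)
open import Data.List.Relation.Binary.Subset.Propositional using () renaming (_⊆_ to _⊆ˡ_)
open import Data.List.Relation.Unary.All using (All)
open import Data.List.Relation.Unary.Unique.Propositional using (Unique)
open import Data.Nat.Base as ℕ using (ℕ; zero; suc)
import Data.Nat.Properties as ℕ
open import Data.Nat.Solver as ℕ using ()
open import Data.Product.Base using (Σ; ∃-syntax; _×_; _,_)
open import Data.Rational.Base as ℚ using (ℚ; 0ℚ; 1ℚ; ½)
import Data.Rational.Base
import Data.Rational.Properties as ℚ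
import Data.Rational.Unnormalised.Base as ℚᵘ
import Data.Rational.Unnormalised.Properties as ℚᵘ
open import Data.Rational.Solver as ℚ using ()
open import Data.Sum.Base using (_⊎_; inj₁; inj₂)
open import Data.Vec.Base using (Vec; lookup)
open import Data.Vec.Functional using (Vector; map; zipWith; replicate; foldr)
open import Level using (0ℓ)
import Relation.Binary.PropositionalEquality
open import Relation.Binary.PropositionalEquality
  using (_≡_; refl; sym; trans; cong; cong₂; subst; subst₂)
open import Relation.Nullary.Negation using (¬_)

module _ where
  open Data.Rational.Base

  ∣∣-bound : ∀ {p q} → p ≤ q → - p ≤ q → ∣ p ∣ ≤ q
  ∣∣-bound {p} p≤q -p≤q with ℚ.∣p∣≡p∨∣p∣≡-p p
  ... | inj₁ e = subst (_≤ _) (sym e) p≤q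
  ... | inj₂ e = subst (_≤ _) (sym e) -p≤q

  ≤+⇒-≤ : ∀ {p q r} → p ≤ q + r → p - q ≤ r
  ≤+⇒-≤ {p} {q} {r} h = subst (p - q ≤_)
    (solve 2 (λ q r → q :+ r :- q := r) refl q r) (ℚ.+-monoˡ-≤ (- q) h)
    where open ℚ.+-*-Solver

  ∣-∣-bound : ∀ {p q r} → p ≤ q + r → q ≤ p + r → ∣ p - q ∣ ≤ r
  ∣-∣-bound {p} {q} {r} h₁ h₂ = ∣∣-bound (≤+⇒-≤ h₁)
    (subst (_≤ r) (solve 2 (λ p q → q :- p := :- (p :- q)) refl p q) (≤+⇒-≤ h₂))
    where open ℚ.+-*-Solver

  /-mono-≤ : ∀ {a b c d} → a ℕ.* suc d ℕ.≤ c ℕ.* suc b → + a / suc b ≤ + c / suc d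
  /-mono-≤ {a} {b} {c} {d} h = ℚ.toℚᵘ-cancel-≤
    (ℚᵘ.≤-respˡ-≃ (ℚᵘ.≃-sym (ℚ.toℚᵘ-fromℚᵘ (ℚᵘ.mkℚᵘ (+ a) b)))
    (ℚᵘ.≤-respʳ-≃ (ℚᵘ.≃-sym (ℚ.toℚᵘ-fromℚᵘ (ℚᵘ.mkℚᵘ (+ c) d)))
    (ℚᵘ.*≤* (subst₂ ℤ._≤_ (ℤ.pos-* a (suc d)) (ℤ.pos-* c (suc b)) (ℤ.+≤+ h)))))

  /1-* : ∀ a b c → (+ a / 1) * (+ b / suc c) ≡ + (a ℕ.* b) / suc c
  /1-* a b c = ℚ.toℚᵘ-injective (ℚᵘ.≃-trans (ℚ.toℚᵘ-homo-* (+ a / 1) (+ b / suc c))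
    (ℚᵘ.≃-trans (ℚᵘ.*-cong (ℚ.toℚᵘ-fromℚᵘ (ℚᵘ.mkℚᵘ (+ a) 0)) (ℚ.toℚᵘ-fromℚᵘ (ℚᵘ.mkℚᵘ (+ b) c)))
    (ℚᵘ.≃-trans (ℚᵘ.*≡* (cong₂ ℤ._*_ (sym (ℤ.pos-* a b)) (cong +_ (sym (ℕ.+-identityʳ (suc c))))))
    (ℚᵘ.≃-sym (ℚ.toℚᵘ-fromℚᵘ (ℚᵘ.mkℚᵘ (+ (a ℕ.* b)) c))))))

  /1-suc : ∀ a → + suc a / 1 ≡ + a / 1 + 1ℚ
  /1-suc a = ℚ.toℚᵘ-injective (ℚᵘ.≃-trans (ℚ.toℚᵘ-fromℚᵘ (ℚᵘ.mkℚᵘ (+ suc a) 0))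
    (ℚᵘ.≃-trans (ℚᵘ.*≡* {ℚᵘ.mkℚᵘ (+ suc a) 0} {ℚᵘ.mkℚᵘ (+ a) 0 ℚᵘ.+ ℚᵘ.1ℚᵘ} eq)
    (ℚᵘ.≃-trans (ℚᵘ.+-cong (ℚᵘ.≃-sym (ℚ.toℚᵘ-fromℚᵘ (ℚᵘ.mkℚᵘ (+ a) 0))) (ℚᵘ.≃-refl {ℚᵘ.1ℚᵘ}))
    (ℚᵘ.≃-sym (ℚ.toℚᵘ-homo-+ (+ a / 1) 1ℚ)))))
    where
    eq : + suc a ℤ.* + 1 ≡ (+ a ℤ.* + 1 ℤ.+ + 1) ℤ.* + 1
    eq = cong (ℤ._* + 1) (trans (cong +_ (ℕ.+-comm 1 a)) (cong (ℤ._+ + 1) (sym (ℤ.*-identityʳ (+ a)))))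

IsCauchy : (ℕ → ℚ) → Set
IsCauchy s = ∀ ε → 0ℚ ℚ.< ε →
  ∃[ N ] ∀ m n → N ℕ.≤ m → N ℕ.≤ n → ℚ.∣ s m ℚ.- s n ∣ ℚ.≤ ε

-- The moduli of convergence play no role in the definitions below, and
-- unfolding them is expensive.

abstract
  const-cauchy : ∀ q → IsCauchy (λ _ → q)
  const-cauchy q ε 0<ε = 0 , λ _ _ _ _ →
    subst (ℚ._≤ ε) (sym (cong ℚ.∣_∣ (ℚ.+-inverseʳ q))) (ℚ.<⇒≤ 0<ε)

  +-cauchy : ∀ {s t} → IsCauchy s → IsCauchy t → IsCauchy (λ n → s n ℚ.+ t n)
  +-cauchy {s} {t} cs ct ε 0<ε =
    let M , hs = cs δ 0<δ
        N , ht = ct δ 0<δ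
    in M ℕ.+ N , λ m n hm hn → begin
    ∣ (s m + t m) - (s n + t n) ∣
      ≡⟨ cong ∣_∣ (rearrange (s m) (t m) (s n) (t n)) ⟩
    ∣ (s m - s n) + (t m - t n) ∣
      ≤⟨ ℚ.∣p+q∣≤∣p∣+∣q∣ (s m - s n) (t m - t n) ⟩
    ∣ s m - s n ∣ + ∣ t m - t n ∣
      ≤⟨ ℚ.+-mono-≤ (hs m n (ℕ.m+n≤o⇒m≤o M hm) (ℕ.m+n≤o⇒m≤o M hn))
                    (ht m n (ℕ.m+n≤o⇒n≤o M hm) (ℕ.m+n≤o⇒n≤o M hn)) ⟩
    δ + δ
      ≡⟨ sym (ℚ.*-distribʳ-+ ε ½ ½) ⟩
    1ℚ * ε
      ≡⟨ ℚ.*-identityˡ ε ⟩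
    ε ∎
    where
    open Data.Rational.Base
    open ℚ.≤-Reasoning
    δ : ℚ
    δ = ½ * ε
    0<δ : 0ℚ < δ
    0<δ = subst (_< ½ * ε) (ℚ.*-zeroʳ ½) (ℚ.*-monoʳ-<-pos ½ 0<ε)
    rearrange : ∀ a b c d → (a + b) - (c + d) ≡ (a - c) + (b - d)
    rearrange = solve 4 (λ a b c d → (a :+ b) :- (c :+ d) := (a :- c) :+ (b :- d)) refl
      where open ℚ.+-*-Solver

  cauchy-bounded : ∀ {s} → IsCauchy s →
    ∃[ B ] 0ℚ ℚ.< B × ∃[ N ] ∀ n → N ℕ.≤ n → ℚ.∣ s n ∣ ℚ.≤ B
  cauchy-bounded {s} cs =
    let N , h = cs 1ℚ 0<1
    in ∣ s N ∣ + 1ℚ , ℚ.+-mono-≤-< (ℚ.0≤∣p∣ (s N)) 0<1 , N , λ n hn → begin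
    ∣ s n ∣                   ≡⟨ cong ∣_∣ (split (s n) (s N)) ⟩
    ∣ s N + (s n - s N) ∣     ≤⟨ ℚ.∣p+q∣≤∣p∣+∣q∣ (s N) (s n - s N) ⟩
    ∣ s N ∣ + ∣ s n - s N ∣   ≤⟨ ℚ.+-monoʳ-≤ (∣ s N ∣) (h n N hn ℕ.≤-refl) ⟩
    ∣ s N ∣ + 1ℚ              ∎
    where
    open Data.Rational.Base
    open ℚ.≤-Reasoning
    0<1 : 0ℚ < 1ℚ
    0<1 = ℚ.positive⁻¹ 1ℚ
    split : ∀ a b → a ≡ b + (a - b)
    split = solve 2 (λ a b → a := b :+ (a :- b)) refl
      where open ℚ.+-*-Solver

  divide : ∀ A B ε → 0ℚ ℚ.< A → 0ℚ ℚ.< B → 0ℚ ℚ.< ε →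
    ∃[ δ ] 0ℚ ℚ.< δ × δ ℚ.* B ℚ.+ A ℚ.* δ ≡ ε
  divide A B ε 0<A 0<B 0<ε = ε * C⁻¹ , 0<δ , (begin
    ε * C⁻¹ * B + A * (ε * C⁻¹)   ≡⟨ factor A B ε C⁻¹ ⟩
    ε * (C⁻¹ * (A + B))           ≡⟨ cong (ε *_) (ℚ.*-inverseˡ (A + B) {{C≢0}}) ⟩
    ε * 1ℚ                        ≡⟨ ℚ.*-identityʳ ε ⟩
    ε                             ∎)
    where
    open Data.Rational.Base
    open Relation.Binary.PropositionalEquality.≡-Reasoning
    C>0 : Positive (A + B)
    C>0 = positive (ℚ.+-mono-< 0<A 0<B)
    C≢0 : NonZero (A + B)
    C≢0 = ℚ.pos⇒nonZero (A + B) {{C>0}}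
    C⁻¹ : ℚ
    C⁻¹ = (1/ (A + B)) {{C≢0}}
    0<δ : 0ℚ < ε * C⁻¹
    0<δ = subst (_< ε * C⁻¹) (ℚ.*-zeroˡ C⁻¹)
      (ℚ.*-monoˡ-<-pos C⁻¹ {{ℚ.1/pos⇒pos (A + B) {{C>0}}}} 0<ε)
    factor : ∀ a b e c → e * c * b + a * (e * c) ≡ e * (c * (a + b))
    factor = solve 4 (λ a b e c → e :* c :* b :+ a :* (e :* c) := e :* (c :* (a :+ b))) refl
      where open ℚ.+-*-Solver

  *-close : ∀ p q p′ q′ A B δ → 0ℚ ℚ.≤ A → 0ℚ ℚ.≤ δ →
    ℚ.∣ q ∣ ℚ.≤ B → ℚ.∣ p′ ∣ ℚ.≤ A →
    ℚ.∣ p ℚ.- p′ ∣ ℚ.≤ δ → ℚ.∣ q ℚ.- q′ ∣ ℚ.≤ δ →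
    ℚ.∣ p ℚ.* q ℚ.- p′ ℚ.* q′ ∣ ℚ.≤ δ ℚ.* B ℚ.+ A ℚ.* δ
  *-close p q p′ q′ A B δ 0≤A 0≤δ hq hp′ hp hqq′ = begin
    ∣ p * q - p′ * q′ ∣
      ≡⟨ cong ∣_∣ (rearrange p q p′ q′) ⟩
    ∣ (p - p′) * q + p′ * (q - q′) ∣
      ≤⟨ ℚ.∣p+q∣≤∣p∣+∣q∣ ((p - p′) * q) (p′ * (q - q′)) ⟩
    ∣ (p - p′) * q ∣ + ∣ p′ * (q - q′) ∣
      ≡⟨ cong₂ _+_ (ℚ.∣p*q∣≡∣p∣*∣q∣ (p - p′) q) (ℚ.∣p*q∣≡∣p∣*∣q∣ p′ (q - q′)) ⟩
    ∣ p - p′ ∣ * ∣ q ∣ + ∣ p′ ∣ * ∣ q - q′ ∣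
      ≤⟨ ℚ.+-mono-≤
           (*-mono-≤ (∣ p - p′ ∣) δ (∣ q ∣) B (ℚ.0≤∣p∣ q) 0≤δ hp hq)
           (*-mono-≤ (∣ p′ ∣) A (∣ q - q′ ∣) δ (ℚ.0≤∣p∣ (q - q′)) 0≤A hp′ hqq′) ⟩
    δ * B + A * δ ∎
    where
    open Data.Rational.Base
    open ℚ.≤-Reasoning
    *-mono-≤ : ∀ p q x y → 0ℚ ≤ x → 0ℚ ≤ q → p ≤ q → x ≤ y → p * x ≤ q * y
    *-mono-≤ p q x y 0≤x 0≤q p≤q x≤y = ℚ.≤-trans
      (ℚ.*-monoʳ-≤-nonNeg x {{nonNegative 0≤x}} p≤q)
      (ℚ.*-monoˡ-≤-nonNeg q {{nonNegative 0≤q}} x≤y)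
    rearrange : ∀ a b c d → a * b - c * d ≡ (a - c) * b + c * (b - d)
    rearrange = solve 4 (λ a b c d → a :* b :- c :* d := (a :- c) :* b :+ c :* (b :- d)) refl
      where open ℚ.+-*-Solver

  *-cauchy : ∀ {s t} → IsCauchy s → IsCauchy t → IsCauchy (λ n → s n ℚ.* t n)
  *-cauchy {s} {t} cs ct ε 0<ε =
    let A , 0<A , I , bs = cauchy-bounded cs
        B , 0<B , J , bt = cauchy-bounded ct
        δ , 0<δ , δ-eq   = divide A B ε 0<A 0<B 0<ε
        M , hs = cs δ 0<δ
        N , ht = ct δ 0<δ
        I≤ = λ {x} h → ℕ.m+n≤o⇒m≤o I {J} {x} (ℕ.m+n≤o⇒m≤o (I ℕ.+ J) h)
        J≤ = λ {x} h → ℕ.m+n≤o⇒n≤o I {J} {x} (ℕ.m+n≤o⇒m≤o (I ℕ.+ J) h)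
        M≤ = λ {x} h → ℕ.m+n≤o⇒m≤o M {N} {x} (ℕ.m+n≤o⇒n≤o (I ℕ.+ J) h)
        N≤ = λ {x} h → ℕ.m+n≤o⇒n≤o M {N} {x} (ℕ.m+n≤o⇒n≤o (I ℕ.+ J) h)
    in (I ℕ.+ J) ℕ.+ (M ℕ.+ N) , λ m n hm hn →
      subst (ℚ.∣ s m ℚ.* t m ℚ.- s n ℚ.* t n ∣ ℚ.≤_) δ-eq
        (*-close (s m) (t m) (s n) (t n) A B δ (ℚ.<⇒≤ 0<A) (ℚ.<⇒≤ 0<δ)
          (bt m (J≤ hm)) (bs n (I≤ hn))
          (hs m n (M≤ hm) (M≤ hn)) (ht m n (N≤ hm) (N≤ hn)))

sumℚ : ℕ → (ℕ → ℚ) → ℚ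
sumℚ zero    f = 0ℚ
sumℚ (suc n) f = sumℚ n f ℚ.+ f n

-- The lower Riemann sum of ∫₁ⁿ dt/t for the subdivision into intervals
-- of length 1/m, where m = suc j: the i-th interval [1+i/m , 1+(i+1)/m]
-- contributes (1/m) / (1+(i+1)/m) = 1/(m+i+1).

log-seq : ℕ → ℕ → ℚ
log-seq n j = sumℚ ((n ℕ.∸ 1) ℕ.* suc j) (λ i → + 1 ℚ./ suc (suc j ℕ.+ i))

module LogCauchy where
  open Data.Rational.Base
  open ℚ.≤-Reasoning

  u : ℕ → ℚ
  u n = + 1 / suc n

  u-anti : ∀ {m n} → m ℕ.≤ n → u n ≤ u m
  u-anti {m} {n} m≤n = /-mono-≤ {1} {n} {1} {m} (ℕ.*-monoʳ-≤ 1 (ℕ.s≤s m≤n))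

  sumℚ-mono : ∀ n {f g} → (∀ i → i ℕ.< n → f i ≤ g i) → sumℚ n f ≤ sumℚ n g
  sumℚ-mono zero    h = ℚ.≤-refl
  sumℚ-mono (suc n) h = ℚ.+-mono-≤ (sumℚ-mono n (λ i i<n → h i (ℕ.m<n⇒m<1+n i<n))) (h n ℕ.≤-refl)

  sumℚ-cong : ∀ n {f g} → (∀ i → f i ≡ g i) → sumℚ n f ≡ sumℚ n g
  sumℚ-cong zero    h = refl
  sumℚ-cong (suc n) h = cong₂ _+_ (sumℚ-cong n h) (h n)

  sumℚ-const : ∀ n c → sumℚ n (λ _ → c) ≡ (+ n / 1) * c
  sumℚ-const zero    c = sym (ℚ.*-zeroˡ c)
  sumℚ-const (suc n) c = begin-equality
    sumℚ n (λ _ → c) + c      ≡⟨ cong₂ _+_ (sumℚ-const n c) (sym (ℚ.*-identityˡ c)) ⟩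
    (+ n / 1) * c + 1ℚ * c    ≡⟨ sym (ℚ.*-distribʳ-+ c (+ n / 1) 1ℚ) ⟩
    ((+ n / 1) + 1ℚ) * c      ≡⟨ cong (_* c) (sym (/1-suc n)) ⟩
    (+ suc n / 1) * c         ∎

  sumℚ-++ : ∀ m n f → sumℚ (m ℕ.+ n) f ≡ sumℚ m f + sumℚ n (λ i → f (m ℕ.+ i))
  sumℚ-++ m zero    f = trans (cong (λ k → sumℚ k f) (ℕ.+-identityʳ m)) (sym (ℚ.+-identityʳ _))
  sumℚ-++ m (suc n) f = trans (cong (λ k → sumℚ k f) (ℕ.+-suc m n))
    (trans (cong (_+ f (m ℕ.+ n)) (sumℚ-++ m n f)) (ℚ.+-assoc (sumℚ m f) _ _))

  sumℚ-blocks : ∀ M A f → sumℚ (M ℕ.* A) f ≡ sumℚ M (λ i → sumℚ A (λ t → f (i ℕ.* A ℕ.+ t)))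
  sumℚ-blocks zero    A f = refl
  sumℚ-blocks (suc M) A f = trans (cong (λ k → sumℚ k f) (ℕ.+-comm A (M ℕ.* A)))
    (trans (sumℚ-++ (M ℕ.* A) A f) (cong (_+ sumℚ A (λ t → f (M ℕ.* A ℕ.+ t))) (sumℚ-blocks M A f)))

  block : ℕ → ℕ → ℚ
  block A x = sumℚ A (λ t → u (A ℕ.* suc x ℕ.+ t))

  scale : ∀ a x → sumℚ (suc a) (λ _ → + 1 / (suc a ℕ.* suc x)) ≡ u x
  scale a x = trans (sumℚ-const (suc a) (+ 1 / (suc a ℕ.* suc x)))
    (trans (/1-* (suc a) 1 (x ℕ.+ a ℕ.* suc x))
    (ℚ.≤-antisym (/-mono-≤ {suc a ℕ.* 1} {x ℕ.+ a ℕ.* suc x} {1} {x} (ℕ.≤-reflexive eq))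
                 (/-mono-≤ {1} {x} {suc a ℕ.* 1} {x ℕ.+ a ℕ.* suc x} (ℕ.≤-reflexive (sym eq)))))
    where
    eq : suc a ℕ.* 1 ℕ.* suc x ≡ 1 ℕ.* (suc a ℕ.* suc x)
    eq = trans (cong (ℕ._* suc x) (ℕ.*-identityʳ (suc a))) (sym (ℕ.*-identityˡ (suc a ℕ.* suc x)))

  block-≤ : ∀ a x → block (suc a) x ≤ u x
  block-≤ a x = subst (block (suc a) x ≤_) (scale a x) (sumℚ-mono (suc a) λ t _ →
    u-anti (ℕ.≤-trans (ℕ.n≤1+n _) (ℕ.m≤m+n (suc a ℕ.* suc x) t)))

  block-≥ : ∀ a x → u (suc x) ≤ block (suc a) x
  block-≥ a x = subst (_≤ block (suc a) x) (scale a (suc x)) (sumℚ-mono (suc a) λ t t<A →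
    u-anti (ℕ.s≤s⁻¹ (subst (suc (suc a ℕ.* suc x ℕ.+ t) ℕ.≤_) (eq (suc a) (suc x))
      (ℕ.≤-trans (ℕ.≤-reflexive (sym (ℕ.+-suc (suc a ℕ.* suc x) t)))
                 (ℕ.+-monoʳ-≤ (suc a ℕ.* suc x) t<A)))))
    where
    eq : ∀ A y → A ℕ.* y ℕ.+ A ≡ A ℕ.* suc y
    eq A y = trans (ℕ.+-comm (A ℕ.* y) A) (sym (ℕ.*-suc A y))

  S : ℕ → ℕ → ℚ
  S B M = sumℚ M (λ i → u (B ℕ.+ i))

  S-blocks : ∀ A j M → S (A ℕ.* suc j) (M ℕ.* A) ≡ sumℚ M (λ i → block A (j ℕ.+ i))
  S-blocks A j M = trans (sumℚ-blocks M A _)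
    (sumℚ-cong M λ i → sumℚ-cong A λ t → cong u (eq A j i t))
    where
    eq : ∀ A j i t → A ℕ.* suc j ℕ.+ (i ℕ.* A ℕ.+ t) ≡ A ℕ.* suc (j ℕ.+ i) ℕ.+ t
    eq = solve 4 (λ A j i t → A :* (con 1 :+ j) :+ (i :* A :+ t)
                           := A :* (con 1 :+ (j :+ i)) :+ t) refl
      where open ℕ.+-*-Solver

  refine-≥ : ∀ a j M → S (suc j) M ≤ S (suc a ℕ.* suc j) (M ℕ.* suc a)
  refine-≥ a j M = subst (S (suc j) M ≤_) (sym (S-blocks (suc a) j M))
    (sumℚ-mono M λ i _ → block-≥ a (j ℕ.+ i))

  telescope : ∀ j M → S j M + u (j ℕ.+ M) ≡ u j + S (suc j) M
  telescope j zero    = trans (ℚ.+-identityˡ _)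
    (trans (cong u (ℕ.+-identityʳ j)) (sym (ℚ.+-identityʳ (u j))))
  telescope j (suc M) = trans
    (cong₂ _+_ (telescope j M) (cong u (ℕ.+-suc j M)))
    (ℚ.+-assoc (u j) (S (suc j) M) _)

  0≤u : ∀ n → 0ℚ ≤ u n
  0≤u n = ℚ.nonNegative⁻¹ (u n) {{ℚ.normalize-nonNeg 1 (suc n)}}

  refine-≤ : ∀ a j M → S (suc a ℕ.* suc j) (M ℕ.* suc a) ≤ S (suc j) M + u j
  refine-≤ a j M = begin
    S (suc a ℕ.* suc j) (M ℕ.* suc a)        ≡⟨ S-blocks (suc a) j M ⟩
    sumℚ M (λ i → block (suc a) (j ℕ.+ i))   ≤⟨ sumℚ-mono M (λ i _ → block-≤ a (j ℕ.+ i)) ⟩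
    S j M                                    ≡⟨ sym (ℚ.+-identityʳ (S j M)) ⟩
    S j M + 0ℚ                               ≤⟨ ℚ.+-monoʳ-≤ (S j M) (0≤u (j ℕ.+ M)) ⟩
    S j M + u (j ℕ.+ M)                      ≡⟨ telescope j M ⟩
    u j + S (suc j) M                        ≡⟨ ℚ.+-comm (u j) (S (suc j) M) ⟩
    S (suc j) M + u j                        ∎

  log-seq-close : ∀ n j l → log-seq n j ≤ log-seq n l + u l
  log-seq-close n j l = begin
    S (suc j) (N ℕ.* suc j)
      ≤⟨ refine-≥ l j (N ℕ.* suc j) ⟩
    S (suc l ℕ.* suc j) (N ℕ.* suc j ℕ.* suc l)
      ≡⟨ cong₂ S (ℕ.*-comm (suc l) (suc j)) (eq N (suc j) (suc l)) ⟩
    S (suc j ℕ.* suc l) (N ℕ.* suc l ℕ.* suc j)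
      ≤⟨ refine-≤ j l (N ℕ.* suc l) ⟩
    S (suc l) (N ℕ.* suc l) + u l ∎
    where
    N = n ℕ.∸ 1
    eq : ∀ x y z → x ℕ.* y ℕ.* z ≡ x ℕ.* z ℕ.* y
    eq x y z = trans (ℕ.*-assoc x y z) (trans (cong (x ℕ.*_) (ℕ.*-comm y z)) (sym (ℕ.*-assoc x z y)))

  archimedean : ∀ ε → 0ℚ < ε → ∃[ N ] ∀ n → N ℕ.≤ n → u n ≤ ε
  archimedean ε@(ℚ.mkℚ (+ suc p) q _) _ = q , λ n q≤n →
    subst (u n ≤_) (ℚ.↥p/↧p≡p ε) (/-mono-≤ {1} {n} {suc p} {q} (ℕ.*-mono-≤ {1} {suc p} (ℕ.s≤s ℕ.z≤n) (ℕ.s≤s q≤n)))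
  archimedean (ℚ.mkℚ (+ zero) q _) (*<* (ℤ.+<+ ()))
  archimedean (ℚ.mkℚ (ℤ.-[1+ p ]) q _) (*<* ())

  abstract
    log-cauchy : ∀ n → IsCauchy (log-seq n)
    log-cauchy n ε 0<ε =
      let N , h = archimedean ε 0<ε
      in N , λ j l N≤j N≤l → ∣-∣-bound
        (ℚ.≤-trans (log-seq-close n j l) (ℚ.+-monoʳ-≤ (log-seq n l) (h l N≤l)))
        (ℚ.≤-trans (log-seq-close n l j) (ℚ.+-monoʳ-≤ (log-seq n j) (h j N≤j)))

record ℝ : Set where
  constructor mkℝ
  field
    seq    : ℕ → ℚ
    cauchy : IsCauchy seq

open ℝ public

infix 4 _≈_ _≤_ _<_

_≈_ : ℝ → ℝ → Set
x ≈ y = ∀ ε → 0ℚ ℚ.< ε → ∃[ N ] ∀ n → N ℕ.≤ n → ℚ.∣ seq x n ℚ.- seq y n ∣ ℚ.≤ ε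

_≤_ : ℝ → ℝ → Set
x ≤ y = ∀ ε → 0ℚ ℚ.< ε → ∃[ N ] ∀ n → N ℕ.≤ n → seq x n ℚ.≤ seq y n ℚ.+ ε

_<_ : ℝ → ℝ → Set
x < y = ∃[ ε ] 0ℚ ℚ.< ε × ∃[ N ] ∀ n → N ℕ.≤ n → seq x n ℚ.+ ε ℚ.≤ seq y n

fromℚ : ℚ → ℝ
fromℚ q = mkℝ (λ _ → q) (const-cauchy q)

fromℕ : ℕ → ℝ
fromℕ n = fromℚ (+ n ℚ./ 1)

0ℝ 1ℝ : ℝ
0ℝ = fromℕ 0
1ℝ = fromℕ 1

infixl 6 _+_
infixl 7 _*_

_+_ : ℝ → ℝ → ℝ
x + y = mkℝ (λ n → seq x n ℚ.+ seq y n) (+-cauchy {seq x} {seq y} (cauchy x) (cauchy y))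

_*_ : ℝ → ℝ → ℝ
x * y = mkℝ (λ n → seq x n ℚ.* seq y n) (*-cauchy {seq x} {seq y} (cauchy x) (cauchy y))

ℝ-rawSemiring : RawSemiring 0ℓ 0ℓ
ℝ-rawSemiring = record
  { Carrier = ℝ ; _≈_ = _≈_ ; _+_ = _+_ ; _*_ = _*_ ; 0# = 0ℝ ; 1# = 1ℝ }

open RawSemiringDefs ℝ-rawSemiring public using (_^_)

-- The natural logarithm log n = ∫₁ⁿ dt/t of an integer n ≥ 1, as the
-- limit of the sums log-seq n j; log 0 is the junk value 0.

log : ℕ → ℝ
log n = mkℝ (log-seq n) (LogCauchy.log-cauchy n)

module _ {d : ℕ} where

  infix  4 _≈ᵛ_
  infixl 6 _+ᵛ_
  infixl 7 _·ᵛ_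

  _≈ᵛ_ : Vector ℝ d → Vector ℝ d → Set
  v ≈ᵛ w = ∀ i → v i ≈ w i

  _+ᵛ_ : Vector ℝ d → Vector ℝ d → Vector ℝ d
  _+ᵛ_ = zipWith _+_

  _·ᵛ_ : ℝ → Vector ℝ d → Vector ℝ d
  a ·ᵛ v = map (a *_) v

  0ᵛ : Vector ℝ d
  0ᵛ = replicate d 0ℝ

  linComb : ∀ {k} → Vector ℝ k → Vector (Vector ℝ d) k → Vector ℝ d
  linComb a b = foldr _+ᵛ_ 0ᵛ (zipWith _·ᵛ_ a b)

record Subspace (d : ℕ) : Set₁ where
  field
    _∈ₛ     : Vector ℝ d → Set
    ∈-resp  : ∀ {v w} → v ≈ᵛ w → v ∈ₛ → w ∈ₛ
    0∈      : 0ᵛ ∈ₛ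
    +-closed : ∀ {v w} → v ∈ₛ → w ∈ₛ → (v +ᵛ w) ∈ₛ
    ·-closed : ∀ a {v} → v ∈ₛ → (a ·ᵛ v) ∈ₛ

infix 4 _∈_

_∈_ : ∀ {d} → Vector ℝ d → Subspace d → Set
v ∈ U = Subspace._∈ₛ U v

record IsBasis {d k} (U : Subspace d) (b : Vector (Vector ℝ d) k) : Set where
  field
    contained   : ∀ i → b i ∈ U
    independent : ∀ a → linComb a b ≈ᵛ 0ᵛ → ∀ i → a i ≈ 0ℝ
    spanning    : ∀ v → v ∈ U → ∃[ a ] v ≈ᵛ linComb a b

HasDimension : ∀ {d} → Subspace d → ℕ → Set
HasDimension {d} U k = Σ (Vector (Vector ℝ d) k) (IsBasis U)

-- The index i : Fin n stands for the integer i + 1 ∈ {1,…,n}.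

Grid : ℕ → ℕ → Set
Grid n d = Vec (Fin n) d

toℝᵈ : ∀ {n d} → Grid n d → Vector ℝ d
toℝᵈ p i = fromℕ (suc (toℕ (lookup p i)))

-- Finite sets of grid points are duplicate-free lists.  A set S is
-- admissible if for every k-dimensional U, each set T ⊆ S ∩ U has at
-- most r - 1 elements.

Admissible : ∀ {n d} → ℕ → ℕ → List (Grid n d) → Set₁
Admissible {n} {d} k r S =
  ∀ (U : Subspace d) → HasDimension U k →
  ∀ (T : List (Grid n d)) → Unique T → T ⊆ˡ S → All (λ p → toℝᵈ p ∈ U) T →
  length T ℕ.≤ r ℕ.∸ 1

-- f-lin d k r n m means f_lin(n,d,k,r) = m.

record f-lin (d k r n m : ℕ) : Set₁ where
  field
    attained : Σ (List (Grid n d)) λ S → Unique S × Admissible k r S × length S ≡ m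
    maximal  : ∀ (S : List (Grid n d)) → Unique S → Admissible k r S → length S ℕ.≤ m

-- IsPower x p q y means y = x^(p/q), for real x ≥ 0 and q ≥ 1.

IsPower : ℝ → ℕ → ℕ → ℝ → Set
IsPower x p q y = 0ℝ ≤ y × y ^ q ≈ x ^ p

-- IsQuotient x y z means z = x / y, for y > 0.

IsQuotient : ℝ → ℝ → ℝ → Set
IsQuotient x y z = 0ℝ < y × z * y ≈ x

-- IsLogRate d k n y means y = n^(d(d-k)/(d-1)) / (log n)^(1/(d-1)).

IsLogRate : ℕ → ℕ → ℕ → ℝ → Set
IsLogRate d k n y =
  ∃[ a ] ∃[ b ] IsPower (fromℕ n) (d ℕ.* (d ℕ.∸ k)) (d ℕ.∸ 1) a
              × IsPower (log n) 1 (d ℕ.∸ 1) b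
              × IsQuotient a b y

-- g₃ d k r n y means g_{d,k,r}(n) = y, and g₂ d k n y means
-- g_{d,k}(n) = y.

data g₃ (d k r n : ℕ) (y : ℝ) : Set where
  r<d : r ℕ.< d →
        IsPower (fromℕ n) (d ℕ.* (r ℕ.∸ k)) (r ℕ.∸ 1) y → g₃ d k r n y
  r≮d : ¬ (r ℕ.< d) → IsLogRate d k n y → g₃ d k r n y

data g₂ (d k n : ℕ) (y : ℝ) : Set where
  k≡d-1 : k ≡ d ℕ.∸ 1 → IsLogRate d k n y → g₂ d k n y
  k≢d-1 : ¬ (k ≡ d ℕ.∸ 1) → IsPower (fromℕ n) d k y → g₂ d k n y

-- f =Ω g as n → ∞, where f n m means f(n) = m and g n y means g(n) = y.
-- f-lin, g₃ and g₂ are relations determining their value uniquely (up to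
-- ≈), so quantifying over all m and y is the same as speaking of the
-- values; g₃ and g₂ have no value for small n where log n = 0.

_=Ω_ : (ℕ → ℕ → Set₁) → (ℕ → ℝ → Set) → Set₁
f =Ω g = ∃[ c ] 0ℝ < c × ∃[ N ] ∀ n → N ℕ.≤ n →
  ∀ m y → f n m → g n y → c * y ≤ fromℕ m

{-# OPTIONS --safe #-}
module Submission where

-- Let e = min(r, d).  The number of e-tuples of grid points in a common
-- k-dimensional subspace is O(n^(dk)) if e < d and O(n^(dk) log n) if
-- e = d; deleting a point from every such tuple in a random set of grid
-- points of suitable density gives the bound.
--
-- To count the tuples, choose in the lattice of integer points of the
-- subspace vectors b₁, b₂, … such that each bᵢ is a shortest one outside
-- the span of its predecessors, and let 2^(aᵢ) be the size of bᵢ.  Covering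
-- by cubes of side 2^(aᵢ) shows that the subspace contains O(∏ n / 2^(aᵢ))
-- grid points, so the number of tuples is at most the sum of
-- ∏ (n / 2^(aᵢ))^e over all choices of the bᵢ.  Reducing bᵢ modulo b₁ at
-- the largest coordinate of b₁ leaves O(2^(aᵢ (d-1) + a₁)) choices for bᵢ,
-- and the resulting sums over a₂, a₃, … are geometric.
--
-- Linear algebra over the reals is used classically, up to double negation;
-- this is harmless because the bound on the number of points in a subspace
-- is decidable.

import Data.Fin.Properties as Fin
open import Data.Fin.Base as Fin using (Fin; zero; suc; toℕ)
import Data.Integer.Base as ℤ
open import Data.Integer.Base using (ℤ; +_; 0ℤ; 1ℤ; ∣_∣)
import Data.Integer.DivMod as ℤ
import Data.Integer.Properties as ℤ
import Data.Integer.Tactic.RingSolver as ℤ-Ring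
open import Data.List.Base as List 
  using (List; []; _∷_; _++_; allFin; cartesianProductWith; concatMap; filter; length; map; take; upTo)
import Data.List.Membership.DecPropositional as DecMembership
open import Data.List.Membership.Propositional using (lose) renaming (_∈_ to _∈ˡ_)
open import Data.List.Membership.Propositional.Properties
  using (∈-allFin; ∈-cartesianProductWith⁺; ∈-concatMap⁺; ∈-filter⁺; ∈-filter⁻; ∈-map⁺; ∈-map⁻; ∈-upTo⁺; ∈-upTo⁻)
import Data.List.Properties as List
open import Data.List.Relation.Binary.Subset.Propositional using () renaming (_⊆_ to _⊆ˡ_)
open import Data.List.Relation.Unary.All as All using (All; []; _∷_)
import Data.List.Relation.Unary.All.Properties as AllP
open import Data.List.Relation.Unary.AllPairs using ([]; _∷_)
open import Data.List.Relation.Unary.Any using (here; there)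
open import Data.List.Relation.Unary.Unique.DecPropositional using (unique?)
open import Data.List.Relation.Unary.Unique.Propositional using (Unique)
open import Data.List.Relation.Unary.Unique.Propositional.Properties
  using (allFin⁺; filter⁺; take⁺) renaming (cartesianProductWith⁺ to unique-product)
open import Data.Nat.Base as ℕ using (ℕ; zero; suc)
import Data.Nat.DivMod as ℕ
import Data.Nat.Properties as ℕ
import Data.Nat.Tactic.RingSolver as ℕ-Ring
open import Data.Product.Base using (∃-syntax; _×_; _,_; proj₁; proj₂)
import Data.Rational.Base as ℚ
open import Data.Rational.Base using (ℚ; 0ℚ; 1ℚ; ½)
import Data.Rational.Properties as ℚ
import Data.Rational.Solver as ℚ-Solver
import Data.Rational.Unnormalised.Base as ℚᵘ
import Data.Rational.Unnormalised.Properties as ℚᵘ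
open import Data.Sum.Base using (_⊎_; inj₁; inj₂)
open import Data.Unit.Base using (⊤; tt)
open import Data.Vec.Base as Vec using (Vec; []; _∷_; lookup; tabulate)
open import Data.Vec.Properties using (length-toList; lookup∘tabulate; ≡-dec)
import Defs
open import Defs
  using (Admissible; Grid; HasDimension; IsBasis; IsCauchy; Subspace; cauchy-bounded; f-lin; fromℚ; linComb; ℝ; 0ℝ; 1ℝ; cauchy; seq)
open import Function.Base using (_∘_; case_of_; id)
open import Level using (0ℓ)
open import Relation.Binary.Definitions using (DecidableEquality)
open import Relation.Binary.PropositionalEquality
  using (_≡_; _≢_; cong; cong₂; refl; subst; subst₂; sym; trans; module ≡-Reasoning)
open import Relation.Nullary.Decidable.Core using (Dec; decidable-stable; no; yes; ¬?; ¬¬-excluded-middle)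
open import Relation.Nullary.Negation using (contradiction; ¬_)
open import Relation.Unary using (Decidable; Pred)

-- Elimination over ℤ

-- Why e stops at d: a first vector of size 2^a has about 2^(ad) choices and carries the weight (n /
-- 2^a)^e. The sum over a is governed by the largest a if e < d, is balanced if e = d, which costs
-- the logarithm, and is governed by a = 0 if e > d. In the last case it bounds the tuples only by
-- n^(ek), and deletion would yield n^(e(d-k)/(e-1)), whose exponent decreases with e. So for r ≥ d
-- it pays to forbid already d points in a subspace.
--
-- The covering argument needs constants that depend on d and e alone, although flags may consist of
-- long and skew vectors. Pivots of maximal absolute value achieve this: over its pivot coordinates
-- the span is a graph of bounded slope, so only as many coordinates have to be subdivided as the
-- span has dimensions.

maxAbs : ∀ {m} (v : Fin (suc m) → ℤ) → ∃[ p ] ∀ i → ∣ v i ∣ ℕ.≤ ∣ v p ∣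
maxAbs {zero}  v = zero , λ { zero → ℕ.≤-refl }
maxAbs {suc m} v with maxAbs (v ∘ suc)
... | p , h with ℕ.≤-total (∣ v zero ∣) (∣ v (suc p) ∣)
...   | inj₁ le = suc p , λ { zero → le ; (suc i) → h i }
...   | inj₂ le = zero , λ { zero → ℕ.≤-refl ; (suc i) → ℕ.≤-trans (h i) le }

-- Fraction-free Gaussian elimination with pivots of maximal absolute
-- value.  A Flag lists integer vectors, the most recent first, each with
-- a scale a : ℕ that bounds its entries by a multiple of 2 ^ a.

module Elimination (m : ℕ) where

  d : ℕ
  d = suc m

  Coords : Set
  Coords = Fin d → ℤ

  Flag : Set
  Flag = List (Vec ℤ d × ℕ)

  pivot : Coords → Fin d
  pivot v = proj₁ (maxAbs v)

  pivot-max : ∀ v i → ∣ v i ∣ ℕ.≤ ∣ v (pivot v) ∣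
  pivot-max v = proj₂ (maxAbs v)

  module _ where
    open import Data.Integer.Base using (_+_; _*_; _-_)

    elim : Coords → Coords → Coords
    elim b v i = b (pivot b) * v i - v (pivot b) * b i

    red : Flag → Coords → Coords
    red []             v = v
    red ((b , _) ∷ bs) v = elim (red bs (lookup b)) (red bs v)

    -- For an independent flag this is membership in its rational span, since `red bs v` is `det bs`
    -- times `v` up to a combination of the flag. As an equation between integers it can be decided,
    -- unlike membership in a real subspace.
    Elim : Flag → Coords → Set
    Elim bs v = ∀ i → red bs v i ≡ 0ℤ

    Elim? : ∀ bs v → Dec (Elim bs v)
    Elim? bs v = Fin.all? λ i → red bs v i ℤ.≟ 0ℤ

    Indep : Flag → Set
    Indep []             = ⊤
    Indep ((b , _) ∷ bs) = (¬ Elim bs (lookup b)) × Indep bs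

    red-cong : ∀ bs {v w} → (∀ i → v i ≡ w i) → ∀ i → red bs v i ≡ red bs w i
    red-cong []             h = h
    red-cong ((b , _) ∷ bs) h i = cong₂ (λ x y → b′ (pivot b′) * x - y * b′ i)
      (red-cong bs h i) (red-cong bs h (pivot b′))
      where b′ = red bs (lookup b)

    red-linear : ∀ bs x v y w i →
      red bs (λ i → x * v i - y * w i) i ≡ x * red bs v i - y * red bs w i
    red-linear []             x v y w i = refl
    red-linear ((b , _) ∷ bs) x v y w i = trans
      (cong₂ (λ s t → b′ (pivot b′) * s - t * b′ i)
        (red-linear bs x v y w i) (red-linear bs x v y w (pivot b′)))
      (eq (b′ (pivot b′)) (b′ i) x y (red bs v i) (red bs w i) (red bs v (pivot b′)) (red bs w (pivot b′)))
      where
      b′ = red bs (lookup b)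
      eq : ∀ p q x y s t s′ t′ → p * (x * s - y * t) - (x * s′ - y * t′) * q
         ≡ x * (p * s - s′ * q) - y * (p * t - t′ * q)
      eq = ℤ-Ring.solve-∀

    Elim-combine : ∀ bs x {v} y {w} → Elim bs v → Elim bs w → Elim bs (λ i → x * v i - y * w i)
    Elim-combine bs x {v} y {w} hv hw i = trans (red-linear bs x v y w i)
      (trans (cong₂ (λ s t → x * s - y * t) (hv i) (hw i)) (eq x y))
      where
      eq : ∀ x y → x * 0ℤ - y * 0ℤ ≡ 0ℤ
      eq = ℤ-Ring.solve-∀

    Elim-cong : ∀ bs {v w} → (∀ i → v i ≡ w i) → Elim bs v → Elim bs w
    Elim-cong bs h hv i = trans (sym (red-cong bs h i)) (hv i)

    Elim-weaken : ∀ b bs {v} → Elim bs v → Elim (b ∷ bs) v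
    Elim-weaken (b , _) bs hv i =
      trans (cong₂ (λ s t → b′ (pivot b′) * s - t * b′ i) (hv i) (hv (pivot b′)))
            (eq (b′ (pivot b′)) (b′ i))
      where
      b′ = red bs (lookup b)
      eq : ∀ p q → p * 0ℤ - 0ℤ * q ≡ 0ℤ
      eq = ℤ-Ring.solve-∀

    Elim-head : ∀ b a bs → Elim ((b , a) ∷ bs) (lookup b)
    Elim-head b a bs i = ℤ.+-inverseʳ (b′ (pivot b′) * b′ i)
      where b′ = red bs (lookup b)

    pivot≡0 : ∀ v → v (pivot v) ≡ 0ℤ → ∀ i → v i ≡ 0ℤ
    pivot≡0 v h i = ℤ.∣i∣≡0⇒i≡0 (ℕ.n≤0⇒n≡0 (subst (∣ v i ∣ ℕ.≤_) (cong ∣_∣ h) (pivot-max v i)))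

    pivots : Flag → List (Fin d)
    pivots []             = []
    pivots ((b , _) ∷ bs) = pivot (red bs (lookup b)) ∷ pivots bs

    length-pivots : ∀ bs → length (pivots bs) ≡ length bs
    length-pivots []       = refl
    length-pivots (_ ∷ bs) = cong suc (length-pivots bs)

    det : Flag → ℤ
    det []             = 1ℤ
    det ((b , _) ∷ bs) = b′ (pivot b′) * det bs
      where b′ = red bs (lookup b)

    det≢0 : ∀ bs → Indep bs → det bs ≢ 0ℤ
    det≢0 []             _          ()
    det≢0 ((b , _) ∷ bs) (h , ind) e with ℤ.i*j≡0⇒i≡0∨j≡0 _ e
    ... | inj₁ p≡0 = h (pivot≡0 _ p≡0)
    ... | inj₂ D≡0 = det≢0 bs ind D≡0

    spreadK : ℕ → ℕ
    spreadK zero    = 0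
    spreadK (suc i) = suc (2 ℕ.* spreadK i)

    -- The step for `b` adds `w p * b′ i` to the error. A maximal pivot gives ∣ `b′ i` ∣ ≤ ∣ `β` ∣,
    -- so relative to the determinant this adds at most ∣ `w p` ∣ / ∣ `D` ∣ ≤ (K + 1) M, and K
    -- becomes 2K + 1. The pair `s`, `M` expresses the bound M / s on the pivot coordinates without
    -- fractions.
    spread : ∀ bs v s M → (∀ {j} → j ∈ˡ pivots bs → ∣ v j ∣ ℕ.* s ℕ.≤ M) → ∀ i →
      ∣ red bs v i - det bs * v i ∣ ℕ.* s ℕ.≤ spreadK (length bs) ℕ.* ∣ det bs ∣ ℕ.* M
    spread []             v s M h i = ℕ.≤-reflexive
      (cong (λ x → ∣ x ∣ ℕ.* s) (eq (v i)))
      where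
      eq : ∀ x → x - 1ℤ * x ≡ 0ℤ
      eq = ℤ-Ring.solve-∀
    spread ((b , _) ∷ bs) v s M h i = begin
      ∣ (β * w i - w p * b′ i) - β * D * v i ∣ ℕ.* s
        ≡⟨ cong (λ x → ∣ x ∣ ℕ.* s) (eq₁ β (w i) (w p) (b′ i) D (v i)) ⟩
      ∣ β * (w i - D * v i) - w p * b′ i ∣ ℕ.* s
        ≤⟨ ℕ.*-monoˡ-≤ s (ℤ.∣i-j∣≤∣i∣+∣j∣ (β * (w i - D * v i)) (w p * b′ i)) ⟩
      (∣ β * (w i - D * v i) ∣ ℕ.+ ∣ w p * b′ i ∣) ℕ.* s
        ≡⟨ cong₂ (λ x y → (x ℕ.+ y) ℕ.* s) (ℤ.abs-* β (w i - D * v i)) (ℤ.abs-* (w p) (b′ i)) ⟩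
      (∣ β ∣ ℕ.* ∣ w i - D * v i ∣ ℕ.+ ∣ w p ∣ ℕ.* ∣ b′ i ∣) ℕ.* s
        ≤⟨ ℕ.*-monoˡ-≤ s (ℕ.+-monoʳ-≤ (∣ β ∣ ℕ.* ∣ w i - D * v i ∣)
             (ℕ.*-monoʳ-≤ (∣ w p ∣) (pivot-max b′ i))) ⟩
      (∣ β ∣ ℕ.* ∣ w i - D * v i ∣ ℕ.+ ∣ w p ∣ ℕ.* ∣ β ∣) ℕ.* s
        ≡⟨ eq₂ (∣ β ∣) (∣ w i - D * v i ∣) (∣ w p ∣) s ⟩
      ∣ β ∣ ℕ.* (∣ w i - D * v i ∣ ℕ.* s ℕ.+ ∣ w p ∣ ℕ.* s)
        ≤⟨ ℕ.*-monoʳ-≤ (∣ β ∣) (ℕ.+-mono-≤ (spread bs v s M (h ∘ there) i) w-bound) ⟩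
      ∣ β ∣ ℕ.* (K ℕ.* ∣ D ∣ ℕ.* M ℕ.+ (K ℕ.* ∣ D ∣ ℕ.* M ℕ.+ ∣ D ∣ ℕ.* M))
        ≡⟨ eq₃ (∣ β ∣) K (∣ D ∣) M ⟩
      suc (2 ℕ.* K) ℕ.* (∣ β ∣ ℕ.* ∣ D ∣) ℕ.* M
        ≡⟨ cong (λ x → suc (2 ℕ.* K) ℕ.* x ℕ.* M) (ℤ.abs-* β D) ⟨
      suc (2 ℕ.* K) ℕ.* ∣ β * D ∣ ℕ.* M ∎
      where
      open ℕ.≤-Reasoning
      b′ = red bs (lookup b)
      p  = pivot b′
      β  = b′ p
      w  = red bs v
      D  = det bs
      K  = spreadK (length bs)
      eq₁ : ∀ β x y z D v → (β * x - y * z) - β * D * v ≡ β * (x - D * v) - y * z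
      eq₁ = ℤ-Ring.solve-∀
      eq₂ : ∀ β x y s → (β ℕ.* x ℕ.+ y ℕ.* β) ℕ.* s ≡ β ℕ.* (x ℕ.* s ℕ.+ y ℕ.* s)
      eq₂ = ℕ-Ring.solve-∀
      eq₃ : ∀ β K D M → β ℕ.* (K ℕ.* D ℕ.* M ℕ.+ (K ℕ.* D ℕ.* M ℕ.+ D ℕ.* M))
          ≡ suc (2 ℕ.* K) ℕ.* (β ℕ.* D) ℕ.* M
      eq₃ = ℕ-Ring.solve-∀
      split : ∀ x y → x ≡ (x - y) + y
      split = ℤ-Ring.solve-∀
      w-bound : ∣ w p ∣ ℕ.* s ℕ.≤ K ℕ.* ∣ D ∣ ℕ.* M ℕ.+ ∣ D ∣ ℕ.* M
      w-bound = begin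
        ∣ w p ∣ ℕ.* s
          ≡⟨ cong (λ x → ∣ x ∣ ℕ.* s) (split (w p) (D * v p)) ⟩
        ∣ (w p - D * v p) + D * v p ∣ ℕ.* s
          ≤⟨ ℕ.*-monoˡ-≤ s (ℤ.∣i+j∣≤∣i∣+∣j∣ (w p - D * v p) (D * v p)) ⟩
        (∣ w p - D * v p ∣ ℕ.+ ∣ D * v p ∣) ℕ.* s
          ≡⟨ trans (ℕ.*-distribʳ-+ s (∣ w p - D * v p ∣) (∣ D * v p ∣))
                   (cong (λ x → ∣ w p - D * v p ∣ ℕ.* s ℕ.+ x)
                     (trans (cong (ℕ._* s) (ℤ.abs-* D (v p))) (ℕ.*-assoc (∣ D ∣) (∣ v p ∣) s))) ⟩
        ∣ w p - D * v p ∣ ℕ.* s ℕ.+ ∣ D ∣ ℕ.* (∣ v p ∣ ℕ.* s)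
          ≤⟨ ℕ.+-mono-≤ (spread bs v s M (h ∘ there) p) (ℕ.*-monoʳ-≤ (∣ D ∣) (h (here refl))) ⟩
        K ℕ.* ∣ D ∣ ℕ.* M ℕ.+ ∣ D ∣ ℕ.* M ∎

    -- Here `red bs v` vanishes, so `spread` bounds `det bs * v` itself and the determinant cancels.
    -- The constant depends only on the number of vectors, not on their size.
    Elim-spread : ∀ bs → Indep bs → ∀ v → Elim bs v → ∀ s M →
      (∀ {j} → j ∈ˡ pivots bs → ∣ v j ∣ ℕ.* s ℕ.≤ M) → ∀ i →
      ∣ v i ∣ ℕ.* s ℕ.≤ spreadK (length bs) ℕ.* M
    Elim-spread bs ind v hv s M h i = ℕ.*-cancelˡ-≤ (∣ D ∣) (begin
      ∣ D ∣ ℕ.* (∣ v i ∣ ℕ.* s)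
        ≡⟨ ℕ.*-assoc (∣ D ∣) (∣ v i ∣) s ⟨
      ∣ D ∣ ℕ.* ∣ v i ∣ ℕ.* s
        ≡⟨ cong (ℕ._* s) (ℤ.abs-* D (v i)) ⟨
      ∣ D * v i ∣ ℕ.* s
        ≡⟨ cong (ℕ._* s) (trans (sym (ℤ.∣-i∣≡∣i∣ (D * v i)))
             (cong ∣_∣ (trans (eq (D * v i)) (cong (_- D * v i) (sym (hv i)))))) ⟩
      ∣ red bs v i - D * v i ∣ ℕ.* s
        ≤⟨ spread bs v s M h i ⟩
      K ℕ.* ∣ D ∣ ℕ.* M
        ≡⟨ swap K (∣ D ∣) M ⟩
      ∣ D ∣ ℕ.* (K ℕ.* M) ∎)
      where
      open ℕ.≤-Reasoning
      D = det bs
      K = spreadK (length bs)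
      instance
        D≢0 : ℕ.NonZero ∣ D ∣
        D≢0 = ℕ.≢-nonZero (det≢0 bs ind ∘ ℤ.∣i∣≡0⇒i≡0)
      eq : ∀ x → ℤ.- x ≡ 0ℤ - x
      eq = ℤ-Ring.solve-∀
      swap : ∀ x y z → x ℕ.* y ℕ.* z ≡ y ℕ.* (x ℕ.* z)
      swap = ℕ-Ring.solve-∀

    -- The intended instance is the set of integer points of a real subspace. `combine` has the
    -- shape of an elimination step, and `saturated`, which comes from scaling by 1/x, allows such a
    -- step to be undone.
    record Lattice : Set₁ where
      field
        Mem       : Coords → Set
        Mem-cong  : ∀ {v w} → (∀ i → v i ≡ w i) → Mem v → Mem w
        Mem-zero  : Mem (λ _ → 0ℤ)
        combine   : ∀ x {v} y {w} → Mem v → Mem w → Mem (λ i → x * v i - y * w i)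
        saturated : ∀ x {v} → x ≢ 0ℤ → Mem (λ i → x * v i) → Mem v

    module _ (Λ : Lattice) where
      open Lattice Λ

      InΛ : Flag → Set
      InΛ = All (Mem ∘ lookup ∘ proj₁)

      red-Mem : ∀ bs → InΛ bs → ∀ {v} → Mem v → Mem (red bs v)
      red-Mem []       []         hv = hv
      red-Mem ((b , _) ∷ bs) (hb ∷ hbs) {v} hv =
        combine (b′ (pivot b′)) (red bs v (pivot b′)) (red-Mem bs hbs hv) (red-Mem bs hbs hb)
        where b′ = red bs (lookup b)

      -- Adding back the multiple of `b′` leaves `β` times the previous reduction, and saturation
      -- divides by the nonzero pivot entry `β`.
      red-Mem⁻ : ∀ bs → Indep bs → InΛ bs → ∀ {v} → Mem (red bs v) → Mem v
      red-Mem⁻ []             _         _          hv = hv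
      red-Mem⁻ ((b , _) ∷ bs) (h , ind) (hb ∷ hbs) {v} hv =
        red-Mem⁻ bs ind hbs (saturated β (λ e → h (pivot≡0 b′ e))
          (Mem-cong (λ i → eq (β * w i) (w (pivot b′)) (b′ i))
            (combine 1ℤ (ℤ.- w (pivot b′)) hv (red-Mem bs hbs hb))))
        where
        b′ = red bs (lookup b)
        β  = b′ (pivot b′)
        w  = red bs v
        eq : ∀ x y z → 1ℤ * (x - y * z) - (ℤ.- y) * z ≡ x
        eq = ℤ-Ring.solve-∀

      Elim⇒Mem : ∀ bs → Indep bs → InΛ bs → ∀ {v} → Elim bs v → Mem v
      Elim⇒Mem bs ind hbs hv = red-Mem⁻ bs ind hbs (Mem-cong (sym ∘ hv) Mem-zero)

-- Grid points in a subspace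

length-filter-¬ : ∀ {A : Set} {P : Pred A 0ℓ} (P? : Decidable P) (xs : List A) →
  length xs ≡ length (filter P? xs) ℕ.+ length (filter (¬? ∘ P?) xs)
length-filter-¬ P? []       = refl
length-filter-¬ P? (x ∷ xs) with P? x
... | yes _ = cong suc (length-filter-¬ P? xs)
... | no  _ = trans (cong suc (length-filter-¬ P? xs)) (sym (ℕ.+-suc _ _))

module _ {X : Set} where

  -- Induction on the number of values, splitting off the fibre over the largest one. The factor `P`
  -- states the fibre bound B / P without division.
  pigeonhole : ∀ (f : X → ℕ) Q P B (W : List X) → Unique W →
    (∀ {x} → x ∈ˡ W → f x ℕ.< Q) →
    (∀ W′ → Unique W′ → W′ ⊆ˡ W → (∀ {x y} → x ∈ˡ W′ → y ∈ˡ W′ → f x ≡ f y) →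
      length W′ ℕ.* P ℕ.≤ B) →
    length W ℕ.* P ℕ.≤ Q ℕ.* B
  pigeonhole f zero    P B []      u hf h = ℕ.z≤n
  pigeonhole f zero    P B (x ∷ W) u hf h = contradiction (hf (here refl)) λ ()
  pigeonhole f (suc Q) P B W       u hf h = begin
    length W ℕ.* P
      ≡⟨ cong (ℕ._* P) (length-filter-¬ Q? W) ⟩
    (length W₁ ℕ.+ length W₂) ℕ.* P
      ≡⟨ ℕ.*-distribʳ-+ P (length W₁) (length W₂) ⟩
    length W₁ ℕ.* P ℕ.+ length W₂ ℕ.* P
      ≤⟨ ℕ.+-mono-≤
          (h W₁ (filter⁺ Q? u) (proj₁ ∘ ∈-filter⁻ Q?)
            λ hx hy → trans (proj₂ (∈-filter⁻ Q? {xs = W} hx)) (sym (proj₂ (∈-filter⁻ Q? {xs = W} hy))))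
          (pigeonhole f Q P B W₂ (filter⁺ (¬? ∘ Q?) u)
            (λ hx → let hx′ , fx≢Q = ∈-filter⁻ (¬? ∘ Q?) {xs = W} hx in
              ℕ.≤∧≢⇒< (ℕ.≤-pred (hf hx′)) fx≢Q)
            (λ W′ u′ s c → h W′ u′ (proj₁ ∘ ∈-filter⁻ (¬? ∘ Q?) ∘ s) c)) ⟩
    B ℕ.+ Q ℕ.* B ∎
    where
    open ℕ.≤-Reasoning
    Q? : Decidable (λ x → f x ≡ Q)
    Q? x = f x ℕ.≟ Q
    W₁ = filter Q? W
    W₂ = filter (¬? ∘ Q?) W

  pigeonhole-All : ∀ {I : Set} (f : I → X → ℕ) Q P B (J : List I) (W : List X) → Unique W →
    (∀ {j x} → j ∈ˡ J → x ∈ˡ W → f j x ℕ.< Q) →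
    (∀ W′ → Unique W′ → W′ ⊆ˡ W →
      (∀ {j} → j ∈ˡ J → ∀ {x y} → x ∈ˡ W′ → y ∈ˡ W′ → f j x ≡ f j y) →
      length W′ ℕ.* P ℕ.≤ B) →
    length W ℕ.* P ℕ.≤ Q ℕ.^ length J ℕ.* B
  pigeonhole-All f Q P B []      W u hf h = subst (length W ℕ.* P ℕ.≤_) (sym (ℕ.*-identityˡ B))
    (h W u id λ ())
  pigeonhole-All f Q P B (j ∷ J) W u hf h = subst (length W ℕ.* P ℕ.≤_) (sym (ℕ.*-assoc Q (Q ℕ.^ length J) B))
    (pigeonhole (f j) Q P (Q ℕ.^ length J ℕ.* B) W u (hf (here refl)) λ W′ u′ s c →
      pigeonhole-All f Q P B J W′ u′ (λ hj hx → hf (there hj) (s hx)) λ W″ u″ s′ c′ →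
        h W″ u″ (s ∘ s′) λ { (here refl) hx hy → c (s′ hx) (s′ hy) ; (there hj) → c′ hj })

/-≡⇒< : ∀ x y n .{{_ : ℕ.NonZero n}} → x ℕ./ n ≡ y ℕ./ n → x ℕ.< y ℕ.+ n
/-≡⇒< x y n e = begin-strict
  x                                  ≡⟨ ℕ.m≡m%n+[m/n]*n x n ⟩
  x ℕ.% n ℕ.+ x ℕ./ n ℕ.* n          <⟨ ℕ.+-monoˡ-< (x ℕ./ n ℕ.* n) (ℕ.m%n<n x n) ⟩
  n ℕ.+ x ℕ./ n ℕ.* n                ≡⟨ cong (λ q → n ℕ.+ q ℕ.* n) e ⟩
  n ℕ.+ y ℕ./ n ℕ.* n                ≤⟨ ℕ.+-monoʳ-≤ n (ℕ.m/n*n≤m y n) ⟩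
  n ℕ.+ y                            ≡⟨ ℕ.+-comm n y ⟩
  y ℕ.+ n                            ∎
  where open ℕ.≤-Reasoning

+∣i+n∣ : ∀ i {n} → ∣ i ∣ ℕ.≤ n → + ∣ i ℤ.+ + n ∣ ≡ i ℤ.+ + n
+∣i+n∣ (+ i)      h = refl
+∣i+n∣ ℤ.-[1+ i ] h = ℤ.0≤i⇒+∣i∣≡i (subst (0ℤ ℤ.≤_) (sym (ℤ.⊖-≥ h)) (ℤ.+≤+ ℕ.z≤n))

∣-∣*-<-ordered : ∀ s n x y → x ℕ.≤ y → y ℕ.* s ℕ.< x ℕ.* s ℕ.+ n → ∣ + x ℤ.- + y ∣ ℕ.* s ℕ.< n
∣-∣*-<-ordered s n x y x≤y h = subst (λ z → z ℕ.* s ℕ.< n)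
  (trans (sym (ℤ.∣⊖∣-≤ x≤y)) (cong ∣_∣ (sym (ℤ.m-n≡m⊖n x y))))
  (ℕ.+-cancelˡ-< (x ℕ.* s) _ _ (subst (ℕ._< x ℕ.* s ℕ.+ n)
    (trans (cong (ℕ._* s) (sym (ℕ.m+[n∸m]≡n x≤y))) (ℕ.*-distribʳ-+ s x (y ℕ.∸ x))) h))

∣-∣*-< : ∀ x y s n → x ℕ.* s ℕ.< y ℕ.* s ℕ.+ n → y ℕ.* s ℕ.< x ℕ.* s ℕ.+ n →
  ∣ + x ℤ.- + y ∣ ℕ.* s ℕ.< n
∣-∣*-< x y s n h₁ h₂ with ℕ.≤-total x y
... | inj₁ x≤y = ∣-∣*-<-ordered s n x y x≤y h₂
... | inj₂ y≤x = subst (λ z → z ℕ.* s ℕ.< n) (ℤ.∣i-j∣≡∣j-i∣ (+ y) (+ x)) (∣-∣*-<-ordered s n y x y≤x h₁)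

^-distribʳ-* : ∀ k x y → (x ℕ.* y) ℕ.^ k ≡ x ℕ.^ k ℕ.* y ℕ.^ k
^-distribʳ-* zero    x y = refl
^-distribʳ-* (suc k) x y = trans (cong (x ℕ.* y ℕ.*_) (^-distribʳ-* k x y)) (eq x y (x ℕ.^ k) (y ℕ.^ k))
  where
  eq : ∀ x y z w → x ℕ.* y ℕ.* (z ℕ.* w) ≡ x ℕ.* z ℕ.* (y ℕ.* w)
  eq = ℕ-Ring.solve-∀

module _ (m : ℕ) where
  open Elimination m

  suc-spreadK : ∀ i → suc (spreadK i) ≡ 2 ℕ.^ i
  suc-spreadK zero    = refl
  suc-spreadK (suc i) = trans (eq (spreadK i)) (cong (2 ℕ.*_) (suc-spreadK i))
    where
    eq : ∀ x → suc (suc (2 ℕ.* x)) ≡ 2 ℕ.* suc x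
    eq = ℕ-Ring.solve-∀

  top : Flag → ℕ
  top []            = 0
  top ((_ , a) ∷ _) = a

  total : Flag → ℕ
  total []             = 0
  total ((_ , a) ∷ bs) = a ℕ.+ total bs

  countC : ℕ → ℕ
  countC zero    = 1
  countC (suc i) = (2 ℕ.^ (i ℕ.+ 3)) ℕ.^ suc i ℕ.* countC i

  module _ (Λ : Lattice) where
    open Lattice Λ

    -- Each b is, up to a constant factor, a shortest element of Λ outside
    -- the span of the vectors before it.

    Minimal : Flag → Set
    Minimal []             = ⊤
    Minimal ((b , a) ∷ bs) =
        (∀ v → Mem v → (∀ j → 2 ℕ.* ∣ v j ∣ ℕ.< 2 ℕ.^ a) → Elim bs v)
      × top bs ℕ.≤ a × Minimal bs

    module _ {X : Set} (ι : X → Coords) (ι-injective : ∀ {x y} → (∀ j → ι x j ≡ ι y j) → x ≡ y) where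
      open import Data.Integer.Base using (_+_; _-_; _*_)

      -- Induction on the flag. Only the pivot coordinates are cut, into intervals of length 2^a /
      -- s, which gives Q^(i+1) cells. The difference of two points in a cell lies in Λ and is
      -- shorter than minimality allows outside the span of `bs`, so it lies in that span, and each
      -- cell is counted by induction with `a` in place of `t`.
      count : ∀ bs → Indep bs → InΛ Λ bs → Minimal bs → ∀ t → top bs ℕ.≤ t →
        ∀ (W : List X) → Unique W →
        (∀ {x y} → x ∈ˡ W → y ∈ˡ W → Elim bs (λ j → ι x j - ι y j)) →
        (∀ {x y} → x ∈ˡ W → y ∈ˡ W → ∀ j → ∣ ι x j - ι y j ∣ ℕ.< 2 ℕ.^ t) →
        length W ℕ.* 2 ℕ.^ total bs ℕ.≤ countC (length bs) ℕ.* (2 ℕ.^ t) ℕ.^ length bs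
      count bs ind mem min t le [] u el sh = ℕ.z≤n
      count [] ind mem min t le (x ∷ []) u el sh = ℕ.≤-refl
      count [] ind mem min t le (x ∷ y ∷ W) ((x≢y ∷ _) ∷ _) el sh =
        contradiction (ι-injective λ j → ℤ.i-j≡0⇒i≡j _ _ (el (here refl) (there (here refl)) j)) x≢y
      count (f@(b , a) ∷ bs) (b∉ , ind) (hb ∷ mem) (short , top≤a , min) t a≤t W@(x₀ ∷ _) u el sh = begin
        length W ℕ.* 2 ℕ.^ (a ℕ.+ total bs)
          ≡⟨ cong (length W ℕ.*_) (ℕ.^-distribˡ-+-* 2 a (total bs)) ⟩
        length W ℕ.* (2 ℕ.^ a ℕ.* 2 ℕ.^ total bs)
          ≡⟨ swap (length W) (2 ℕ.^ a) (2 ℕ.^ total bs) ⟩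
        2 ℕ.^ a ℕ.* (length W ℕ.* 2 ℕ.^ total bs)
          ≤⟨ ℕ.*-monoʳ-≤ (2 ℕ.^ a) (pigeonhole-All cell Q (2 ℕ.^ total bs)
               (countC i ℕ.* (2 ℕ.^ a) ℕ.^ i) (pivots (f ∷ bs)) W u (λ _ hx → cell<Q _ hx) fibre) ⟩
        2 ℕ.^ a ℕ.* (Q ℕ.^ length (pivots (f ∷ bs)) ℕ.* (countC i ℕ.* (2 ℕ.^ a) ℕ.^ i))
          ≡⟨ cong (λ l → 2 ℕ.^ a ℕ.* (Q ℕ.^ l ℕ.* (countC i ℕ.* (2 ℕ.^ a) ℕ.^ i))) (length-pivots (f ∷ bs)) ⟩
        2 ℕ.^ a ℕ.* (Q ℕ.^ suc i ℕ.* (countC i ℕ.* (2 ℕ.^ a) ℕ.^ i))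
          ≡⟨ cong (λ q → 2 ℕ.^ a ℕ.* (q ℕ.* (countC i ℕ.* (2 ℕ.^ a) ℕ.^ i)))
               (trans (cong (ℕ._^ suc i) (ℕ.^-distribˡ-+-* 2 r (i ℕ.+ 3)))
                      (^-distribʳ-* (suc i) (2 ℕ.^ r) (2 ℕ.^ (i ℕ.+ 3)))) ⟩
        2 ℕ.^ a ℕ.* ((2 ℕ.^ r) ℕ.^ suc i ℕ.* (2 ℕ.^ (i ℕ.+ 3)) ℕ.^ suc i ℕ.* (countC i ℕ.* (2 ℕ.^ a) ℕ.^ i))
          ≡⟨ regroup (2 ℕ.^ a) ((2 ℕ.^ r) ℕ.^ suc i) ((2 ℕ.^ (i ℕ.+ 3)) ℕ.^ suc i) (countC i) ((2 ℕ.^ a) ℕ.^ i) ⟩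
        countC (suc i) ℕ.* ((2 ℕ.^ a) ℕ.^ suc i ℕ.* (2 ℕ.^ r) ℕ.^ suc i)
          ≡⟨ cong (countC (suc i) ℕ.*_) (trans (sym (^-distribʳ-* (suc i) (2 ℕ.^ a) (2 ℕ.^ r)))
               (cong (ℕ._^ suc i) 2^a*2^r)) ⟩
        countC (suc i) ℕ.* (2 ℕ.^ t) ℕ.^ suc i ∎
        where
        open ℕ.≤-Reasoning
        i = length bs
        r = t ℕ.∸ a
        -- `Elim-spread` loses a factor below 2^(i+1) = s / 2, so all coordinates of points in one
        -- cell differ by less than 2^a / 2, as `short` requires.
        s = 2 ℕ.^ (i ℕ.+ 2)
        -- The offsets lie below 2 * 2^t, and 2 * 2^t * s / 2^a is exactly this number of intervals.
        Q = 2 ℕ.^ (r ℕ.+ (i ℕ.+ 3))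
        instance
          2^a≢0 : ℕ.NonZero (2 ℕ.^ a)
          2^a≢0 = ℕ.m^n≢0 2 a
          s≢0 : ℕ.NonZero s
          s≢0 = ℕ.m^n≢0 2 (i ℕ.+ 2)
        swap : ∀ x y z → x ℕ.* (y ℕ.* z) ≡ y ℕ.* (x ℕ.* z)
        swap = ℕ-Ring.solve-∀
        regroup : ∀ x y z c w → x ℕ.* (y ℕ.* z ℕ.* (c ℕ.* w)) ≡ z ℕ.* c ℕ.* (x ℕ.* w ℕ.* y)
        regroup = ℕ-Ring.solve-∀
        2^a*2^r : 2 ℕ.^ a ℕ.* 2 ℕ.^ r ≡ 2 ℕ.^ t
        2^a*2^r = trans (sym (ℕ.^-distribˡ-+-* 2 a r)) (cong (2 ℕ.^_) (ℕ.m+[n∸m]≡n a≤t))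
        -- Shifting by `x₀` and 2^t makes all coordinates nonnegative, so that cells come from
        -- division of natural numbers.
        offset : Fin d → X → ℤ
        offset j x = (ι x j - ι x₀ j) + + (2 ℕ.^ t)
        cell : Fin d → X → ℕ
        cell j x = (∣ offset j x ∣ ℕ.* s) ℕ./ 2 ℕ.^ a
        offset≥0 : ∀ j {x} → x ∈ˡ W → + ∣ offset j x ∣ ≡ offset j x
        offset≥0 j {x} hx = +∣i+n∣ (ι x j - ι x₀ j) (ℕ.<⇒≤ (sh hx (here refl) j))
        cell<Q : ∀ j {x} → x ∈ˡ W → cell j x ℕ.< Q
        cell<Q j {x} hx = ℕ.m<n*o⇒m/o<n (begin-strict
          ∣ offset j x ∣ ℕ.* s
            <⟨ ℕ.*-monoˡ-< s (ℕ.≤-<-trans (ℤ.∣i+j∣≤∣i∣+∣j∣ (ι x j - ι x₀ j) (+ (2 ℕ.^ t)))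
                 (ℕ.+-monoˡ-< (2 ℕ.^ t) (sh hx (here refl) j))) ⟩
          (2 ℕ.^ t ℕ.+ 2 ℕ.^ t) ℕ.* s
            ≡⟨ cong (λ z → (z ℕ.+ z) ℕ.* s) (sym 2^a*2^r) ⟩
          (2 ℕ.^ a ℕ.* 2 ℕ.^ r ℕ.+ 2 ℕ.^ a ℕ.* 2 ℕ.^ r) ℕ.* s
            ≡⟨ eq (2 ℕ.^ a) (2 ℕ.^ r) s ⟩
          2 ℕ.^ r ℕ.* (2 ℕ.* s) ℕ.* 2 ℕ.^ a
            ≡⟨ cong (λ z → 2 ℕ.^ r ℕ.* 2 ℕ.^ z ℕ.* 2 ℕ.^ a) (sym (ℕ.+-suc i 2)) ⟩
          2 ℕ.^ r ℕ.* 2 ℕ.^ (i ℕ.+ 3) ℕ.* 2 ℕ.^ a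
            ≡⟨ cong (ℕ._* 2 ℕ.^ a) (sym (ℕ.^-distribˡ-+-* 2 r (i ℕ.+ 3))) ⟩
          Q ℕ.* 2 ℕ.^ a ∎)
          where
          eq : ∀ x y s → (x ℕ.* y ℕ.+ x ℕ.* y) ℕ.* s ≡ y ℕ.* (2 ℕ.* s) ℕ.* x
          eq = ℕ-Ring.solve-∀
        close : ∀ j {x y} → x ∈ˡ W → y ∈ˡ W → cell j x ≡ cell j y →
          ∣ ι x j - ι y j ∣ ℕ.* s ℕ.≤ ℕ.pred (2 ℕ.^ a)
        close j {x} {y} hx hy e = ℕ.<⇒≤pred (subst (λ z → ∣ z ∣ ℕ.* s ℕ.< 2 ℕ.^ a)
          (trans (cong₂ _-_ (offset≥0 j hx) (offset≥0 j hy)) (eq (ι x j) (ι y j) (ι x₀ j) (+ (2 ℕ.^ t))))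
          (∣-∣*-< (∣ offset j x ∣) (∣ offset j y ∣) s (2 ℕ.^ a)
            (/-≡⇒< _ _ (2 ℕ.^ a) e) (/-≡⇒< _ _ (2 ℕ.^ a) (sym e))))
          where
          eq : ∀ x y z w → ((x - z) + w) - ((y - z) + w) ≡ x - y
          eq = ℤ-Ring.solve-∀
        fibre : ∀ W′ → Unique W′ → W′ ⊆ˡ W →
          (∀ {j} → j ∈ˡ pivots (f ∷ bs) → ∀ {x y} → x ∈ˡ W′ → y ∈ˡ W′ → cell j x ≡ cell j y) →
          length W′ ℕ.* 2 ℕ.^ total bs ℕ.≤ countC i ℕ.* (2 ℕ.^ a) ℕ.^ i
        fibre W′ u′ W′⊆W const = count bs ind mem min a top≤a W′ u′
          (λ hx hy → short _ (Elim⇒Mem Λ (f ∷ bs) (b∉ , ind) (hb ∷ mem) (el (W′⊆W hx) (W′⊆W hy)))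
            (λ j → dist hx hy j))
          (λ hx hy j → ℕ.≤-<-trans (ℕ.m≤m+n _ _) (dist hx hy j))
          where
          dist : ∀ {x y} → x ∈ˡ W′ → y ∈ˡ W′ → ∀ j → 2 ℕ.* ∣ ι x j - ι y j ∣ ℕ.< 2 ℕ.^ a
          dist {x} {y} hx hy j = ℕ.m≤pred[n]⇒suc[m]≤n (ℕ.*-cancelʳ-≤ _ _ (2 ℕ.^ suc i) {{ℕ.m^n≢0 2 (suc i)}} (begin
            2 ℕ.* ∣ ι x j - ι y j ∣ ℕ.* 2 ℕ.^ suc i
              ≡⟨ eq (∣ ι x j - ι y j ∣) (2 ℕ.^ suc i) ⟩
            ∣ ι x j - ι y j ∣ ℕ.* 2 ℕ.^ suc (suc i)
              ≡⟨ cong (λ z → ∣ ι x j - ι y j ∣ ℕ.* 2 ℕ.^ z) (ℕ.+-comm 2 i) ⟩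
            ∣ ι x j - ι y j ∣ ℕ.* s
              ≤⟨ Elim-spread (f ∷ bs) (b∉ , ind) (λ j → ι x j - ι y j) (el (W′⊆W hx) (W′⊆W hy)) s _
                   (λ {j} hj → close j (W′⊆W hx) (W′⊆W hy) (const hj hx hy)) j ⟩
            spreadK (suc i) ℕ.* ℕ.pred (2 ℕ.^ a)
              ≤⟨ ℕ.*-monoˡ-≤ _ (ℕ.≤-trans (ℕ.n≤1+n _) (ℕ.≤-reflexive (suc-spreadK (suc i)))) ⟩
            2 ℕ.^ suc i ℕ.* ℕ.pred (2 ℕ.^ a)
              ≡⟨ ℕ.*-comm (2 ℕ.^ suc i) _ ⟩
            ℕ.pred (2 ℕ.^ a) ℕ.* 2 ℕ.^ suc i ∎))
            where
            eq : ∀ x y → 2 ℕ.* x ℕ.* y ≡ x ℕ.* (2 ℕ.* y)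
            eq = ℕ-Ring.solve-∀

-- Enumeration of the tuples in a subspace

sumOver : ∀ {X : Set} → (X → ℕ) → List X → ℕ
sumOver f []       = 0
sumOver f (x ∷ xs) = f x ℕ.+ sumOver f xs

module _ {X : Set} where

  sumOver-mono : ∀ {f g : X → ℕ} xs → (∀ {x} → x ∈ˡ xs → f x ℕ.≤ g x) → sumOver f xs ℕ.≤ sumOver g xs
  sumOver-mono []       h = ℕ.z≤n
  sumOver-mono (x ∷ xs) h = ℕ.+-mono-≤ (h (here refl)) (sumOver-mono xs (h ∘ there))

  sumOver-* : ∀ (f : X → ℕ) c xs → sumOver (λ x → f x ℕ.* c) xs ≡ sumOver f xs ℕ.* c
  sumOver-* f c []       = refl
  sumOver-* f c (x ∷ xs) = trans (cong (f x ℕ.* c ℕ.+_) (sumOver-* f c xs))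
    (sym (ℕ.*-distribʳ-+ c (f x) (sumOver f xs)))

  sumOver-const : ∀ c (xs : List X) → sumOver (λ _ → c) xs ≡ length xs ℕ.* c
  sumOver-const c []       = refl
  sumOver-const c (x ∷ xs) = cong (c ℕ.+_) (sumOver-const c xs)

  sumOver-++ : ∀ (f : X → ℕ) xs ys → sumOver f (xs ++ ys) ≡ sumOver f xs ℕ.+ sumOver f ys
  sumOver-++ f []       ys = refl
  sumOver-++ f (x ∷ xs) ys = trans (cong (f x ℕ.+_) (sumOver-++ f xs ys))
    (sym (ℕ.+-assoc (f x) (sumOver f xs) (sumOver f ys)))

  sumOver-map : ∀ {Y : Set} (f : X → ℕ) (g : Y → X) xs → sumOver f (map g xs) ≡ sumOver (f ∘ g) xs
  sumOver-map f g []       = refl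
  sumOver-map f g (x ∷ xs) = cong (f (g x) ℕ.+_) (sumOver-map f g xs)

  sumOver-concatMap : ∀ {Y : Set} (f : X → ℕ) (g : Y → List X) xs →
    sumOver f (concatMap g xs) ≡ sumOver (λ y → sumOver f (g y)) xs
  sumOver-concatMap f g []       = refl
  sumOver-concatMap f g (x ∷ xs) = trans (sumOver-++ f (g x) (concatMap g xs))
    (cong (sumOver f (g x) ℕ.+_) (sumOver-concatMap f g xs))

  length-concatMap : ∀ {Y : Set} (g : Y → List X) xs →
    length (concatMap g xs) ≡ sumOver (λ y → length (g y)) xs
  length-concatMap g []       = refl
  length-concatMap g (x ∷ xs) = trans (List.length-++ (g x)) (cong (length (g x) ℕ.+_) (length-concatMap g xs))

sumOver-product : ∀ {X Y Z : Set} (f : Z → ℕ) (w : Y → ℕ) c (h : X → Y → Z) →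
  (∀ x y → f (h x y) ≡ c ℕ.* w y) → ∀ xs ys →
  sumOver f (cartesianProductWith h xs ys) ≡ length xs ℕ.* c ℕ.* sumOver w ys
sumOver-product f w c h e []       ys = refl
sumOver-product f w c h e (x ∷ xs) ys = begin
  sumOver f (map (h x) ys ++ cartesianProductWith h xs ys)
    ≡⟨ sumOver-++ f (map (h x) ys) _ ⟩
  sumOver f (map (h x) ys) ℕ.+ sumOver f (cartesianProductWith h xs ys)
    ≡⟨ cong₂ ℕ._+_ (trans (sumOver-map f (h x) ys) (row ys)) (sumOver-product f w c h e xs ys) ⟩
  c ℕ.* sumOver w ys ℕ.+ length xs ℕ.* c ℕ.* sumOver w ys
    ≡⟨ ℕ.*-distribʳ-+ (sumOver w ys) c (length xs ℕ.* c) ⟨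
  suc (length xs) ℕ.* c ℕ.* sumOver w ys ∎
  where
  open ≡-Reasoning
  row : ∀ ys → sumOver (f ∘ h x) ys ≡ c ℕ.* sumOver w ys
  row []       = sym (ℕ.*-zeroʳ c)
  row (y ∷ ys) = trans (cong₂ ℕ._+_ (e x y) (row ys)) (sym (ℕ.*-distribˡ-+ c (w y) (sumOver w ys)))

sumOver-upTo : ∀ (f : ℕ → ℕ) n → sumOver f (upTo (suc n)) ≡ sumOver f (upTo n) ℕ.+ f n
sumOver-upTo f n = trans (cong (sumOver f) (sym (List.upTo-∷ʳ n)))
  (trans (sumOver-++ f (upTo n) (n ∷ [])) (cong (sumOver f (upTo n) ℕ.+_) (ℕ.+-identityʳ (f n))))

geometric-↓ : ∀ f Y n → (∀ {u} → u ℕ.< n → f u ℕ.* 2 ℕ.^ u ℕ.≤ Y) → sumOver f (upTo n) ℕ.≤ 2 ℕ.* Y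
geometric-↓ f Y n h = ℕ.*-cancelˡ-≤ (2 ℕ.^ n) {{ℕ.m^n≢0 2 n}}
  (ℕ.≤-trans (ℕ.m≤m+n _ (2 ℕ.* Y)) (ℕ.≤-trans (go n h) (ℕ.≤-reflexive (eq (2 ℕ.^ n) Y))))
  where
  open ℕ.≤-Reasoning
  eq : ∀ x y → 2 ℕ.* x ℕ.* y ≡ x ℕ.* (2 ℕ.* y)
  eq = ℕ-Ring.solve-∀
  eq₁ : ∀ p s x y → 2 ℕ.* p ℕ.* (s ℕ.+ x) ℕ.+ 2 ℕ.* y ≡ 2 ℕ.* (p ℕ.* s ℕ.+ (x ℕ.* p ℕ.+ y))
  eq₁ = ℕ-Ring.solve-∀
  eq₂ : ∀ p y s → 2 ℕ.* (s ℕ.+ 2 ℕ.* y) ≡ 2 ℕ.* s ℕ.+ 2 ℕ.* (2 ℕ.* y)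
  eq₂ = ℕ-Ring.solve-∀
  -- The induction needs the sharper bound 2Y (1 - 2^(-n)), written without denominators.
  go : ∀ n → (∀ {u} → u ℕ.< n → f u ℕ.* 2 ℕ.^ u ℕ.≤ Y) →
    2 ℕ.^ n ℕ.* sumOver f (upTo n) ℕ.+ 2 ℕ.* Y ℕ.≤ 2 ℕ.* 2 ℕ.^ n ℕ.* Y
  go zero    h = ℕ.≤-refl
  go (suc n) h = begin
    2 ℕ.* 2 ℕ.^ n ℕ.* sumOver f (upTo (suc n)) ℕ.+ 2 ℕ.* Y
      ≡⟨ cong (λ s → 2 ℕ.* 2 ℕ.^ n ℕ.* s ℕ.+ 2 ℕ.* Y) (sumOver-upTo f n) ⟩
    2 ℕ.* 2 ℕ.^ n ℕ.* (sumOver f (upTo n) ℕ.+ f n) ℕ.+ 2 ℕ.* Y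
      ≡⟨ eq₁ (2 ℕ.^ n) (sumOver f (upTo n)) (f n) Y ⟩
    2 ℕ.* (2 ℕ.^ n ℕ.* sumOver f (upTo n) ℕ.+ (f n ℕ.* 2 ℕ.^ n ℕ.+ Y))
      ≤⟨ ℕ.*-monoʳ-≤ 2 (ℕ.+-monoʳ-≤ (2 ℕ.^ n ℕ.* sumOver f (upTo n)) (ℕ.+-monoˡ-≤ Y (h ℕ.≤-refl))) ⟩
    2 ℕ.* (2 ℕ.^ n ℕ.* sumOver f (upTo n) ℕ.+ (Y ℕ.+ Y))
      ≡⟨ cong (λ z → 2 ℕ.* (2 ℕ.^ n ℕ.* sumOver f (upTo n) ℕ.+ (Y ℕ.+ z))) (sym (ℕ.+-identityʳ Y)) ⟩
    2 ℕ.* (2 ℕ.^ n ℕ.* sumOver f (upTo n) ℕ.+ 2 ℕ.* Y)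
      ≤⟨ ℕ.*-monoʳ-≤ 2 (go n (h ∘ ℕ.m<n⇒m<1+n)) ⟩
    2 ℕ.* (2 ℕ.* 2 ℕ.^ n ℕ.* Y)
      ≡⟨ ℕ.*-assoc 2 (2 ℕ.* 2 ℕ.^ n) Y ⟨
    2 ℕ.* (2 ℕ.* 2 ℕ.^ n) ℕ.* Y ∎

geometric-↑ : ∀ f Y M → (∀ {u} → u ℕ.≤ M → f u ℕ.* 2 ℕ.^ M ℕ.≤ Y ℕ.* 2 ℕ.^ u) →
  sumOver f (upTo (suc M)) ℕ.≤ 2 ℕ.* Y
geometric-↑ f Y M h = ℕ.*-cancelʳ-≤ _ _ (2 ℕ.^ M) {{ℕ.m^n≢0 2 M}}
  (ℕ.≤-trans (go (suc M) (h ∘ ℕ.≤-pred)) (ℕ.≤-reflexive (eq (2 ℕ.^ M) Y)))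
  where
  open ℕ.≤-Reasoning
  eq : ∀ x y → y ℕ.* (2 ℕ.* x) ≡ 2 ℕ.* y ℕ.* x
  eq = ℕ-Ring.solve-∀
  eq′ : ∀ x y → x ℕ.* y ℕ.+ x ℕ.* y ≡ x ℕ.* (2 ℕ.* y)
  eq′ = ℕ-Ring.solve-∀
  go : ∀ n → (∀ {u} → u ℕ.< n → f u ℕ.* 2 ℕ.^ M ℕ.≤ Y ℕ.* 2 ℕ.^ u) →
    sumOver f (upTo n) ℕ.* 2 ℕ.^ M ℕ.≤ Y ℕ.* 2 ℕ.^ n
  go zero    h = ℕ.z≤n
  go (suc n) h = begin
    sumOver f (upTo (suc n)) ℕ.* 2 ℕ.^ M
      ≡⟨ cong (ℕ._* 2 ℕ.^ M) (sumOver-upTo f n) ⟩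
    (sumOver f (upTo n) ℕ.+ f n) ℕ.* 2 ℕ.^ M
      ≡⟨ ℕ.*-distribʳ-+ (2 ℕ.^ M) (sumOver f (upTo n)) (f n) ⟩
    sumOver f (upTo n) ℕ.* 2 ℕ.^ M ℕ.+ f n ℕ.* 2 ℕ.^ M
      ≤⟨ ℕ.+-mono-≤ (go n (h ∘ ℕ.m<n⇒m<1+n)) (h ℕ.≤-refl) ⟩
    Y ℕ.* 2 ℕ.^ n ℕ.+ Y ℕ.* 2 ℕ.^ n
      ≡⟨ eq′ Y (2 ℕ.^ n) ⟩
    Y ℕ.* 2 ℕ.^ suc n ∎

length-product : ∀ {X Y Z : Set} (h : X → Y → Z) xs ys →
  length (cartesianProductWith h xs ys) ≡ length xs ℕ.* length ys
length-product h []       ys = refl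
length-product h (x ∷ xs) ys = trans (List.length-++ (map (h x) ys))
  (cong₂ ℕ._+_ (List.length-map (h x) ys) (length-product h xs ys))

vectors : ∀ {X : Set} {n} → (Fin n → List X) → List (Vec X n)
vectors {n = zero}  r = [] ∷ []
vectors {n = suc n} r = cartesianProductWith _∷_ (r zero) (vectors (r ∘ suc))

∈-vectors : ∀ {X : Set} {n} (r : Fin n → List X) (v : Vec X n) → (∀ i → lookup v i ∈ˡ r i) → v ∈ˡ vectors r
∈-vectors r []      h = here refl
∈-vectors r (x ∷ v) h = ∈-cartesianProductWith⁺ _∷_ (h zero) (∈-vectors (r ∘ suc) v (h ∘ suc))

module _ {X : Set} where

  length-vectors : ∀ {n} (r : Fin n → List X) Y → (∀ i → length (r i) ℕ.≤ Y) → length (vectors r) ℕ.≤ Y ℕ.^ n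
  length-vectors {zero}  r Y h = ℕ.≤-refl
  length-vectors {suc n} r Y h = subst (ℕ._≤ Y ℕ.^ suc n) (sym (length-product _∷_ (r zero) _))
    (ℕ.*-mono-≤ (h zero) (length-vectors (r ∘ suc) Y (h ∘ suc)))

  -- The coordinate `p` with its own bound is the one reduced modulo the first vector of the flag.
  length-vectors-at : ∀ {n} (r : Fin (suc n) → List X) p Y Z → length (r p) ℕ.≤ Z →
    (∀ i → i ≢ p → length (r i) ℕ.≤ Y) → length (vectors r) ℕ.≤ Z ℕ.* Y ℕ.^ n
  length-vectors-at r zero Y Z hp h = subst (ℕ._≤ _) (sym (length-product _∷_ (r zero) _))
    (ℕ.*-mono-≤ hp (length-vectors (r ∘ suc) Y λ i → h (suc i) λ ()))
  length-vectors-at {suc n} r (suc p) Y Z hp h = subst (ℕ._≤ _) (sym (length-product _∷_ (r zero) _))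
    (ℕ.≤-trans
      (ℕ.*-mono-≤ (h zero λ ()) (length-vectors-at (r ∘ suc) p Y Z hp λ i i≢p → h (suc i) (i≢p ∘ Fin.suc-injective)))
      (ℕ.≤-reflexive (eq Y Z (Y ℕ.^ n))))
    where
    eq : ∀ x y z → x ℕ.* (y ℕ.* z) ≡ y ℕ.* (x ℕ.* z)
    eq = ℕ-Ring.solve-∀

symInterval : ℕ → List ℤ
symInterval M = map (λ i → + i ℤ.- + M) (upTo (suc (2 ℕ.* M)))

∈-symInterval : ∀ M z → ∣ z ∣ ℕ.≤ M → z ∈ˡ symInterval M
∈-symInterval M z h = subst (_∈ˡ symInterval M) (trans (cong (ℤ._- + M) (+∣i+n∣ z h)) (eq z (+ M)))
  (∈-map⁺ (λ i → + i ℤ.- + M) (∈-upTo⁺ (ℕ.s≤s (begin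
    ∣ z ℤ.+ + M ∣   ≤⟨ ℤ.∣i+j∣≤∣i∣+∣j∣ z (+ M) ⟩
    ∣ z ∣ ℕ.+ M     ≤⟨ ℕ.+-monoˡ-≤ M h ⟩
    M ℕ.+ M         ≡⟨ cong (M ℕ.+_) (ℕ.+-identityʳ M) ⟨
    2 ℕ.* M         ∎))))
  where
  open ℕ.≤-Reasoning
  eq : ∀ x y → x ℤ.+ y ℤ.- y ≡ x
  eq = ℤ-Ring.solve-∀

length-symInterval : ∀ a → length (symInterval (2 ℕ.^ (a ℕ.+ 2))) ℕ.≤ 2 ℕ.^ (a ℕ.+ 4)
length-symInterval a = begin
  length (symInterval M)        ≡⟨ trans (List.length-map _ (upTo (suc (2 ℕ.* M)))) (List.length-upTo (suc (2 ℕ.* M))) ⟩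
  1 ℕ.+ 2 ℕ.* M                 ≤⟨ ℕ.+-monoˡ-≤ (2 ℕ.* M) (ℕ.≤-trans (ℕ.m^n>0 2 (a ℕ.+ 2)) (ℕ.m≤m+n M _)) ⟩
  2 ℕ.* M ℕ.+ 2 ℕ.* M           ≡⟨ eq M ⟩
  M ℕ.* 2 ℕ.^ 2                 ≡⟨ ℕ.^-distribˡ-+-* 2 (a ℕ.+ 2) 2 ⟨
  2 ℕ.^ (a ℕ.+ 2 ℕ.+ 2)         ≡⟨ cong (2 ℕ.^_) (ℕ.+-assoc a 2 2) ⟩
  2 ℕ.^ (a ℕ.+ 4)               ∎
  where
  open ℕ.≤-Reasoning
  M = 2 ℕ.^ (a ℕ.+ 2)
  eq : ∀ x → 2 ℕ.* x ℕ.+ 2 ℕ.* x ≡ x ℕ.* 4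
  eq = ℕ-Ring.solve-∀

∈-concatMap : ∀ {X Y : Set} (f : X → List Y) {xs x y} → x ∈ˡ xs → y ∈ˡ f x → y ∈ˡ concatMap f xs
∈-concatMap f hx hy = ∈-concatMap⁺ f (lose hx hy)

edgesK : ℕ → (ℕ → ℕ) → ℕ → ℕ
edgesK m C k = sumOver (λ i → 16 ℕ.^ suc m ℕ.* (2 ℕ.* 16 ℕ.^ m) ℕ.^ i ℕ.* C (suc i)) (upTo k)

module Enumeration (m A e : ℕ) {X : Set} (points : List X) (ι : X → Elimination.Coords m) where
  open Elimination m

  starts : ℕ → List (Vec ℤ d)
  starts a = vectors (λ _ → symInterval (2 ℕ.^ (a ℕ.+ 2)))

  -- Division by the pivot entry of `b₁` leaves a remainder below 2^a₁ there; the other entries grow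
  -- from 2^a to at most 3 * 2^a, hence the range 2^(a+2).
  stepRange : Vec ℤ d → ℕ → ℕ → Fin d → List ℤ
  stepRange b₁ a₁ a i with i Fin.≟ pivot (lookup b₁)
  ... | yes _ = map +_ (upTo (2 ℕ.^ a₁))
  ... | no  _ = symInterval (2 ℕ.^ (a ℕ.+ 2))

  steps : Vec ℤ d → ℕ → ℕ → List (Vec ℤ d)
  steps b₁ a₁ a = vectors (stepRange b₁ a₁ a)

  -- The flags of suc i vectors that begin with b₁.  The later vectors are
  -- reduced modulo b₁ at the pivot of b₁, which leaves fewer of them by a factor
  -- 2 ^ (a - a₁); this is what leaves a single logarithm when e = d.

  extensions : Vec ℤ d → ℕ → ℕ → List Flag
  extensions b₁ a₁ zero    = ((b₁ , a₁) ∷ []) ∷ []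
  extensions b₁ a₁ (suc i) = concatMap
    (λ u → cartesianProductWith (λ b bs → (b , a₁ ℕ.+ u) ∷ bs) (steps b₁ a₁ (a₁ ℕ.+ u)) (extensions b₁ a₁ i))
    (upTo (suc (A ℕ.∸ a₁)))

  flags : ℕ → List Flag
  flags i = concatMap (λ a → concatMap (λ b → extensions b a i) (starts a)) (upTo (suc A))

  weight : Flag → ℕ
  weight []             = 1
  weight ((_ , a) ∷ bs) = (2 ℕ.^ (A ℕ.∸ a)) ℕ.^ e ℕ.* weight bs

  section : Flag → List X
  section bs = filter (λ x → Elim? bs (ι x)) points

  -- The test discards flags that are not minimal, without having to
  -- decide minimality.

  tuples : ℕ → Flag → List (Vec X e)
  tuples C bs with length (section bs) ℕ.^ e ℕ.≤? C ℕ.* weight bs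
  ... | yes _ = vectors (λ _ → section bs)
  ... | no  _ = []

  length-tuples : ∀ C bs → length (tuples C bs) ℕ.≤ weight bs ℕ.* C
  length-tuples C bs with length (section bs) ℕ.^ e ℕ.≤? C ℕ.* weight bs
  ... | yes h = ℕ.≤-trans (length-vectors {n = e} (λ _ → section bs) _ λ _ → ℕ.≤-refl)
                  (ℕ.≤-trans h (ℕ.≤-reflexive (ℕ.*-comm C (weight bs))))
  ... | no  _ = ℕ.z≤n

  ∈-tuples : ∀ C bs v → length (section bs) ℕ.^ e ℕ.≤ C ℕ.* weight bs →
    (∀ i → lookup v i ∈ˡ points) → (∀ i → Elim bs (ι (lookup v i))) → v ∈ˡ tuples C bs
  ∈-tuples C bs v h hp he with length (section bs) ℕ.^ e ℕ.≤? C ℕ.* weight bs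
  ... | yes _ = ∈-vectors _ v λ i → ∈-filter⁺ (λ x → Elim? bs (ι x)) (hp i) (he i)
  ... | no ¬h = contradiction h ¬h

  edges : (ℕ → ℕ) → ℕ → List (Vec X e)
  edges C k = concatMap (λ i → concatMap (tuples (C (suc i))) (flags i)) (upTo k)

  -- The index is the factor by which the number of tuples may exceed the order N^k: the number of
  -- scales, of order log n, if e = d, and the value 2 of a geometric series if e < d.
  data Rate : ℕ → Set where
    e≡d : e ≡ d → Rate (suc A)
    e<d : e ℕ.< d → Rate 2

  private
    N : ℕ
    N = (2 ℕ.^ A) ℕ.^ d

  length-starts : ∀ a → length (starts a) ℕ.≤ (2 ℕ.^ (a ℕ.+ 4)) ℕ.^ d
  length-starts a = length-vectors {n = d} (λ _ → symInterval (2 ℕ.^ (a ℕ.+ 2))) _ λ _ → length-symInterval a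

  length-steps : ∀ b₁ a₁ a → length (steps b₁ a₁ a) ℕ.≤ 2 ℕ.^ a₁ ℕ.* (2 ℕ.^ (a ℕ.+ 4)) ℕ.^ m
  length-steps b₁ a₁ a = length-vectors-at (stepRange b₁ a₁ a) (pivot (lookup b₁)) _ _ at-pivot off-pivot
    where
    at-pivot : length (stepRange b₁ a₁ a (pivot (lookup b₁))) ℕ.≤ 2 ℕ.^ a₁
    at-pivot with pivot (lookup b₁) Fin.≟ pivot (lookup b₁)
    ... | yes _ = ℕ.≤-reflexive (trans (List.length-map _ (upTo (2 ℕ.^ a₁))) (List.length-upTo _))
    ... | no ≢  = contradiction refl ≢
    off-pivot : ∀ i → i ≢ pivot (lookup b₁) → length (stepRange b₁ a₁ a i) ℕ.≤ 2 ℕ.^ (a ℕ.+ 4)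
    off-pivot i i≢p with i Fin.≟ pivot (lookup b₁)
    ... | yes i≡p = contradiction i≡p i≢p
    ... | no  _   = length-symInterval a

  private
    -- Since `P * U * W` is 2^A, writing all powers in terms of `P`, `U` and `W` turns the
    -- comparison of exponents into ring identities.
    module Powers {a₁ u} (a₁≤A : a₁ ℕ.≤ A) (u≤ : u ℕ.≤ A ℕ.∸ a₁) where
      P U W : ℕ
      P = 2 ℕ.^ a₁
      U = 2 ℕ.^ u
      W = 2 ℕ.^ (A ℕ.∸ (a₁ ℕ.+ u))

      2^[A∸a₁] : 2 ℕ.^ (A ℕ.∸ a₁) ≡ U ℕ.* W
      2^[A∸a₁] = trans (cong (2 ℕ.^_) (sym (ℕ.m+[n∸m]≡n u≤)))
        (trans (ℕ.^-distribˡ-+-* 2 u (A ℕ.∸ a₁ ℕ.∸ u)) (cong (λ z → U ℕ.* 2 ℕ.^ z) (ℕ.∸-+-assoc A a₁ u)))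

      N≡ : N ≡ P ℕ.* U ℕ.* W ℕ.* ((P ℕ.* U) ℕ.^ m ℕ.* W ℕ.^ m)
      N≡ = trans (cong (ℕ._^ d) (trans (cong (2 ℕ.^_) (sym (ℕ.m+[n∸m]≡n a₁≤A)))
             (trans (ℕ.^-distribˡ-+-* 2 a₁ (A ℕ.∸ a₁)) (trans (cong (P ℕ.*_) 2^[A∸a₁]) (sym (ℕ.*-assoc P U W))))))
             (cong (P ℕ.* U ℕ.* W ℕ.*_) (^-distribʳ-* m (P ℕ.* U) W))

      [2^[a+4]]^ : ∀ j → (2 ℕ.^ (a₁ ℕ.+ u ℕ.+ 4)) ℕ.^ j ≡ (P ℕ.* U) ℕ.^ j ℕ.* 16 ℕ.^ j
      [2^[a+4]]^ j = trans (cong (ℕ._^ j) (trans (ℕ.^-distribˡ-+-* 2 (a₁ ℕ.+ u) 4) (cong (ℕ._* 16) (ℕ.^-distribˡ-+-* 2 a₁ u))))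
        (^-distribʳ-* j (P ℕ.* U) 16)

  stepWeight : ℕ → ℕ → ℕ
  stepWeight a₁ a = 2 ℕ.^ a₁ ℕ.* (2 ℕ.^ (a ℕ.+ 4)) ℕ.^ m ℕ.* (2 ℕ.^ (A ℕ.∸ a)) ℕ.^ e

  open ℕ.≤-Reasoning

  -- If e = d, the term for `u` is bounded by 16^m N / 2^u; this decay is the factor gained at the
  -- pivot of `b₁`. If e < d, then W^e ≤ W^m bounds every term by 16^m N / 2^(A - a₁), which lies
  -- below an increasing geometric series.
  sum-stepWeight : ∀ {ℓ} → Rate ℓ → ∀ a₁ → a₁ ℕ.≤ A →
    sumOver (λ u → stepWeight a₁ (a₁ ℕ.+ u)) (upTo (suc (A ℕ.∸ a₁))) ℕ.≤ 2 ℕ.* (16 ℕ.^ m ℕ.* N)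
  sum-stepWeight (e≡d refl) a₁ a₁≤A = geometric-↓ _ _ (suc (A ℕ.∸ a₁)) λ {u} u< →
    let open Powers a₁≤A (ℕ.≤-pred u<) in begin
    P ℕ.* (2 ℕ.^ (a₁ ℕ.+ u ℕ.+ 4)) ℕ.^ m ℕ.* (W ℕ.* W ℕ.^ m) ℕ.* U
      ≡⟨ cong (λ z → P ℕ.* z ℕ.* (W ℕ.* W ℕ.^ m) ℕ.* U) ([2^[a+4]]^ m) ⟩
    P ℕ.* ((P ℕ.* U) ℕ.^ m ℕ.* 16 ℕ.^ m) ℕ.* (W ℕ.* W ℕ.^ m) ℕ.* U
      ≡⟨ eq P U W ((P ℕ.* U) ℕ.^ m) (16 ℕ.^ m) (W ℕ.^ m) ⟩
    16 ℕ.^ m ℕ.* (P ℕ.* U ℕ.* W ℕ.* ((P ℕ.* U) ℕ.^ m ℕ.* W ℕ.^ m))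
      ≡⟨ cong (16 ℕ.^ m ℕ.*_) N≡ ⟨
    16 ℕ.^ m ℕ.* N ∎
    where
    eq : ∀ P U W x c y → P ℕ.* (x ℕ.* c) ℕ.* (W ℕ.* y) ℕ.* U ≡ c ℕ.* (P ℕ.* U ℕ.* W ℕ.* (x ℕ.* y))
    eq = ℕ-Ring.solve-∀
  sum-stepWeight (e<d lt) a₁ a₁≤A = geometric-↑ _ (16 ℕ.^ m ℕ.* N) (A ℕ.∸ a₁) λ {u} u≤ →
    let open Powers a₁≤A u≤ in begin
    P ℕ.* (2 ℕ.^ (a₁ ℕ.+ u ℕ.+ 4)) ℕ.^ m ℕ.* W ℕ.^ e ℕ.* 2 ℕ.^ (A ℕ.∸ a₁)
      ≡⟨ cong₂ (λ z y → P ℕ.* z ℕ.* W ℕ.^ e ℕ.* y) ([2^[a+4]]^ m) 2^[A∸a₁] ⟩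
    P ℕ.* ((P ℕ.* U) ℕ.^ m ℕ.* 16 ℕ.^ m) ℕ.* W ℕ.^ e ℕ.* (U ℕ.* W)
      ≤⟨ ℕ.*-monoˡ-≤ (U ℕ.* W) (ℕ.*-monoʳ-≤ (P ℕ.* ((P ℕ.* U) ℕ.^ m ℕ.* 16 ℕ.^ m))
           (ℕ.^-monoʳ-≤ W {{ℕ.m^n≢0 2 (A ℕ.∸ (a₁ ℕ.+ u))}} (ℕ.≤-pred lt))) ⟩
    P ℕ.* ((P ℕ.* U) ℕ.^ m ℕ.* 16 ℕ.^ m) ℕ.* W ℕ.^ m ℕ.* (U ℕ.* W)
      ≡⟨ eq P U W ((P ℕ.* U) ℕ.^ m) (16 ℕ.^ m) (W ℕ.^ m) ⟩
    16 ℕ.^ m ℕ.* (P ℕ.* U ℕ.* W ℕ.* ((P ℕ.* U) ℕ.^ m ℕ.* W ℕ.^ m))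
      ≡⟨ cong (16 ℕ.^ m ℕ.*_) N≡ ⟨
    16 ℕ.^ m ℕ.* N
      ≤⟨ ℕ.m≤m*n (16 ℕ.^ m ℕ.* N) U {{ℕ.m^n≢0 2 u}} ⟩
    16 ℕ.^ m ℕ.* N ℕ.* U ∎
    where
    eq : ∀ P U W x c y → P ℕ.* (x ℕ.* c) ℕ.* y ℕ.* (U ℕ.* W) ≡ c ℕ.* (P ℕ.* U ℕ.* W ℕ.* (x ℕ.* y))
    eq = ℕ-Ring.solve-∀

  -- The first vector has nothing to be reduced by. If e = d, all A + 1 scales contribute the same
  -- amount 16^d N, and this is the source of the logarithm; if e < d, the terms grow geometrically
  -- with the scale.
  sum-startWeight : ∀ {ℓ} → Rate ℓ →
    sumOver (λ a → (2 ℕ.^ (a ℕ.+ 4)) ℕ.^ d ℕ.* (2 ℕ.^ (A ℕ.∸ a)) ℕ.^ e) (upTo (suc A)) ℕ.≤ ℓ ℕ.* (16 ℕ.^ d ℕ.* N)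
  sum-startWeight (e≡d refl) = begin
    sumOver (λ a → (2 ℕ.^ (a ℕ.+ 4)) ℕ.^ d ℕ.* (2 ℕ.^ (A ℕ.∸ a)) ℕ.^ d) (upTo (suc A))
      ≤⟨ sumOver-mono (upTo (suc A)) (λ {a} ha → ℕ.≤-reflexive (term a (ℕ.≤-pred (∈-upTo⁻ ha)))) ⟩
    sumOver (λ _ → 16 ℕ.^ d ℕ.* N) (upTo (suc A))
      ≡⟨ sumOver-const (16 ℕ.^ d ℕ.* N) (upTo (suc A)) ⟩
    length (upTo (suc A)) ℕ.* (16 ℕ.^ d ℕ.* N)
      ≡⟨ cong (ℕ._* (16 ℕ.^ d ℕ.* N)) (List.length-upTo (suc A)) ⟩
    suc A ℕ.* (16 ℕ.^ d ℕ.* N) ∎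
    where
    term : ∀ u → u ℕ.≤ A → (2 ℕ.^ (u ℕ.+ 4)) ℕ.^ d ℕ.* (2 ℕ.^ (A ℕ.∸ u)) ℕ.^ d ≡ 16 ℕ.^ d ℕ.* N
    term u u≤ = trans (cong (ℕ._* W ℕ.^ d) ([2^[a+4]]^ d))
      (trans (eq U W (16 ℕ.^ d) ((1 ℕ.* U) ℕ.^ m) (W ℕ.^ m)) (cong (16 ℕ.^ d ℕ.*_) (sym N≡)))
      where
      open Powers {0} {u} ℕ.z≤n u≤
      eq : ∀ U W c x y → (1 ℕ.* U) ℕ.* x ℕ.* c ℕ.* (W ℕ.* y) ≡ c ℕ.* (1 ℕ.* U ℕ.* W ℕ.* (x ℕ.* y))
      eq = ℕ-Ring.solve-∀
  sum-startWeight (e<d lt) = geometric-↑ _ (16 ℕ.^ d ℕ.* N) A λ {u} u≤ →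
    let open Powers {0} {u} ℕ.z≤n u≤ in begin
    (2 ℕ.^ (u ℕ.+ 4)) ℕ.^ d ℕ.* W ℕ.^ e ℕ.* 2 ℕ.^ A
      ≡⟨ cong₂ (λ z y → z ℕ.* W ℕ.^ e ℕ.* y) ([2^[a+4]]^ d) 2^[A∸a₁] ⟩
    (P ℕ.* U) ℕ.^ d ℕ.* 16 ℕ.^ d ℕ.* W ℕ.^ e ℕ.* (U ℕ.* W)
      ≤⟨ ℕ.*-monoˡ-≤ (U ℕ.* W) (ℕ.*-monoʳ-≤ ((P ℕ.* U) ℕ.^ d ℕ.* 16 ℕ.^ d)
           (ℕ.^-monoʳ-≤ W {{ℕ.m^n≢0 2 (A ℕ.∸ u)}} (ℕ.≤-pred lt))) ⟩
    (P ℕ.* U) ℕ.^ d ℕ.* 16 ℕ.^ d ℕ.* W ℕ.^ m ℕ.* (U ℕ.* W)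
      ≡⟨ eq P U W ((P ℕ.* U) ℕ.^ m) (16 ℕ.^ d) (W ℕ.^ m) ⟩
    16 ℕ.^ d ℕ.* (P ℕ.* U ℕ.* W ℕ.* ((P ℕ.* U) ℕ.^ m ℕ.* W ℕ.^ m)) ℕ.* U
      ≡⟨ cong (λ z → 16 ℕ.^ d ℕ.* z ℕ.* U) N≡ ⟨
    16 ℕ.^ d ℕ.* N ℕ.* U ∎
    where
    eq : ∀ P U W x c y → (P ℕ.* U) ℕ.* x ℕ.* c ℕ.* y ℕ.* (U ℕ.* W)
       ≡ c ℕ.* (P ℕ.* U ℕ.* W ℕ.* (x ℕ.* y)) ℕ.* U
    eq = ℕ-Ring.solve-∀

  sum-extensions : ∀ {ℓ} → Rate ℓ → ∀ b₁ a₁ → a₁ ℕ.≤ A → ∀ i →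
    sumOver weight (extensions b₁ a₁ i) ℕ.≤ (2 ℕ.^ (A ℕ.∸ a₁)) ℕ.^ e ℕ.* (2 ℕ.* (16 ℕ.^ m ℕ.* N)) ℕ.^ i
  sum-extensions R b₁ a₁ a₁≤A zero    = ℕ.≤-reflexive (ℕ.+-identityʳ _)
  sum-extensions R b₁ a₁ a₁≤A (suc i) = begin
    sumOver weight (extensions b₁ a₁ (suc i))
      ≡⟨ sumOver-concatMap weight (λ u → cartesianProductWith (λ b bs → (b , a₁ ℕ.+ u) ∷ bs)
           (steps b₁ a₁ (a₁ ℕ.+ u)) (extensions b₁ a₁ i)) (upTo (suc (A ℕ.∸ a₁))) ⟩
    sumOver (λ u → sumOver weight (cartesianProductWith (λ b bs → (b , a₁ ℕ.+ u) ∷ bs)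
      (steps b₁ a₁ (a₁ ℕ.+ u)) (extensions b₁ a₁ i))) (upTo (suc (A ℕ.∸ a₁)))
      ≤⟨ sumOver-mono (upTo (suc (A ℕ.∸ a₁))) (λ {u} _ → ℕ.≤-trans
           (ℕ.≤-reflexive (sumOver-product weight weight ((2 ℕ.^ (A ℕ.∸ (a₁ ℕ.+ u))) ℕ.^ e)
             (λ b bs → (b , a₁ ℕ.+ u) ∷ bs) (λ _ _ → refl) (steps b₁ a₁ (a₁ ℕ.+ u)) (extensions b₁ a₁ i)))
           (ℕ.*-monoˡ-≤ T (ℕ.*-monoˡ-≤ _ (length-steps b₁ a₁ (a₁ ℕ.+ u))))) ⟩
    sumOver (λ u → stepWeight a₁ (a₁ ℕ.+ u) ℕ.* T) (upTo (suc (A ℕ.∸ a₁)))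
      ≡⟨ sumOver-* (λ u → stepWeight a₁ (a₁ ℕ.+ u)) T (upTo (suc (A ℕ.∸ a₁))) ⟩
    sumOver (λ u → stepWeight a₁ (a₁ ℕ.+ u)) (upTo (suc (A ℕ.∸ a₁))) ℕ.* T
      ≤⟨ ℕ.*-mono-≤ (sum-stepWeight R a₁ a₁≤A) (sum-extensions R b₁ a₁ a₁≤A i) ⟩
    Z ℕ.* ((2 ℕ.^ (A ℕ.∸ a₁)) ℕ.^ e ℕ.* Z ℕ.^ i)
      ≡⟨ eq Z ((2 ℕ.^ (A ℕ.∸ a₁)) ℕ.^ e) (Z ℕ.^ i) ⟩
    (2 ℕ.^ (A ℕ.∸ a₁)) ℕ.^ e ℕ.* Z ℕ.^ suc i ∎
    where
    T = sumOver weight (extensions b₁ a₁ i)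
    Z = 2 ℕ.* (16 ℕ.^ m ℕ.* N)
    eq : ∀ x y z → x ℕ.* (y ℕ.* z) ≡ y ℕ.* (x ℕ.* z)
    eq = ℕ-Ring.solve-∀

  sum-flags : ∀ {ℓ} → Rate ℓ → ∀ i →
    sumOver weight (flags i) ℕ.≤ ℓ ℕ.* (16 ℕ.^ d ℕ.* N) ℕ.* (2 ℕ.* (16 ℕ.^ m ℕ.* N)) ℕ.^ i
  sum-flags {ℓ} R i = begin
    sumOver weight (flags i)
      ≡⟨ sumOver-concatMap weight (λ a → concatMap (λ b → extensions b a i) (starts a)) (upTo (suc A)) ⟩
    sumOver (λ a → sumOver weight (concatMap (λ b → extensions b a i) (starts a))) (upTo (suc A))
      ≤⟨ sumOver-mono (upTo (suc A)) (λ {a} ha → bound a (ℕ.≤-pred (∈-upTo⁻ ha))) ⟩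
    sumOver (λ a → (2 ℕ.^ (a ℕ.+ 4)) ℕ.^ d ℕ.* (2 ℕ.^ (A ℕ.∸ a)) ℕ.^ e ℕ.* Z) (upTo (suc A))
      ≡⟨ sumOver-* (λ a → (2 ℕ.^ (a ℕ.+ 4)) ℕ.^ d ℕ.* (2 ℕ.^ (A ℕ.∸ a)) ℕ.^ e) Z (upTo (suc A)) ⟩
    sumOver (λ a → (2 ℕ.^ (a ℕ.+ 4)) ℕ.^ d ℕ.* (2 ℕ.^ (A ℕ.∸ a)) ℕ.^ e) (upTo (suc A)) ℕ.* Z
      ≤⟨ ℕ.*-monoˡ-≤ Z (sum-startWeight R) ⟩
    ℓ ℕ.* (16 ℕ.^ d ℕ.* N) ℕ.* Z ∎
    where
    Z = (2 ℕ.* (16 ℕ.^ m ℕ.* N)) ℕ.^ i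
    bound : ∀ a → a ℕ.≤ A → sumOver weight (concatMap (λ b → extensions b a i) (starts a))
          ℕ.≤ (2 ℕ.^ (a ℕ.+ 4)) ℕ.^ d ℕ.* (2 ℕ.^ (A ℕ.∸ a)) ℕ.^ e ℕ.* Z
    bound a a≤A = begin
      sumOver weight (concatMap (λ b → extensions b a i) (starts a))
        ≡⟨ sumOver-concatMap weight (λ b → extensions b a i) (starts a) ⟩
      sumOver (λ b → sumOver weight (extensions b a i)) (starts a)
        ≤⟨ sumOver-mono (starts a) (λ {b} _ → sum-extensions R b a a≤A i) ⟩
      sumOver (λ _ → (2 ℕ.^ (A ℕ.∸ a)) ℕ.^ e ℕ.* Z) (starts a)
        ≡⟨ sumOver-const ((2 ℕ.^ (A ℕ.∸ a)) ℕ.^ e ℕ.* Z) (starts a) ⟩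
      length (starts a) ℕ.* ((2 ℕ.^ (A ℕ.∸ a)) ℕ.^ e ℕ.* Z)
        ≤⟨ ℕ.*-monoˡ-≤ _ (length-starts a) ⟩
      (2 ℕ.^ (a ℕ.+ 4)) ℕ.^ d ℕ.* ((2 ℕ.^ (A ℕ.∸ a)) ℕ.^ e ℕ.* Z)
        ≡⟨ ℕ.*-assoc ((2 ℕ.^ (a ℕ.+ 4)) ℕ.^ d) _ Z ⟨
      (2 ℕ.^ (a ℕ.+ 4)) ℕ.^ d ℕ.* (2 ℕ.^ (A ℕ.∸ a)) ℕ.^ e ℕ.* Z ∎

  -- Flags of i + 1 vectors contribute N^(i+1) ≤ N^k up to constants. The factor `ℓ` enters once,
  -- through the first vector.
  length-edges : ∀ {ℓ} → Rate ℓ → ∀ C k → length (edges C k) ℕ.≤ edgesK m C k ℕ.* (ℓ ℕ.* N ℕ.^ k)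
  length-edges {ℓ} R C k = begin
    length (edges C k)
      ≡⟨ length-concatMap (λ i → concatMap (tuples (C (suc i))) (flags i)) (upTo k) ⟩
    sumOver (λ i → length (concatMap (tuples (C (suc i))) (flags i))) (upTo k)
      ≤⟨ sumOver-mono (upTo k) (λ {i} hi → bound i (∈-upTo⁻ hi)) ⟩
    sumOver (λ i → 16 ℕ.^ d ℕ.* (2 ℕ.* 16 ℕ.^ m) ℕ.^ i ℕ.* C (suc i) ℕ.* (ℓ ℕ.* N ℕ.^ k)) (upTo k)
      ≡⟨ sumOver-* (λ i → 16 ℕ.^ d ℕ.* (2 ℕ.* 16 ℕ.^ m) ℕ.^ i ℕ.* C (suc i)) (ℓ ℕ.* N ℕ.^ k) (upTo k) ⟩
    edgesK m C k ℕ.* (ℓ ℕ.* N ℕ.^ k) ∎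
    where
    instance
      N≢0 : ℕ.NonZero N
      N≢0 = ℕ.m^n≢0 (2 ℕ.^ A) d {{ℕ.m^n≢0 2 A}}
    eq : ∀ ℓ x N y c → ℓ ℕ.* (x ℕ.* N) ℕ.* y ℕ.* c ≡ x ℕ.* (ℓ ℕ.* (N ℕ.* y)) ℕ.* c
    eq = ℕ-Ring.solve-∀
    eq′ : ∀ x ℓ N y z c → x ℕ.* (ℓ ℕ.* (N ℕ.* (y ℕ.* z))) ℕ.* c ≡ x ℕ.* y ℕ.* c ℕ.* (ℓ ℕ.* (N ℕ.* z))
    eq′ = ℕ-Ring.solve-∀
    bound : ∀ i → i ℕ.< k → length (concatMap (tuples (C (suc i))) (flags i)) ℕ.≤
      16 ℕ.^ d ℕ.* (2 ℕ.* 16 ℕ.^ m) ℕ.^ i ℕ.* C (suc i) ℕ.* (ℓ ℕ.* N ℕ.^ k)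
    bound i i<k = begin
      length (concatMap (tuples (C (suc i))) (flags i))
        ≡⟨ length-concatMap (tuples (C (suc i))) (flags i) ⟩
      sumOver (λ bs → length (tuples (C (suc i)) bs)) (flags i)
        ≤⟨ sumOver-mono (flags i) (λ {bs} _ → length-tuples (C (suc i)) bs) ⟩
      sumOver (λ bs → weight bs ℕ.* C (suc i)) (flags i)
        ≡⟨ sumOver-* weight (C (suc i)) (flags i) ⟩
      sumOver weight (flags i) ℕ.* C (suc i)
        ≤⟨ ℕ.*-monoˡ-≤ (C (suc i)) (sum-flags R i) ⟩
      ℓ ℕ.* (16 ℕ.^ d ℕ.* N) ℕ.* (2 ℕ.* (16 ℕ.^ m ℕ.* N)) ℕ.^ i ℕ.* C (suc i)
        ≡⟨ cong (λ z → ℓ ℕ.* (16 ℕ.^ d ℕ.* N) ℕ.* z ℕ.* C (suc i))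
             (trans (cong (ℕ._^ i) (sym (ℕ.*-assoc 2 (16 ℕ.^ m) N))) (^-distribʳ-* i (2 ℕ.* 16 ℕ.^ m) N)) ⟩
      ℓ ℕ.* (16 ℕ.^ d ℕ.* N) ℕ.* ((2 ℕ.* 16 ℕ.^ m) ℕ.^ i ℕ.* N ℕ.^ i) ℕ.* C (suc i)
        ≡⟨ trans (eq ℓ (16 ℕ.^ d) N _ (C (suc i))) (eq′ (16 ℕ.^ d) ℓ N ((2 ℕ.* 16 ℕ.^ m) ℕ.^ i) (N ℕ.^ i) (C (suc i))) ⟩
      16 ℕ.^ d ℕ.* (2 ℕ.* 16 ℕ.^ m) ℕ.^ i ℕ.* C (suc i) ℕ.* (ℓ ℕ.* N ℕ.^ suc i)
        ≤⟨ ℕ.*-monoʳ-≤ (16 ℕ.^ d ℕ.* (2 ℕ.* 16 ℕ.^ m) ℕ.^ i ℕ.* C (suc i))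
             (ℕ.*-monoʳ-≤ ℓ (ℕ.^-monoʳ-≤ N i<k)) ⟩
      16 ℕ.^ d ℕ.* (2 ℕ.* 16 ℕ.^ m) ℕ.^ i ℕ.* C (suc i) ℕ.* (ℓ ℕ.* N ℕ.^ k) ∎

-- Flags of shortest vectors

module Saturation (m A e : ℕ) {X : Set} (points : List X) (ι : X → Elimination.Coords m)
  (Λ : Elimination.Lattice m) (k : ℕ)
  (rank≤k : ∀ bs → Elimination.Indep m bs → Elimination.InΛ m Λ bs → length bs ℕ.≤ k) where

  open Elimination m
  open Lattice Λ
  open Enumeration m A e points ι

  Within : ℕ → Coords → Set
  Within a v = ∀ j → ∣ v j ∣ ℕ.≤ 2 ℕ.^ a

  -- The first clause of `Minimal`. Its factor 2 is what lets saturation at one scale supply it at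
  -- the next.
  Short : ℕ → Flag → Set
  Short a bs = ∀ v → Mem v → (∀ j → 2 ℕ.* ∣ v j ∣ ℕ.< 2 ℕ.^ a) → Elim bs v

  Saturated : ℕ → Flag → Set
  Saturated a bs = ∀ v → Mem v → Within a v → Elim bs v

  full⇒saturated : ∀ a bs → ¬ (∃[ v ] Mem v × Within a v × ¬ Elim bs v) → Saturated a bs
  full⇒saturated a bs full v hv within = decidable-stable (Elim? bs v) λ ∉ → full (v , hv , within , ∉)

  saturated⇒short : ∀ a bs → Saturated a bs → Short (suc a) bs
  saturated⇒short a bs sat v hv h = sat v hv λ j → ℕ.<⇒≤ (ℕ.*-cancelˡ-< 2 _ _ (h j))

  short-zero : ∀ bs → Short 0 bs
  short-zero bs v hv h = Elim-cong bs (λ j → sym (v≡0 j)) (zero-Elim bs)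
    where
    v≡0 : ∀ j → v j ≡ 0ℤ
    v≡0 j = ℤ.∣i∣≡0⇒i≡0 (ℕ.n≤0⇒n≡0 (ℕ.≤-trans (ℕ.m≤n*m _ 2) (ℕ.≤-pred (h j))))
    zero-Elim : ∀ bs → Elim bs (λ _ → 0ℤ)
    zero-Elim []       _ = refl
    zero-Elim (b ∷ bs)   = Elim-weaken b bs (zero-Elim bs)

  -- The invariant of a flag under construction at scale `a`. The fields from `first` on keep what
  -- later reductions modulo `b₁` need.
  record Built (a : ℕ) (b₁ : Vec ℤ d) (a₁ i : ℕ) (bs : Flag) : Set where
    field
      enumerated : bs ∈ˡ extensions b₁ a₁ i
      length≡    : length bs ≡ suc i
      indep      : Indep bs
      members    : InΛ Λ bs
      minimal    : Minimal m Λ bs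
      top≤       : top m bs ℕ.≤ a
      scales≤    : All (λ s → proj₂ s ℕ.≤ A) bs
      first      : Elim bs (lookup b₁)
      started    : b₁ ∈ˡ starts a₁
      a₁≤a       : a₁ ℕ.≤ a
      b₁∈        : Mem (lookup b₁)
      b₁-within  : Within a₁ (lookup b₁)
      b₁≢0       : lookup b₁ (pivot (lookup b₁)) ≢ 0ℤ

  built-suc : ∀ {a b₁ a₁ i bs} → Built a b₁ a₁ i bs → Built (suc a) b₁ a₁ i bs
  built-suc B = record
    { enumerated = enumerated ; length≡ = length≡ ; indep = indep ; members = members
    ; minimal = minimal ; top≤ = ℕ.m≤n⇒m≤1+n top≤ ; scales≤ = scales≤ ; first = first
    ; started = started ; a₁≤a = ℕ.m≤n⇒m≤1+n a₁≤a ; b₁∈ = b₁∈ ; b₁-within = b₁-within ; b₁≢0 = b₁≢0 }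
    where open Built B

  start : ∀ {a} → a ℕ.≤ A → Short a [] → ∀ v → Mem v → Within a v → ¬ Elim [] v →
    ∃[ b ] Built a b a 0 ((b , a) ∷ [])
  start {a} a≤A short v hv within v≢0 = b , record
    { enumerated = here refl
    ; length≡    = refl
    ; indep      = (λ b≡0 → v≢0 λ j → trans (sym (b≗v j)) (b≡0 j)) , tt
    ; members    = b∈ ∷ []
    ; minimal    = short , ℕ.z≤n , tt
    ; top≤       = ℕ.≤-refl
    ; scales≤    = a≤A ∷ []
    ; first      = Elim-head b a []
    ; started    = ∈-vectors (λ _ → symInterval (2 ℕ.^ (a ℕ.+ 2))) b λ j → ∈-symInterval _ _
        (ℕ.≤-trans (b-within j) (ℕ.^-monoʳ-≤ 2 (ℕ.m≤m+n a 2)))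
    ; a₁≤a       = ℕ.≤-refl
    ; b₁∈        = b∈
    ; b₁-within  = b-within
    ; b₁≢0       = λ e → v≢0 λ j → trans (sym (b≗v j)) (pivot≡0 (lookup b) e j)
    }
    where
    b = tabulate v
    b≗v : ∀ j → lookup b j ≡ v j
    b≗v = lookup∘tabulate v
    b∈ : Mem (lookup b)
    b∈ = Mem-cong (λ j → sym (b≗v j)) hv
    b-within : Within a (lookup b)
    b-within j = subst (λ z → ∣ z ∣ ℕ.≤ 2 ℕ.^ a) (sym (b≗v j)) (within j)

  -- The vector added is `v` minus a multiple of `b₁`. As `b₁` lies in the span already, the result
  -- is still outside it. `Minimal` constrains only the earlier vectors, so the growth of the
  -- entries by a constant factor does no harm.
  extend : ∀ {a b₁ a₁ i bs} → a ℕ.≤ A → Built a b₁ a₁ i bs → Short a bs →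
    ∀ v → Mem v → Within a v → ¬ Elim bs v →
    ∃[ b ] Built a b₁ a₁ (suc i) ((b , a) ∷ bs)
  extend {a} {b₁} {a₁} {i} {bs} a≤A B short v hv within v∉ = b , record
    { enumerated = ∈-concatMap (λ u → cartesianProductWith (λ b bs → (b , a₁ ℕ.+ u) ∷ bs)
          (steps b₁ a₁ (a₁ ℕ.+ u)) (extensions b₁ a₁ i)) (∈-upTo⁺ (ℕ.s≤s (ℕ.∸-monoˡ-≤ a₁ a≤A)))
        (subst (λ z → (b , a) ∷ bs ∈ˡ cartesianProductWith (λ b bs → (b , z) ∷ bs) (steps b₁ a₁ z) (extensions b₁ a₁ i))
          (sym (ℕ.m+[n∸m]≡n a₁≤a))
          (∈-cartesianProductWith⁺ (λ b bs → (b , a) ∷ bs) b∈steps enumerated))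
    ; length≡    = cong suc length≡
    ; indep      = b∉ , indep
    ; members    = Mem-cong (λ j → trans (eq₁ (v j) t (lookup b₁ j)) (sym (b≗ j))) (combine 1ℤ t hv b₁∈) ∷ members
    ; minimal    = short , top≤ , minimal
    ; top≤       = ℕ.≤-refl
    ; scales≤    = a≤A ∷ scales≤
    ; first      = Elim-weaken (b , a) bs first
    ; started    = started
    ; a₁≤a       = a₁≤a
    ; b₁∈        = b₁∈
    ; b₁-within  = b₁-within
    ; b₁≢0       = b₁≢0
    }
    where
    open Built B
    p = pivot (lookup b₁)
    β = lookup b₁ p
    instance
      β≢0 : ℤ.NonZero β
      β≢0 = ℤ.≢-nonZero b₁≢0
    t = v p ℤ./ β
    ρ = v p ℤ.% β
    b = tabulate (λ j → v j ℤ.- t ℤ.* lookup b₁ j)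
    b≗ : ∀ j → lookup b j ≡ v j ℤ.- t ℤ.* lookup b₁ j
    b≗ = lookup∘tabulate _
    eq₁ : ∀ x t y → 1ℤ ℤ.* x ℤ.- t ℤ.* y ≡ x ℤ.- t ℤ.* y
    eq₁ = ℤ-Ring.solve-∀
    eq₂ : ∀ x t y → 1ℤ ℤ.* (x ℤ.- t ℤ.* y) ℤ.- (ℤ.- t) ℤ.* y ≡ x
    eq₂ = ℤ-Ring.solve-∀
    eq₃ : ∀ x y → (x ℤ.+ y) ℤ.- y ≡ x
    eq₃ = ℤ-Ring.solve-∀
    eq₄ : ∀ x y → y ≡ (x ℤ.+ y) ℤ.- x
    eq₄ = ℤ-Ring.solve-∀
    b∉ : ¬ Elim bs (lookup b)
    b∉ h = v∉ (Elim-cong bs (λ j → trans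
      (cong (λ z → 1ℤ ℤ.* z ℤ.- (ℤ.- t) ℤ.* lookup b₁ j) (b≗ j)) (eq₂ (v j) t (lookup b₁ j)))
      (Elim-combine bs 1ℤ (ℤ.- t) h first))
    b-pivot : lookup b p ≡ + ρ
    b-pivot = trans (b≗ p) (trans (cong (ℤ._- t ℤ.* β) (ℤ.a≡a%n+[a/n]*n (v p) β)) (eq₃ (+ ρ) (t ℤ.* β)))
    ρ<2^a₁ : ρ ℕ.< 2 ℕ.^ a₁
    ρ<2^a₁ = ℕ.<-≤-trans (ℤ.n%d<d (v p) β) (b₁-within p)
    open ℕ.≤-Reasoning
    -- The multiple of `b₁` is largest at the pivot, where it equals `v p` minus the remainder.
    tb₁-bound : ∀ j → ∣ t ℤ.* lookup b₁ j ∣ ℕ.≤ 2 ℕ.^ a ℕ.+ 2 ℕ.^ a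
    tb₁-bound j = begin
      ∣ t ℤ.* lookup b₁ j ∣         ≡⟨ ℤ.abs-* t (lookup b₁ j) ⟩
      ∣ t ∣ ℕ.* ∣ lookup b₁ j ∣     ≤⟨ ℕ.*-monoʳ-≤ (∣ t ∣) (pivot-max (lookup b₁) j) ⟩
      ∣ t ∣ ℕ.* ∣ β ∣               ≡⟨ ℤ.abs-* t β ⟨
      ∣ t ℤ.* β ∣                   ≡⟨ cong ∣_∣ (trans (eq₄ (+ ρ) (t ℤ.* β)) (cong (ℤ._- + ρ) (sym (ℤ.a≡a%n+[a/n]*n (v p) β)))) ⟩
      ∣ v p ℤ.- + ρ ∣               ≤⟨ ℤ.∣i-j∣≤∣i∣+∣j∣ (v p) (+ ρ) ⟩
      ∣ v p ∣ ℕ.+ ρ                 ≤⟨ ℕ.+-mono-≤ (within p) (ℕ.≤-trans (ℕ.<⇒≤ ρ<2^a₁) (ℕ.^-monoʳ-≤ 2 a₁≤a)) ⟩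
      2 ℕ.^ a ℕ.+ 2 ℕ.^ a           ∎
    b-bound : ∀ j → ∣ lookup b j ∣ ℕ.≤ 2 ℕ.^ (a ℕ.+ 2)
    b-bound j = begin
      ∣ lookup b j ∣                              ≡⟨ cong ∣_∣ (b≗ j) ⟩
      ∣ v j ℤ.- t ℤ.* lookup b₁ j ∣               ≤⟨ ℤ.∣i-j∣≤∣i∣+∣j∣ (v j) (t ℤ.* lookup b₁ j) ⟩
      ∣ v j ∣ ℕ.+ ∣ t ℤ.* lookup b₁ j ∣           ≤⟨ ℕ.+-mono-≤ (within j) (tb₁-bound j) ⟩
      2 ℕ.^ a ℕ.+ (2 ℕ.^ a ℕ.+ 2 ℕ.^ a)           ≤⟨ ℕ.m≤n+m _ (2 ℕ.^ a) ⟩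
      2 ℕ.^ a ℕ.+ (2 ℕ.^ a ℕ.+ (2 ℕ.^ a ℕ.+ 2 ℕ.^ a)) ≡⟨ eq (2 ℕ.^ a) ⟩
      2 ℕ.^ a ℕ.* 2 ℕ.^ 2                         ≡⟨ ℕ.^-distribˡ-+-* 2 a 2 ⟨
      2 ℕ.^ (a ℕ.+ 2)                             ∎
      where
      eq : ∀ x → x ℕ.+ (x ℕ.+ (x ℕ.+ x)) ≡ x ℕ.* 4
      eq = ℕ-Ring.solve-∀
    b∈steps : b ∈ˡ steps b₁ a₁ a
    b∈steps = ∈-vectors (stepRange b₁ a₁ a) b go
      where
      go : ∀ j → lookup b j ∈ˡ stepRange b₁ a₁ a j
      go j with j Fin.≟ p
      ... | yes refl = subst (_∈ˡ map +_ (upTo (2 ℕ.^ a₁))) (sym b-pivot) (∈-map⁺ +_ (∈-upTo⁺ ρ<2^a₁))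
      ... | no  _    = ∈-symInterval _ _ (b-bound j)

  Finished : ℕ → Set
  Finished a = ∃[ b₁ ] ∃[ a₁ ] ∃[ i ] ∃[ bs ] Built a b₁ a₁ i bs × Saturated a bs

  -- Whether Λ has a vector outside the span cannot be decided, hence the double negation. The fuel
  -- `f` is the number of vectors that the rank bound still permits.
  saturate : ∀ f {a b₁ a₁ i bs} → suc i ℕ.+ f ≡ k → a ℕ.≤ A → Built a b₁ a₁ i bs → Short a bs → ¬ ¬ Finished a
  saturate f {a} {b₁} {a₁} {i} {bs} i+f≡k a≤A B short fail = ¬¬-excluded-middle λ where
      (no full)                    → fail (_ , _ , _ , _ , B , full⇒saturated a bs full)
      (yes (v , hv , within , v∉)) → continue f i+f≡k (extend a≤A B short v hv within v∉)
    where
    continue : ∀ f → suc i ℕ.+ f ≡ k → ¬ (∃[ b ] Built a b₁ a₁ (suc i) ((b , a) ∷ bs))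
    continue zero    e (b , B′) = ℕ.<-irrefl refl (begin-strict
      k                        ≡⟨ trans (sym e) (ℕ.+-identityʳ (suc i)) ⟩
      suc i                    <⟨ ℕ.n<1+n (suc i) ⟩
      suc (suc i)              ≡⟨ Built.length≡ B′ ⟨
      length ((b , a) ∷ bs)    ≤⟨ rank≤k _ (Built.indep B′) (Built.members B′) ⟩
      k                        ∎)
      where open ℕ.≤-Reasoning
    continue (suc f) e (b , B′) = saturate f (trans (sym (ℕ.+-suc (suc i) f)) e) a≤A B′
      (λ v hv h → Elim-weaken (b , a) bs (short v hv h)) fail

  saturate′ : ∀ {a b₁ a₁ i bs} → a ℕ.≤ A → Built a b₁ a₁ i bs → Short a bs → ¬ ¬ Finished a
  saturate′ {i = i} {bs} a≤A B = saturate (k ℕ.∸ suc i) (ℕ.m+[n∸m]≡n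
    (subst (ℕ._≤ k) length≡ (rank≤k bs indep members))) a≤A B
    where open Built B

  reach-from-empty : ∀ {a} → a ℕ.≤ A → Short a [] → ¬ ¬ (Saturated a [] ⊎ Finished a)
  reach-from-empty {a} a≤A short fail = ¬¬-excluded-middle λ where
      (no full) → fail (inj₁ (full⇒saturated a [] full))
      (yes (v , hv , within , v≢0)) → let b , B = start a≤A short v hv within v≢0 in
        saturate′ a≤A B (λ v hv h → Elim-weaken (b , a) [] (short v hv h)) (fail ∘ inj₂)

  -- The scales are passed one at a time, because saturation at scale a is the minimality required
  -- of every vector added at scale a + 1.
  reach : ∀ a → a ℕ.≤ A → ¬ ¬ (Saturated a [] ⊎ Finished a)
  reach zero    0≤A    = reach-from-empty 0≤A (short-zero [])
  reach (suc a) suca≤A fail = reach a (ℕ.<⇒≤ suca≤A) λ where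
    (inj₁ sat) → reach-from-empty suca≤A (saturated⇒short a [] sat) fail
    (inj₂ (b₁ , a₁ , i , bs , B , sat)) →
      saturate′ suca≤A (built-suc B) (saturated⇒short a bs sat) (fail ∘ inj₂)

  powers : ∀ bs → All (λ s → proj₂ s ℕ.≤ A) bs →
    (2 ℕ.^ total m bs) ℕ.^ e ℕ.* weight bs ≡ ((2 ℕ.^ A) ℕ.^ length bs) ℕ.^ e
  powers []             []         = trans (ℕ.*-identityʳ _) refl
  powers ((b , a) ∷ bs) (a≤A ∷ h) = begin
    (2 ℕ.^ (a ℕ.+ total m bs)) ℕ.^ e ℕ.* ((2 ℕ.^ (A ℕ.∸ a)) ℕ.^ e ℕ.* weight bs)
      ≡⟨ cong (λ z → z ℕ.^ e ℕ.* ((2 ℕ.^ (A ℕ.∸ a)) ℕ.^ e ℕ.* weight bs)) (ℕ.^-distribˡ-+-* 2 a (total m bs)) ⟩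
    (2 ℕ.^ a ℕ.* 2 ℕ.^ total m bs) ℕ.^ e ℕ.* ((2 ℕ.^ (A ℕ.∸ a)) ℕ.^ e ℕ.* weight bs)
      ≡⟨ cong (ℕ._* ((2 ℕ.^ (A ℕ.∸ a)) ℕ.^ e ℕ.* weight bs)) (^-distribʳ-* e (2 ℕ.^ a) (2 ℕ.^ total m bs)) ⟩
    (2 ℕ.^ a) ℕ.^ e ℕ.* (2 ℕ.^ total m bs) ℕ.^ e ℕ.* ((2 ℕ.^ (A ℕ.∸ a)) ℕ.^ e ℕ.* weight bs)
      ≡⟨ eq ((2 ℕ.^ a) ℕ.^ e) _ ((2 ℕ.^ (A ℕ.∸ a)) ℕ.^ e) (weight bs) ⟩
    (2 ℕ.^ a) ℕ.^ e ℕ.* (2 ℕ.^ (A ℕ.∸ a)) ℕ.^ e ℕ.* ((2 ℕ.^ total m bs) ℕ.^ e ℕ.* weight bs)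
      ≡⟨ cong₂ ℕ._*_ (trans (sym (^-distribʳ-* e (2 ℕ.^ a) (2 ℕ.^ (A ℕ.∸ a))))
           (cong (ℕ._^ e) (trans (sym (ℕ.^-distribˡ-+-* 2 a (A ℕ.∸ a))) (cong (2 ℕ.^_) (ℕ.m+[n∸m]≡n a≤A)))))
           (powers bs h) ⟩
    (2 ℕ.^ A) ℕ.^ e ℕ.* ((2 ℕ.^ A) ℕ.^ length bs) ℕ.^ e
      ≡⟨ ^-distribʳ-* e (2 ℕ.^ A) _ ⟨
    (2 ℕ.^ A ℕ.* (2 ℕ.^ A) ℕ.^ length bs) ℕ.^ e ∎
    where
    open ≡-Reasoning
    eq : ∀ x y z w → x ℕ.* y ℕ.* (z ℕ.* w) ≡ x ℕ.* z ℕ.* (y ℕ.* w)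
    eq = ℕ-Ring.solve-∀

  module _ (points-unique : Unique points) (ι-injective : ∀ {x y} → (∀ j → ι x j ≡ ι y j) → x ≡ y)
    (spread<2^A : ∀ x y j → ∣ ι x j ℤ.- ι y j ∣ ℕ.< 2 ℕ.^ A) where

    -- The e-th power of `count` at scale A; `powers` converts the product of the sizes 2^a into
    -- `weight`. So minimal flags pass the test in `tuples`.
    section-bound : ∀ bs → Indep bs → InΛ Λ bs → Minimal m Λ bs → top m bs ℕ.≤ A →
      All (λ s → proj₂ s ℕ.≤ A) bs →
      length (section bs) ℕ.^ e ℕ.≤ countC m (length bs) ℕ.^ e ℕ.* weight bs
    section-bound bs ind mem min top≤ scales≤ = ℕ.*-cancelˡ-≤ ((2 ℕ.^ total m bs) ℕ.^ e) (begin
      (2 ℕ.^ total m bs) ℕ.^ e ℕ.* length (section bs) ℕ.^ e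
        ≡⟨ trans (ℕ.*-comm _ (length (section bs) ℕ.^ e)) (sym (^-distribʳ-* e (length (section bs)) (2 ℕ.^ total m bs))) ⟩
      (length (section bs) ℕ.* 2 ℕ.^ total m bs) ℕ.^ e
        ≤⟨ ℕ.^-monoˡ-≤ e (count m Λ ι ι-injective bs ind mem min A top≤ (section bs)
             (filter⁺ (λ x → Elim? bs (ι x)) points-unique)
             (λ {x} {y} hx hy → Elim-cong bs (λ j → eq₁ (ι x j) (ι y j))
               (Elim-combine bs 1ℤ 1ℤ (elim∈ hx) (elim∈ hy)))
             (λ {x} {y} _ _ → spread<2^A x y)) ⟩
      (countC m (length bs) ℕ.* (2 ℕ.^ A) ℕ.^ length bs) ℕ.^ e
        ≡⟨ ^-distribʳ-* e (countC m (length bs)) _ ⟩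
      countC m (length bs) ℕ.^ e ℕ.* ((2 ℕ.^ A) ℕ.^ length bs) ℕ.^ e
        ≡⟨ cong (countC m (length bs) ℕ.^ e ℕ.*_) (powers bs scales≤) ⟨
      countC m (length bs) ℕ.^ e ℕ.* ((2 ℕ.^ total m bs) ℕ.^ e ℕ.* weight bs)
        ≡⟨ eq₂ (countC m (length bs) ℕ.^ e) ((2 ℕ.^ total m bs) ℕ.^ e) (weight bs) ⟩
      (2 ℕ.^ total m bs) ℕ.^ e ℕ.* (countC m (length bs) ℕ.^ e ℕ.* weight bs) ∎)
      where
      open ℕ.≤-Reasoning
      instance
        nz : ℕ.NonZero ((2 ℕ.^ total m bs) ℕ.^ e)
        nz = ℕ.m^n≢0 (2 ℕ.^ total m bs) e {{ℕ.m^n≢0 2 (total m bs)}}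
      eq₁ : ∀ x y → 1ℤ ℤ.* x ℤ.- 1ℤ ℤ.* y ≡ x ℤ.- y
      eq₁ = ℤ-Ring.solve-∀
      eq₂ : ∀ x y z → x ℕ.* (y ℕ.* z) ≡ y ℕ.* (x ℕ.* z)
      eq₂ = ℕ-Ring.solve-∀
      elim∈ : ∀ {x} → x ∈ˡ section bs → Elim bs (ι x)
      elim∈ hx = proj₂ (∈-filter⁻ (λ x → Elim? bs (ι x)) {xs = points} hx)

    -- A flag saturated at scale A contains all entries of `v` in its span. The nonzero entry rules
    -- out the empty flag, which the enumeration omits.
    ∈-edges : ∀ (v : Vec X e) → (∀ i → lookup v i ∈ˡ points) → (∀ i → Mem (ι (lookup v i))) →
      (∀ i → Within A (ι (lookup v i))) → ∃[ i ] ¬ (∀ j → ι (lookup v i) j ≡ 0ℤ) →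
      ¬ ¬ (v ∈ˡ edges (λ i → countC m i ℕ.^ e) k)
    ∈-edges v hp hv within (i₀ , v≢0) fail = reach A ℕ.≤-refl λ where
      (inj₁ sat) → v≢0 (sat _ (hv i₀) (within i₀))
      (inj₂ (b₁ , a₁ , i , bs , B , sat)) → let open Built B in
        fail (∈-concatMap (λ i → concatMap (tuples (countC m (suc i) ℕ.^ e)) (flags i))
          (∈-upTo⁺ (subst (ℕ._≤ k) length≡ (rank≤k bs indep members)))
          (∈-concatMap (tuples (countC m (suc i) ℕ.^ e))
            (∈-concatMap (λ a → concatMap (λ b → extensions b a i) (starts a)) (∈-upTo⁺ (ℕ.s≤s a₁≤a))
              (∈-concatMap (λ b → extensions b a₁ i) started enumerated))
            (∈-tuples _ bs v
              (subst (λ l → length (section bs) ℕ.^ e ℕ.≤ countC m l ℕ.^ e ℕ.* weight bs) length≡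
                (section-bound bs indep members minimal top≤ scales≤))
              hp (λ i → sat _ (hv i) (within i)))))

-- Independent sets in hypergraphs

sumOver-filter-¬ : ∀ {X : Set} {P : Pred X 0ℓ} (P? : Decidable P) (f : X → ℕ) xs →
  sumOver f xs ≡ sumOver f (filter P? xs) ℕ.+ sumOver f (filter (¬? ∘ P?) xs)
sumOver-filter-¬ P? f []       = refl
sumOver-filter-¬ P? f (x ∷ xs) with P? x
... | yes _ = trans (cong (f x ℕ.+_) (sumOver-filter-¬ P? f xs)) (sym (ℕ.+-assoc (f x) _ _))
... | no  _ = trans (cong (f x ℕ.+_) (sumOver-filter-¬ P? f xs)) (eq (f x) (sumOver f (filter P? xs)) (sumOver f (filter (¬? ∘ P?) xs)))
  where
  eq : ∀ x y z → x ℕ.+ (y ℕ.+ z) ≡ y ℕ.+ (x ℕ.+ z)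
  eq = ℕ-Ring.solve-∀

module Alteration {X : Set} (_≟_ : DecidableEquality X) where
  open DecMembership _≟_ using (_∈?_)

  remove : X → List X → List X
  remove x = filter (λ y → ¬? (x ≟ y))

  length-remove-∉ : ∀ {x} xs → All (x ≢_) xs → length (remove x xs) ≡ length xs
  length-remove-∉ {x} xs h = cong length (List.filter-all (λ y → ¬? (x ≟ y)) h)

  length-remove-∈ : ∀ {x xs} → Unique xs → x ∈ˡ xs → length xs ≡ suc (length (remove x xs))
  length-remove-∈ {x} {y ∷ xs} (y∉ ∷ u) h with x ≟ y
  ... | yes refl = cong suc (sym (length-remove-∉ xs y∉))
  length-remove-∈ {x} {y ∷ xs} (y∉ ∷ u) (here x≡y) | no x≢y = contradiction x≡y x≢y
  length-remove-∈ {x} {y ∷ xs} (y∉ ∷ u) (there h)  | no x≢y = cong suc (length-remove-∈ u h)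

  length-remove : ∀ x {xs} → Unique xs → length xs ℕ.≤ suc (length (remove x xs))
  length-remove x {xs} u with x ∈? xs
  ... | yes x∈ = ℕ.≤-reflexive (length-remove-∈ u x∈)
  ... | no  x∉ = ℕ.≤-trans (ℕ.≤-reflexive (sym (length-remove-∉ xs (AllP.¬Any⇒All¬ xs x∉)))) (ℕ.n≤1+n _)

  covered : List X → List X → ℕ
  covered S ε with All.all? (_∈? S) ε
  ... | yes _ = 1
  ... | no  _ = 0

  covered-mono : ∀ {S ε S′ ε′} → (All (_∈ˡ S) ε → All (_∈ˡ S′) ε′) → covered S ε ℕ.≤ covered S′ ε′
  covered-mono {S} {ε} {S′} {ε′} f with All.all? (_∈? S) ε | All.all? (_∈? S′) ε′
  ... | yes h | no ¬h = contradiction (f h) ¬h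
  ... | yes _ | yes _ = ℕ.≤-refl
  ... | no  _ | _     = ℕ.z≤n

  covered-¬ : ∀ {S ε} → ¬ All (_∈ˡ S) ε → covered S ε ≡ 0
  covered-¬ {S} {ε} ¬h with All.all? (_∈? S) ε
  ... | yes h = contradiction h ¬h
  ... | no  _ = refl

  module _ (q e′ : ℕ) .{{_ : ℕ.NonZero q}} where
    private
      e = suc e′
      w : List X → ℕ
      w ε = q ℕ.^ (e ℕ.∸ length ε)

    IsEdge : List X → Set
    IsEdge ε = Unique ε × length ε ℕ.≤ e

    -- The method of conditional expectations for a random subset of
    -- density 1/q: an edge ε is covered with probability q ^ (- length ε),
    -- and one of the two decisions about v does not lower the expected
    -- value of length S minus the number of covered edges.

    derandomise : ∀ V → Unique V → ∀ E → All IsEdge E →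
      ∃[ S ] Unique S × S ⊆ˡ V ×
        q ℕ.^ e ℕ.* sumOver (covered S) E ℕ.+ q ℕ.^ e′ ℕ.* length V ℕ.≤ q ℕ.^ e ℕ.* length S ℕ.+ sumOver w E
    derandomise [] u E hE = [] , [] , (λ ()) , (begin
      q ℕ.^ e ℕ.* sumOver (covered []) E ℕ.+ q ℕ.^ e′ ℕ.* 0
        ≡⟨ trans (cong (q ℕ.^ e ℕ.* sumOver (covered []) E ℕ.+_) (ℕ.*-zeroʳ (q ℕ.^ e′))) (ℕ.+-identityʳ _) ⟩
      q ℕ.^ e ℕ.* sumOver (covered []) E
        ≡⟨ trans (ℕ.*-comm (q ℕ.^ e) _) (sym (sumOver-* (covered []) (q ℕ.^ e) E)) ⟩
      sumOver (λ ε → covered [] ε ℕ.* q ℕ.^ e) E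
        ≤⟨ sumOver-mono E (λ {ε} _ → bound ε) ⟩
      sumOver w E
        ≡⟨ cong (ℕ._+ sumOver w E) (ℕ.*-zeroʳ (q ℕ.^ e)) ⟨
      q ℕ.^ e ℕ.* 0 ℕ.+ sumOver w E ∎)
      where
      open ℕ.≤-Reasoning
      bound : ∀ ε → covered [] ε ℕ.* q ℕ.^ e ℕ.≤ w ε
      bound []      = ℕ.≤-reflexive (ℕ.*-identityˡ (q ℕ.^ e))
      bound (x ∷ ε) = ℕ.≤-trans (ℕ.≤-reflexive (cong (ℕ._* q ℕ.^ e) (covered-¬ {[]} {x ∷ ε} λ { (() ∷ _) }))) ℕ.z≤n
    derandomise (v ∷ V) (v∉ ∷ u) E hE with ℕ.≤-total (sumOver w (filter (v ∈?_) E)) (q ℕ.^ e′)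
    -- Leaving `v` out costs q^e′, which is made up for by the weight of the edges through `v`.
    ... | inj₂ heavy = let S , uS , S⊆ , h = derandomise V u E₀ (AllP.filter⁺ (¬? ∘ (v ∈?_)) hE) in
      S , uS , there ∘ S⊆ , (begin
      q ℕ.^ e ℕ.* sumOver (covered S) E ℕ.+ q ℕ.^ e′ ℕ.* suc (length V)
        ≡⟨ cong (λ c → q ℕ.^ e ℕ.* c ℕ.+ q ℕ.^ e′ ℕ.* suc (length V)) (covered-E S (λ h → v∉V (S⊆ h))) ⟩
      q ℕ.^ e ℕ.* sumOver (covered S) E₀ ℕ.+ q ℕ.^ e′ ℕ.* suc (length V)
        ≡⟨ eq (q ℕ.^ e ℕ.* sumOver (covered S) E₀) (q ℕ.^ e′) (length V) ⟩
      (q ℕ.^ e ℕ.* sumOver (covered S) E₀ ℕ.+ q ℕ.^ e′ ℕ.* length V) ℕ.+ q ℕ.^ e′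
        ≤⟨ ℕ.+-mono-≤ h heavy ⟩
      (q ℕ.^ e ℕ.* length S ℕ.+ sumOver w E₀) ℕ.+ sumOver w E₁
        ≡⟨ trans (ℕ.+-assoc (q ℕ.^ e ℕ.* length S) (sumOver w E₀) (sumOver w E₁)) (cong (q ℕ.^ e ℕ.* length S ℕ.+_)
             (trans (ℕ.+-comm (sumOver w E₀) (sumOver w E₁)) (sym (sumOver-filter-¬ (v ∈?_) w E)))) ⟩
      q ℕ.^ e ℕ.* length S ℕ.+ sumOver w E ∎)
      where
      open ℕ.≤-Reasoning
      E₀ = filter (¬? ∘ (v ∈?_)) E
      E₁ = filter (v ∈?_) E
      v∉V : ¬ (v ∈ˡ V)
      v∉V h = All.lookup v∉ h refl
      eq : ∀ x y z → x ℕ.+ y ℕ.* suc z ≡ (x ℕ.+ y ℕ.* z) ℕ.+ y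
      eq = ℕ-Ring.solve-∀
      covered-E : ∀ S → ¬ (v ∈ˡ S) → sumOver (covered S) E ≡ sumOver (covered S) E₀
      covered-E S v∉S = trans (sumOver-filter-¬ (v ∈?_) (covered S) E)
        (cong (ℕ._+ sumOver (covered S) E₀) (ℕ.n≤0⇒n≡0 (ℕ.≤-trans
          (sumOver-mono {g = λ _ → 0} E₁ λ hε → ℕ.≤-reflexive (covered-¬ λ h →
            v∉S (All.lookup h (proj₂ (∈-filter⁻ (v ∈?_) {xs = E} hε)))))
          (ℕ.≤-reflexive (trans (sumOver-const 0 E₁) (ℕ.*-zeroʳ (length E₁)))))))
    -- Taking `v` gains q^e. The edges through `v` shrink and become q times as heavy, which costs
    -- at most (q - 1) q^e′.
    ... | inj₁ light = let S , uS , S⊆ , h = derandomise V u (E₀ ++ map (remove v) E₁) edges′ in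
      v ∷ S , AllP.¬Any⇒All¬ S (λ h → v∉V (S⊆ h)) ∷ uS ,
      (λ { (here refl) → here refl ; (there h) → there (S⊆ h) }) , (begin
      q ℕ.^ e ℕ.* sumOver (covered (v ∷ S)) E ℕ.+ q ℕ.^ e′ ℕ.* suc (length V)
        ≤⟨ ℕ.+-monoˡ-≤ _ (ℕ.*-monoʳ-≤ (q ℕ.^ e) (covered-E S)) ⟩
      q ℕ.^ e ℕ.* sumOver (covered S) (E₀ ++ map (remove v) E₁) ℕ.+ q ℕ.^ e′ ℕ.* suc (length V)
        ≡⟨ eq₁ (q ℕ.^ e ℕ.* sumOver (covered S) (E₀ ++ map (remove v) E₁)) (q ℕ.^ e′) (length V) ⟩
      (q ℕ.^ e ℕ.* sumOver (covered S) (E₀ ++ map (remove v) E₁) ℕ.+ q ℕ.^ e′ ℕ.* length V) ℕ.+ q ℕ.^ e′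
        ≤⟨ ℕ.+-monoˡ-≤ (q ℕ.^ e′) h ⟩
      (q ℕ.^ e ℕ.* length S ℕ.+ sumOver w (E₀ ++ map (remove v) E₁)) ℕ.+ q ℕ.^ e′
        ≡⟨ cong (λ z → (q ℕ.^ e ℕ.* length S ℕ.+ z) ℕ.+ q ℕ.^ e′) (trans (sumOver-++ w E₀ _) (cong (sumOver w E₀ ℕ.+_) weight-E₁)) ⟩
      (q ℕ.^ e ℕ.* length S ℕ.+ (sumOver w E₀ ℕ.+ sumOver w E₁ ℕ.* q)) ℕ.+ q ℕ.^ e′
        ≤⟨ split q (q ℕ.^ e′) (length S) (sumOver w E₀) (sumOver w E₁) light ⟩
      q ℕ.^ e ℕ.* suc (length S) ℕ.+ (sumOver w E₁ ℕ.+ sumOver w E₀)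
        ≡⟨ cong (q ℕ.^ e ℕ.* suc (length S) ℕ.+_) (sym (sumOver-filter-¬ (v ∈?_) w E)) ⟩
      q ℕ.^ e ℕ.* suc (length S) ℕ.+ sumOver w E ∎)
      where
      open ℕ.≤-Reasoning
      E₀ = filter (¬? ∘ (v ∈?_)) E
      E₁ = filter (v ∈?_) E
      v∉V : ¬ (v ∈ˡ V)
      v∉V h = All.lookup v∉ h refl
      eq₁ : ∀ x y z → x ℕ.+ y ℕ.* suc z ≡ (x ℕ.+ y ℕ.* z) ℕ.+ y
      eq₁ = ℕ-Ring.solve-∀
      edges₁ : All IsEdge E₁
      edges₁ = AllP.filter⁺ (v ∈?_) hE
      edges′ : All IsEdge (E₀ ++ map (remove v) E₁)
      edges′ = AllP.++⁺ (AllP.filter⁺ (¬? ∘ (v ∈?_)) hE)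
        (AllP.map⁺ (All.map (λ { {ε} (uε , l) → filter⁺ (λ y → ¬? (v ≟ y)) uε ,
          ℕ.≤-trans (List.length-filter (λ y → ¬? (v ≟ y)) ε) l }) edges₁))
      weight-E₁ : sumOver w (map (remove v) E₁) ≡ sumOver w E₁ ℕ.* q
      weight-E₁ = trans (sumOver-map w (remove v) E₁)
        (trans (go E₁ edges₁ (All.tabulate λ hε → proj₂ (∈-filter⁻ (v ∈?_) {xs = E} hε))) (sumOver-* w q E₁))
        where
        go : ∀ E → All IsEdge E → All (v ∈ˡ_) E → sumOver (w ∘ remove v) E ≡ sumOver (λ ε → w ε ℕ.* q) E
        go []      []              []         = refl
        go (ε ∷ E) ((uε , l) ∷ h) (v∈ ∷ v∈E) = cong₂ ℕ._+_
          (trans (cong (q ℕ.^_) (pred (length-remove-∈ uε v∈) l)) (ℕ.*-comm q (w ε)))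
          (go E h v∈E)
          where
          pred : ∀ {l l′} → l ≡ suc l′ → l ℕ.≤ e → e ℕ.∸ l′ ≡ suc (e ℕ.∸ l)
          pred refl h = ℕ.+-∸-assoc 1 (ℕ.≤-pred h)
      covered-E : ∀ S → sumOver (covered (v ∷ S)) E ℕ.≤ sumOver (covered S) (E₀ ++ map (remove v) E₁)
      covered-E S = begin
        sumOver (covered (v ∷ S)) E
          ≡⟨ trans (sumOver-filter-¬ (v ∈?_) (covered (v ∷ S)) E) (ℕ.+-comm (sumOver (covered (v ∷ S)) E₁) _) ⟩
        sumOver (covered (v ∷ S)) E₀ ℕ.+ sumOver (covered (v ∷ S)) E₁
          ≤⟨ ℕ.+-mono-≤
              (sumOver-mono E₀ λ {ε} hε → covered-mono λ h → All.tabulate λ {x} x∈ε →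
                tail (λ { refl → proj₂ (∈-filter⁻ (¬? ∘ (v ∈?_)) {xs = E} hε) x∈ε }) (All.lookup h x∈ε))
              (sumOver-mono E₁ λ {ε} _ → covered-mono λ h → All.tabulate λ {x} x∈ε →
                let x∈ , v≢x = ∈-filter⁻ (λ y → ¬? (v ≟ y)) {xs = ε} x∈ε in
                tail (v≢x ∘ sym) (All.lookup h x∈)) ⟩
        sumOver (covered S) E₀ ℕ.+ sumOver (covered S ∘ remove v) E₁
          ≡⟨ trans (sumOver-++ (covered S) E₀ _) (cong (sumOver (covered S) E₀ ℕ.+_) (sumOver-map (covered S) (remove v) E₁)) ⟨
        sumOver (covered S) (E₀ ++ map (remove v) E₁) ∎
        where
        tail : ∀ {x} → x ≢ v → x ∈ˡ v ∷ S → x ∈ˡ S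
        tail x≢v (here x≡v) = contradiction x≡v x≢v
        tail x≢v (there h)  = h
      split : ∀ q Y s a b .{{_ : ℕ.NonZero q}} → b ℕ.≤ Y →
        (q ℕ.* Y ℕ.* s ℕ.+ (a ℕ.+ b ℕ.* q)) ℕ.+ Y ℕ.≤ q ℕ.* Y ℕ.* suc s ℕ.+ (b ℕ.+ a)
      split (suc q) Y s a b h = begin
        (suc q ℕ.* Y ℕ.* s ℕ.+ (a ℕ.+ b ℕ.* suc q)) ℕ.+ Y
          ≡⟨ eqˡ q Y s a b ⟩
        (suc q ℕ.* Y ℕ.* s ℕ.+ a ℕ.+ b ℕ.+ Y) ℕ.+ q ℕ.* b
          ≤⟨ ℕ.+-monoʳ-≤ (suc q ℕ.* Y ℕ.* s ℕ.+ a ℕ.+ b ℕ.+ Y) (ℕ.*-monoʳ-≤ q h) ⟩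
        (suc q ℕ.* Y ℕ.* s ℕ.+ a ℕ.+ b ℕ.+ Y) ℕ.+ q ℕ.* Y
          ≡⟨ eqʳ q Y s a b ⟩
        suc q ℕ.* Y ℕ.* suc s ℕ.+ (b ℕ.+ a) ∎
        where
        eqˡ : ∀ q Y s a b → (suc q ℕ.* Y ℕ.* s ℕ.+ (a ℕ.+ b ℕ.* suc q)) ℕ.+ Y
            ≡ (suc q ℕ.* Y ℕ.* s ℕ.+ a ℕ.+ b ℕ.+ Y) ℕ.+ q ℕ.* b
        eqˡ = ℕ-Ring.solve-∀
        eqʳ : ∀ q Y s a b → (suc q ℕ.* Y ℕ.* s ℕ.+ a ℕ.+ b ℕ.+ Y) ℕ.+ q ℕ.* Y
            ≡ suc q ℕ.* Y ℕ.* suc s ℕ.+ (b ℕ.+ a)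
        eqʳ = ℕ-Ring.solve-∀

    -- Each edge that is still covered when its turn comes loses its first point. Removing points
    -- covers no new edge, so the initial number of covered edges bounds the loss.
    prune : ∀ E → All (λ ε → length ε ≡ e) E → ∀ S → Unique S →
      ∃[ S′ ] Unique S′ × S′ ⊆ˡ S × All (λ ε → ¬ All (_∈ˡ S′) ε) E ×
        length S ℕ.≤ length S′ ℕ.+ sumOver (covered S) E
    prune []            []       S u = S , u , id , [] , ℕ.m≤m+n _ 0
    prune ((x ∷ ε) ∷ E) (l ∷ hE) S u with All.all? (_∈? S) (x ∷ ε)
    ... | yes h = let S′ , u′ , S′⊆ , ¬c , b = prune E hE (remove x S) (filter⁺ (λ y → ¬? (x ≟ y)) u) in
      S′ , u′ , (λ h → proj₁ (∈-filter⁻ (λ y → ¬? (x ≟ y)) {xs = S} (S′⊆ h))) ,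
      (λ { (x∈ ∷ _) → proj₂ (∈-filter⁻ (λ y → ¬? (x ≟ y)) {xs = S} (S′⊆ x∈)) refl }) ∷ ¬c ,
      (begin
      length S                                                  ≤⟨ length-remove x u ⟩
      suc (length (remove x S))                                 ≤⟨ ℕ.s≤s b ⟩
      suc (length S′ ℕ.+ sumOver (covered (remove x S)) E)      ≤⟨ ℕ.s≤s (ℕ.+-monoʳ-≤ (length S′) (sumOver-mono E λ _ →
                                                                     covered-mono (All.map (λ h → proj₁ (∈-filter⁻ (λ y → ¬? (x ≟ y)) {xs = S} h))))) ⟩
      suc (length S′ ℕ.+ sumOver (covered S) E)                 ≡⟨ ℕ.+-suc (length S′) _ ⟨
      length S′ ℕ.+ suc (sumOver (covered S) E)                 ∎)
      where open ℕ.≤-Reasoning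
    ... | no ¬h = let S′ , u′ , S′⊆ , ¬c , b = prune E hE S u in
      S′ , u′ , S′⊆ , (λ h → ¬h (All.map S′⊆ h)) ∷ ¬c , b

    -- Density 1/q keeps ∣V∣ / q points on average, and the hypothesis bounds the expected number
    -- ∣E∣ / q^e of covered edges by half of that.
    independent-set : ∀ V → Unique V → ∀ E → All (λ ε → Unique ε × length ε ≡ e) E →
      2 ℕ.* length E ℕ.≤ q ℕ.^ e′ ℕ.* length V →
      ∃[ S ] Unique S × S ⊆ˡ V × All (λ ε → ¬ All (_∈ˡ S) ε) E × length V ℕ.≤ 2 ℕ.* q ℕ.* length S
    independent-set V u E hE few =
      let S , uS , S⊆ , h = derandomise V u E (All.map (λ { (u , l) → u , ℕ.≤-reflexive l }) hE)
          S′ , uS′ , S′⊆ , ¬c , b = prune E (All.map proj₂ hE) S uS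
      in S′ , uS′ , S⊆ ∘ S′⊆ , ¬c , ℕ.*-cancelˡ-≤ (q ℕ.^ e′) {{ℕ.m^n≢0 q e′}} (ℕ.+-cancelˡ-≤ (q ℕ.^ e′ ℕ.* length V) _ _
        (ℕ.+-cancelˡ-≤ (2 ℕ.* (q ℕ.^ e ℕ.* sumOver (covered S) E)) _ _ (begin
      2 ℕ.* (q ℕ.^ e ℕ.* sumOver (covered S) E) ℕ.+ (q ℕ.^ e′ ℕ.* length V ℕ.+ q ℕ.^ e′ ℕ.* length V)
        ≡⟨ eq₁ (q ℕ.^ e ℕ.* sumOver (covered S) E) (q ℕ.^ e′ ℕ.* length V) ⟩
      2 ℕ.* (q ℕ.^ e ℕ.* sumOver (covered S) E ℕ.+ q ℕ.^ e′ ℕ.* length V)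
        ≤⟨ ℕ.*-monoʳ-≤ 2 h ⟩
      2 ℕ.* (q ℕ.^ e ℕ.* length S ℕ.+ sumOver w E)
        ≡⟨ cong (λ z → 2 ℕ.* (q ℕ.^ e ℕ.* length S ℕ.+ z)) (weights E hE) ⟩
      2 ℕ.* (q ℕ.^ e ℕ.* length S ℕ.+ length E)
        ≤⟨ ℕ.*-monoʳ-≤ 2 (ℕ.+-monoˡ-≤ (length E) (ℕ.*-monoʳ-≤ (q ℕ.^ e) b)) ⟩
      2 ℕ.* (q ℕ.^ e ℕ.* (length S′ ℕ.+ sumOver (covered S) E) ℕ.+ length E)
        ≡⟨ eq₂ q (q ℕ.^ e′) (length S′) (sumOver (covered S) E) (length E) ⟩
      2 ℕ.* (q ℕ.^ e ℕ.* sumOver (covered S) E) ℕ.+ (2 ℕ.* length E ℕ.+ q ℕ.^ e′ ℕ.* (2 ℕ.* q ℕ.* length S′))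
        ≤⟨ ℕ.+-monoʳ-≤ (2 ℕ.* (q ℕ.^ e ℕ.* sumOver (covered S) E)) (ℕ.+-monoˡ-≤ (q ℕ.^ e′ ℕ.* (2 ℕ.* q ℕ.* length S′)) few) ⟩
      2 ℕ.* (q ℕ.^ e ℕ.* sumOver (covered S) E) ℕ.+ (q ℕ.^ e′ ℕ.* length V ℕ.+ q ℕ.^ e′ ℕ.* (2 ℕ.* q ℕ.* length S′)) ∎)))
      where
      open ℕ.≤-Reasoning
      eq₁ : ∀ x y → 2 ℕ.* x ℕ.+ (y ℕ.+ y) ≡ 2 ℕ.* (x ℕ.+ y)
      eq₁ = ℕ-Ring.solve-∀
      eq₂ : ∀ q y s c l → 2 ℕ.* (q ℕ.* y ℕ.* (s ℕ.+ c) ℕ.+ l)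
          ≡ 2 ℕ.* (q ℕ.* y ℕ.* c) ℕ.+ (2 ℕ.* l ℕ.+ y ℕ.* (2 ℕ.* q ℕ.* s))
      eq₂ = ℕ-Ring.solve-∀
      weights : ∀ E → All (λ ε → Unique ε × length ε ≡ e) E → sumOver w E ≡ length E
      weights []      []            = refl
      weights (ε ∷ E) ((_ , l) ∷ h) = cong₂ ℕ._+_ (cong (q ℕ.^_) (trans (cong (e ℕ.∸_) l) (ℕ.n∸n≡0 e))) (weights E h)

-- Linear algebra over ℝ

module _ where
  open import Data.Rational.Base renaming (∣_∣ to ∣_∣ℚ)
  open ℚ-Solver.+-*-Solver
  open ℚ.≤-Reasoning

  Null : (ℕ → ℚ) → Set
  Null s = ∀ ε → 0ℚ < ε → ∃[ N ] ∀ n → N ℕ.≤ n → ∣ s n ∣ℚ ≤ ε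

  Apart : (ℕ → ℚ) → Set
  Apart s = ∃[ β ] 0ℚ < β × ∃[ N ] ∀ n → N ℕ.≤ n → β ≤ ∣ s n ∣ℚ

  0<½* : ∀ {ε} → 0ℚ < ε → 0ℚ < ½ * ε
  0<½* {ε} 0<ε = subst (_< ½ * ε) (ℚ.*-zeroʳ ½) (ℚ.*-monoʳ-<-pos ½ 0<ε)

  ½+½ : ∀ ε → ½ * ε + ½ * ε ≡ ε
  ½+½ ε = trans (sym (ℚ.*-distribʳ-+ ε ½ ½)) (ℚ.*-identityˡ ε)

  null-cong : ∀ {s t} → (∀ n → s n ≡ t n) → Null s → Null t
  null-cong e h ε 0<ε = let N , hN = h ε 0<ε in N , λ n le → subst (λ z → ∣ z ∣ℚ ≤ ε) (e n) (hN n le)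

  null-zero : ∀ {s} → (∀ n → s n ≡ 0ℚ) → Null s
  null-zero e = null-cong (λ n → sym (e n)) λ ε 0<ε → 0 , λ _ _ → ℚ.<⇒≤ 0<ε

  null-+ : ∀ {s t} → Null s → Null t → Null (λ n → s n + t n)
  null-+ {s} {t} hs ht ε 0<ε =
    let M , hM = hs (½ * ε) (0<½* 0<ε)
        N , hN = ht (½ * ε) (0<½* 0<ε)
    in M ℕ.+ N , λ n le → begin
      ∣ s n + t n ∣ℚ        ≤⟨ ℚ.∣p+q∣≤∣p∣+∣q∣ (s n) (t n) ⟩
      ∣ s n ∣ℚ + ∣ t n ∣ℚ    ≤⟨ ℚ.+-mono-≤ (hM n (ℕ.m+n≤o⇒m≤o M le)) (hN n (ℕ.m+n≤o⇒n≤o M le)) ⟩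
      ½ * ε + ½ * ε        ≡⟨ ½+½ ε ⟩
      ε                    ∎

  scaleBy : ∀ B ε → 0ℚ < B → 0ℚ < ε → ∃[ δ ] 0ℚ < δ × δ * B ≡ ε
  scaleBy B ε 0<B 0<ε = ε * B⁻¹ , 0<δ ,
    trans (ℚ.*-assoc ε B⁻¹ B) (trans (cong (ε *_) (ℚ.*-inverseˡ B {{B≢0}})) (ℚ.*-identityʳ ε))
    where
    B>0 : Positive B
    B>0 = positive 0<B
    B≢0 : NonZero B
    B≢0 = ℚ.pos⇒nonZero B {{B>0}}
    B⁻¹ : ℚ
    B⁻¹ = (1/ B) {{B≢0}}
    0<δ : 0ℚ < ε * B⁻¹
    0<δ = subst (_< ε * B⁻¹) (ℚ.*-zeroˡ B⁻¹) (ℚ.*-monoˡ-<-pos B⁻¹ {{ℚ.1/pos⇒pos B {{B>0}}}} 0<ε)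

  null-* : ∀ {s t} → IsCauchy t → Null s → Null (λ n → s n * t n)
  null-* {s} {t} ct hs ε 0<ε =
    let B , 0<B , M , hM = cauchy-bounded {t} ct
        δ , 0<δ , δB≡ε = scaleBy B ε 0<B 0<ε
        N , hN = hs δ 0<δ
    in M ℕ.+ N , λ n le → begin
      ∣ s n * t n ∣ℚ        ≡⟨ ℚ.∣p*q∣≡∣p∣*∣q∣ (s n) (t n) ⟩
      ∣ s n ∣ℚ * ∣ t n ∣ℚ    ≤⟨ ℚ.*-monoʳ-≤-nonNeg (∣ t n ∣ℚ) {{ℚ.∣-∣-nonNeg (t n)}} (hN n (ℕ.m+n≤o⇒n≤o M le)) ⟩
      δ * ∣ t n ∣ℚ          ≤⟨ ℚ.*-monoˡ-≤-nonNeg δ {{ℚ.pos⇒nonNeg δ {{positive 0<δ}}}} (hM n (ℕ.m+n≤o⇒m≤o M le)) ⟩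
      δ * B                ≡⟨ δB≡ε ⟩
      ε                    ∎

  apart⇒null : ∀ {s t} → Apart s → Null (λ n → s n * t n) → Null t
  apart⇒null {s} {t} (β , 0<β , M , hM) h ε 0<ε =
    let N , hN = h (β * ε) (subst (_< β * ε) (ℚ.*-zeroʳ β) (ℚ.*-monoʳ-<-pos β {{positive 0<β}} 0<ε))
    in M ℕ.+ N , λ n le → ℚ.*-cancelˡ-≤-pos β {{positive 0<β}} (begin
      β * ∣ t n ∣ℚ          ≤⟨ ℚ.*-monoʳ-≤-nonNeg (∣ t n ∣ℚ) {{ℚ.∣-∣-nonNeg (t n)}} (hM n (ℕ.m+n≤o⇒m≤o M le)) ⟩
      ∣ s n ∣ℚ * ∣ t n ∣ℚ    ≡⟨ ℚ.∣p*q∣≡∣p∣*∣q∣ (s n) (t n) ⟨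
      ∣ s n * t n ∣ℚ        ≤⟨ hN n (ℕ.m+n≤o⇒n≤o M le) ⟩
      β * ε                ∎)

  triangle : ∀ x y → ∣ x ∣ℚ ≤ ∣ x - y ∣ℚ + ∣ y ∣ℚ
  triangle x y = subst (λ z → ∣ z ∣ℚ ≤ ∣ x - y ∣ℚ + ∣ y ∣ℚ)
    (solve 2 (λ x y → (x :- y) :+ y := x) refl x y) (ℚ.∣p+q∣≤∣p∣+∣q∣ (x - y) y)

  -- A single term decides: beyond an index where the sequence varies by at most ε/4, it is compared
  -- with ε/2.
  null-or-apart : ∀ {s} → IsCauchy s → ∀ ε → 0ℚ < ε → (∃[ N ] ∀ n → N ℕ.≤ n → ∣ s n ∣ℚ ≤ ε) ⊎ Apart s
  null-or-apart {s} cs ε 0<ε with cs (½ * (½ * ε)) (0<½* (0<½* 0<ε))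
  ... | N , hN with ∣ s N ∣ℚ ℚ.≤? ½ * ε
  ...   | yes small = inj₁ (N , λ n le → begin
      ∣ s n ∣ℚ                          ≤⟨ triangle (s n) (s N) ⟩
      ∣ s n - s N ∣ℚ + ∣ s N ∣ℚ          ≤⟨ ℚ.+-mono-≤ (hN n N le ℕ.≤-refl) small ⟩
      ½ * (½ * ε) + ½ * ε              ≤⟨ ℚ.+-monoˡ-≤ (½ * ε) (half≤ (½ * ε) (0<½* 0<ε)) ⟩
      ½ * ε + ½ * ε                    ≡⟨ ½+½ ε ⟩
      ε                                ∎)
    where
    half≤ : ∀ x → 0ℚ < x → ½ * x ≤ x
    half≤ x 0<x = begin
      ½ * x            ≡⟨ ℚ.+-identityʳ (½ * x) ⟨
      ½ * x + 0ℚ       ≤⟨ ℚ.+-monoʳ-≤ (½ * x) (ℚ.<⇒≤ (0<½* 0<x)) ⟩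
      ½ * x + ½ * x    ≡⟨ ½+½ x ⟩
      x                ∎
  ...   | no large = inj₂ (½ * (½ * ε) , 0<½* (0<½* 0<ε) , N , λ n le → begin
      ½ * (½ * ε)
        ≡⟨ solve 1 (λ x → x := (x :+ x) :- x) refl (½ * (½ * ε)) ⟩
      (½ * (½ * ε) + ½ * (½ * ε)) - ½ * (½ * ε)
        ≡⟨ cong (_- ½ * (½ * ε)) (½+½ (½ * ε)) ⟩
      ½ * ε - ½ * (½ * ε)
        ≤⟨ ℚ.+-mono-≤ (ℚ.<⇒≤ (ℚ.≰⇒> large)) (ℚ.neg-antimono-≤ (hN N n ℕ.≤-refl le)) ⟩
      ∣ s N ∣ℚ - ∣ s N - s n ∣ℚ
        ≤⟨ Defs.≤+⇒-≤ {∣ s N ∣ℚ} {∣ s N - s n ∣ℚ} {∣ s n ∣ℚ} (triangle (s N) (s n)) ⟩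
      ∣ s n ∣ℚ ∎)

  ¬null⇒apart : ∀ {s} → IsCauchy s → ¬ Null s → ¬ ¬ Apart s
  ¬null⇒apart cs ¬null ¬apart = ¬null λ ε 0<ε → case null-or-apart cs ε 0<ε of λ where
    (inj₁ h) → h
    (inj₂ h) → contradiction h ¬apart

  apart⇒¬null : ∀ {s} → Apart s → ¬ Null s
  apart⇒¬null {s} (β , 0<β , M , hM) h =
    let N , hN = h (½ * β) (0<½* 0<β)
    in ℚ.<-irrefl refl (begin-strict
      β                ≤⟨ hM (M ℕ.+ N) (ℕ.m≤m+n M N) ⟩
      ∣ s (M ℕ.+ N) ∣ℚ  ≤⟨ hN (M ℕ.+ N) (ℕ.m≤n+m N M) ⟩
      ½ * β            ≡⟨ ℚ.+-identityʳ (½ * β) ⟨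
      ½ * β + 0ℚ       <⟨ ℚ.+-monoʳ-< (½ * β) (0<½* 0<β) ⟩
      ½ * β + ½ * β    ≡⟨ ½+½ β ⟩
      β                ∎)

  -- For each fixed ε the alternative of `null-or-apart` is constructive, and its second case is
  -- refuted.
  null-stable : ∀ {s} → IsCauchy s → ¬ ¬ Null s → Null s
  null-stable cs ¬¬null ε 0<ε with null-or-apart cs ε 0<ε
  ... | inj₁ h = h
  ... | inj₂ h = contradiction (apart⇒¬null h) ¬¬null

  apart-const : ∀ q → q ≢ 0ℚ → Apart (λ _ → q)
  apart-const q q≢0 = ∣ q ∣ℚ , ℚ.positive⁻¹ (∣ q ∣ℚ) {{ℚ.nonNeg∧nonZero⇒pos (∣ q ∣ℚ) {{ℚ.∣-∣-nonNeg q}} {{nz}}}} , 0 , λ _ _ → ℚ.≤-refl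
    where
    nz : NonZero ∣ q ∣ℚ
    nz = ≢-nonZero λ e → q≢0 (ℚ.∣p∣≡0⇒p≡0 q e)

  sumF : ∀ {n} → (Fin n → ℚ) → ℚ
  sumF {zero}  f = 0ℚ
  sumF {suc n} f = f zero + sumF (f ∘ suc)

  sumF-cong : ∀ {n} {f g : Fin n → ℚ} → (∀ i → f i ≡ g i) → sumF f ≡ sumF g
  sumF-cong {zero}  h = refl
  sumF-cong {suc n} h = cong₂ _+_ (h zero) (sumF-cong (h ∘ suc))

  sumF-zero : ∀ {n} {f : Fin n → ℚ} → (∀ i → f i ≡ 0ℚ) → sumF f ≡ 0ℚ
  sumF-zero {zero}  h = refl
  sumF-zero {suc n} h = cong₂ _+_ (h zero) (sumF-zero (h ∘ suc))

  sumF-+ : ∀ {n} (f g : Fin n → ℚ) → sumF (λ i → f i + g i) ≡ sumF f + sumF g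
  sumF-+ {zero}  f g = refl
  sumF-+ {suc n} f g = trans (cong (λ t → (f zero + g zero) + t) (sumF-+ (f ∘ suc) (g ∘ suc)))
    (solve 4 (λ a b c d → a :+ b :+ (c :+ d) := (a :+ c) :+ (b :+ d)) refl
      (f zero) (g zero) (sumF (f ∘ suc)) (sumF (g ∘ suc)))

  sumF-* : ∀ {n} (f : Fin n → ℚ) c → sumF (λ i → f i * c) ≡ sumF f * c
  sumF-* {zero}  f c = sym (ℚ.*-zeroˡ c)
  sumF-* {suc n} f c = trans (cong (λ t → f zero * c + t) (sumF-* (f ∘ suc) c))
    (sym (ℚ.*-distribʳ-+ c (f zero) (sumF (f ∘ suc))))

  sumF-swap : ∀ {m n} (f : Fin m → Fin n → ℚ) → sumF (λ i → sumF (f i)) ≡ sumF (λ j → sumF (λ i → f i j))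
  sumF-swap {zero} {n} f = sym (sumF-zero {n} λ _ → refl)
  sumF-swap {suc m} f = trans (cong (λ t → sumF (f zero) + t) (sumF-swap (f ∘ suc)))
    (sym (sumF-+ (f zero) (λ j → sumF (λ i → f (suc i) j))))

  sumF-elim : ∀ {n} (x y z : Fin n → ℚ) α β →
    sumF (λ i → x i * (α * y i - z i * β)) ≡ α * sumF (λ i → x i * y i) - sumF (λ i → x i * z i) * β
  sumF-elim {zero}  x y z α β = solve 2 (λ α β → con 0ℚ := α :* con 0ℚ :- con 0ℚ :* β) refl α β
  sumF-elim {suc n} x y z α β = trans (cong (λ t → x zero * (α * y zero - z zero * β) + t) (sumF-elim (x ∘ suc) (y ∘ suc) (z ∘ suc) α β))
    (solve 7 (λ x y z α β s t → x :* (α :* y :- z :* β) :+ (α :* s :- t :* β)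
                           := α :* (x :* y :+ s) :- (x :* z :+ t) :* β) refl
      (x zero) (y zero) (z zero) α β (sumF (λ i → x (suc i) * y (suc i))) (sumF (λ i → x (suc i) * z (suc i))))

  null-sum : ∀ {n} {f : Fin n → ℕ → ℚ} → (∀ i → Null (f i)) → Null (λ N → sumF (λ i → f i N))
  null-sum {zero}  h = null-zero λ _ → refl
  null-sum {suc n} h = null-+ (h zero) (null-sum (h ∘ suc))

  sumR : ∀ {n} → (Fin n → ℝ) → ℝ
  sumR {zero}  f = 0ℝ
  sumR {suc n} f = f zero Defs.+ sumR (f ∘ suc)

  seq-sumR : ∀ {n} (f : Fin n → ℝ) N → seq (sumR f) N ≡ sumF (λ i → seq (f i) N)
  seq-sumR {zero}  f N = refl
  seq-sumR {suc n} f N = cong (λ t → seq (f zero) N + t) (seq-sumR (f ∘ suc) N)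

  _-ᴿ_ : ℝ → ℝ → ℝ
  x -ᴿ y = x Defs.+ fromℚ (- 1ℚ) Defs.* y

  Relation : ∀ {k l} → (Fin l → Fin k → ℝ) → (Fin l → ℝ) → Set
  Relation c x = ∀ j → Null (λ N → sumF (λ i → seq (x i) N * seq (c i j) N))

  -- Elimination of a coordinate in which the first vector does not vanish.

  dependent : ∀ k l → k ℕ.≤ l → (c : Fin (suc l) → Fin k → ℝ) →
    ¬ ¬ (∃[ x ] Relation c x × ∃[ i ] ¬ Null (seq (x i)))
  dependent zero l _ c fail = fail ((λ _ → 1ℝ) , (λ ()) , zero , apart⇒¬null {λ _ → 1ℚ} (apart-const 1ℚ λ ()))
  dependent (suc k) (suc l) (ℕ.s≤s k≤l) c fail = ¬¬-excluded-middle λ where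
      -- The first vector is zero, so it alone gives a relation with coefficient 1.
      (no vanishes) → fail (unit , (λ j → null-cong (λ N → unit-sum j N)
        (null-stable (cauchy (c zero j)) λ ¬null → vanishes (j , ¬null))) , zero , apart⇒¬null {λ _ → 1ℚ} (apart-const 1ℚ λ ()))
      (yes (p , c₀p≢0)) → dependent k l k≤l (λ i j → c′ p i (Fin.punchIn p j)) λ where
        (x , rel , i , xᵢ≢0) → ¬null⇒apart (cauchy (c zero p)) c₀p≢0 λ apart → fail
          (lift p x , (λ j → null-cong (λ N → sym (lift-sum p x j N)) (extended p x rel j)) , suc i ,
           λ h → xᵢ≢0 (apart⇒null apart (null-cong (λ N → ℚ.*-comm (seq (x i) N) (seq (c zero p) N)) h)))
    where
    unit : Fin (suc (suc l)) → ℝ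
    unit zero    = 1ℝ
    unit (suc _) = 0ℝ
    unit-sum : ∀ j N → seq (c zero j) N ≡ sumF (λ i → seq (unit i) N * seq (c i j) N)
    unit-sum j N = sym (trans (cong₂ _+_ (ℚ.*-identityˡ (seq (c zero j) N))
      (sumF-zero λ i → ℚ.*-zeroˡ (seq (c (suc i) j) N))) (ℚ.+-identityʳ _))
    c′ : Fin (suc k) → Fin (suc l) → Fin (suc k) → ℝ
    c′ p i j = (c zero p Defs.* c (suc i) j) -ᴿ (c (suc i) p Defs.* c zero j)
    -- A relation among the eliminated vectors c₀ₚ cᵢ - cᵢₚ c₀, regrouped by the original vectors.
    lift : Fin (suc k) → (Fin (suc l) → ℝ) → Fin (suc (suc l)) → ℝ
    lift p x zero    = fromℚ (- 1ℚ) Defs.* sumR (λ i → x i Defs.* c (suc i) p)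
    lift p x (suc i) = x i Defs.* c zero p
    c′-seq : ∀ p i j N → seq (c′ p i j) N ≡ seq (c zero p) N * seq (c (suc i) j) N - seq (c (suc i) p) N * seq (c zero j) N
    c′-seq p i j N = solve 4 (λ a b c d → a :* b :+ (:- con 1ℚ) :* (c :* d) := a :* b :- c :* d) refl
      (seq (c zero p) N) (seq (c (suc i) j) N) (seq (c (suc i) p) N) (seq (c zero j) N)
    c′-sum : ∀ p x j N → sumF (λ i → seq (x i) N * seq (c′ p i j) N)
      ≡ seq (c zero p) N * sumF (λ i → seq (x i) N * seq (c (suc i) j) N)
        - sumF (λ i → seq (x i) N * seq (c (suc i) p) N) * seq (c zero j) N
    c′-sum p x j N = trans (sumF-cong λ i → cong (seq (x i) N *_) (c′-seq p i j N))
      (sumF-elim (λ i → seq (x i) N) (λ i → seq (c (suc i) j) N) (λ i → seq (c (suc i) p) N) (seq (c zero p) N) (seq (c zero j) N))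
    lift-sum : ∀ p x j N → sumF (λ i → seq (lift p x i) N * seq (c i j) N) ≡ sumF (λ i → seq (x i) N * seq (c′ p i j) N)
    lift-sum p x j N = trans (cong₂ _+_
        (cong (λ z → - 1ℚ * z * seq (c zero j) N) (seq-sumR (λ i → x i Defs.* c (suc i) p) N))
        (trans (sumF-cong λ i → solve 3 (λ a b c → a :* b :* c := a :* c :* b) refl (seq (x i) N) (seq (c zero p) N) (seq (c (suc i) j) N))
               (sumF-* (λ i → seq (x i) N * seq (c (suc i) j) N) (seq (c zero p) N))))
      (trans (solve 4 (λ s b t a → (:- con 1ℚ) :* s :* b :+ t :* a := a :* t :- s :* b) refl
        (sumF (λ i → seq (x i) N * seq (c (suc i) p) N)) (seq (c zero j) N)
        (sumF (λ i → seq (x i) N * seq (c (suc i) j) N)) (seq (c zero p) N))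
        (sym (c′-sum p x j N)))
    extended : ∀ p x → Relation (λ i j → c′ p i (Fin.punchIn p j)) x → ∀ j → Null (λ N → sumF (λ i → seq (x i) N * seq (c′ p i j) N))
    -- The recursive call sees only the coordinates other than `p`; at `p` the eliminated vectors
    -- vanish identically.
    extended p x rel j with p Fin.≟ j
    ... | yes refl = null-zero λ N → trans (c′-sum p x p N)
      (solve 2 (λ a t → a :* t :- t :* a := con 0ℚ) refl (seq (c zero p) N) (sumF (λ i → seq (x i) N * seq (c (suc i) p) N)))
    ... | no p≢j = subst (λ j → Null (λ N → sumF (λ i → seq (x i) N * seq (c′ p i j) N)))
      (Fin.punchIn-punchOut p≢j) (rel (Fin.punchOut p≢j))

-- Rank of the integer points of a real subspace

toℚ : ℤ → ℚ
toℚ z = z ℚ./ 1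

toℚᵘ-toℚ : ∀ z → ℚ.toℚᵘ (toℚ z) ℚᵘ.≃ ℚᵘ.mkℚᵘ z 0
toℚᵘ-toℚ z = ℚ.toℚᵘ-fromℚᵘ (ℚᵘ.mkℚᵘ z 0)

toℚ-* : ∀ x y → toℚ (x ℤ.* y) ≡ toℚ x ℚ.* toℚ y
toℚ-* x y = ℚ.toℚᵘ-injective (ℚᵘ.≃-trans (toℚᵘ-toℚ (x ℤ.* y))
  (ℚᵘ.≃-trans (ℚᵘ.≃-sym (ℚᵘ.*-cong (toℚᵘ-toℚ x) (toℚᵘ-toℚ y)))
  (ℚᵘ.≃-sym (ℚ.toℚᵘ-homo-* (toℚ x) (toℚ y)))))

toℚ-+ : ∀ x y → toℚ (x ℤ.+ y) ≡ toℚ x ℚ.+ toℚ y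
toℚ-+ x y = ℚ.toℚᵘ-injective (ℚᵘ.≃-trans (toℚᵘ-toℚ (x ℤ.+ y))
  (ℚᵘ.≃-trans (ℚᵘ.*≡* {ℚᵘ.mkℚᵘ (x ℤ.+ y) 0} {ℚᵘ.mkℚᵘ x 0 ℚᵘ.+ ℚᵘ.mkℚᵘ y 0}
    (cong (ℤ._* + 1) (sym (cong₂ ℤ._+_ (ℤ.*-identityʳ x) (ℤ.*-identityʳ y)))))
  (ℚᵘ.≃-trans (ℚᵘ.≃-sym (ℚᵘ.+-cong (toℚᵘ-toℚ x) (toℚᵘ-toℚ y)))
  (ℚᵘ.≃-sym (ℚ.toℚᵘ-homo-+ (toℚ x) (toℚ y))))))

toℚ-neg : ∀ x → toℚ (ℤ.- x) ≡ ℚ.- toℚ x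
toℚ-neg x = ℚ.toℚᵘ-injective (ℚᵘ.≃-trans (toℚᵘ-toℚ (ℤ.- x))
  (ℚᵘ.≃-trans (ℚᵘ.≃-sym (ℚᵘ.-‿cong (toℚᵘ-toℚ x))) (ℚᵘ.≃-sym (ℚ.toℚᵘ-homo‿- (toℚ x)))))

toℚ-combine : ∀ x v y w → toℚ (x ℤ.* v ℤ.- y ℤ.* w) ≡ toℚ x ℚ.* toℚ v ℚ.- toℚ y ℚ.* toℚ w
toℚ-combine x v y w = trans (toℚ-+ (x ℤ.* v) (ℤ.- (y ℤ.* w)))
  (cong₂ ℚ._+_ (toℚ-* x v) (trans (toℚ-neg (y ℤ.* w)) (cong ℚ.-_ (toℚ-* y w))))

toℚ≡0 : ∀ z → toℚ z ≡ 0ℚ → z ≡ 0ℤ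
toℚ≡0 z e with ℚᵘ.≃-trans (ℚᵘ.≃-sym (toℚᵘ-toℚ z)) (ℚ.toℚᵘ-cong e)
... | ℚᵘ.*≡* h = trans (sym (ℤ.*-identityʳ z)) h

toℝ : ℤ → ℝ
toℝ z = fromℚ (toℚ z)

≡⇒≈ : ∀ {x y : ℝ} → (∀ n → seq x n ≡ seq y n) → x Defs.≈ y
≡⇒≈ {x} {y} h = null-zero λ n → trans (cong (ℚ._- seq y n) (h n)) (ℚ.+-inverseʳ (seq y n))

module RankBound (m : ℕ) where
  open Elimination m
  open import Data.Rational.Base using (_+_; _*_; _-_; -_)
  open ℚ-Solver.+-*-Solver

  lattice : Subspace d → Lattice
  lattice U = record
    { Mem       = λ v → (toℝ ∘ v) ∈ₛ
    ; Mem-cong  = λ {v} {w} h → ∈-resp (λ i → ≡⇒≈ {toℝ (v i)} {toℝ (w i)} λ _ → cong toℚ (h i))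
    ; Mem-zero  = 0∈
    ; combine   = λ x {v} y {w} hv hw → ∈-resp
        (λ i → ≡⇒≈ {toℝ x Defs.* toℝ (v i) Defs.+ toℝ (ℤ.- y) Defs.* toℝ (w i)} {toℝ (x ℤ.* v i ℤ.- y ℤ.* w i)}
          λ _ → sym (trans (toℚ-combine x (v i) y (w i)) (cong (λ r → toℚ x * toℚ (v i) + r)
            (trans (ℚ.neg-distribˡ-* (toℚ y) (toℚ (w i))) (cong (_* toℚ (w i)) (sym (toℚ-neg y)))))))
        (+-closed (·-closed (toℝ x) hv) (·-closed (toℝ (ℤ.- y)) hw))
    ; saturated = λ x {v} x≢0 h → let instance x≢0′ = ℚ.≢-nonZero (x≢0 ∘ toℚ≡0 x) in ∈-resp
        (λ i → ≡⇒≈ {fromℚ (ℚ.1/ toℚ x) Defs.* toℝ (x ℤ.* v i)} {toℝ (v i)}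
          λ _ → trans (cong (ℚ.1/ toℚ x *_) (toℚ-* x (v i)))
            (trans (sym (ℚ.*-assoc (ℚ.1/ toℚ x) (toℚ x) (toℚ (v i))))
              (trans (cong (_* toℚ (v i)) (ℚ.*-inverseˡ (toℚ x))) (ℚ.*-identityˡ (toℚ (v i))))))
        (·-closed (fromℚ (ℚ.1/ toℚ x)) h)
    }
    where open Subspace U

  vec : (bs : Flag) → Fin (length bs) → Coords
  vec bs i = lookup (proj₁ (List.lookup bs i))

  Vanishing : ∀ {l} → (Fin l → Coords) → (Fin l → ℝ) → Set
  Vanishing V x = ∀ j → Null (λ N → sumF (λ i → seq (x i) N * toℚ (V i j)))

  red-vanishing : ∀ {l} bs (V : Fin l → Coords) x → Vanishing V x → Vanishing (red bs ∘ V) x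
  red-vanishing []             V x h = h
  red-vanishing ((b , _) ∷ bs) V x h j = null-cong
    (λ N → sym (trans (sumF-cong λ i → cong (seq (x i) N *_) (toℚ-combine (b′ p) (W i j) (W i p) (b′ j)))
      (trans (sumF-elim (λ i → seq (x i) N) (λ i → toℚ (W i j)) (λ i → toℚ (W i p)) (toℚ (b′ p)) (toℚ (b′ j)))
        (solve 4 (λ a s t b → a :* s :- t :* b := s :* a :+ t :* (:- b)) refl
          (toℚ (b′ p)) (sumF (λ i → seq (x i) N * toℚ (W i j))) (sumF (λ i → seq (x i) N * toℚ (W i p))) (toℚ (b′ j))))))
    (null-+ (null-* (cauchy (fromℚ (toℚ (b′ p)))) (ih j)) (null-* (cauchy (fromℚ (- toℚ (b′ j)))) (ih p)))
    where
    b′ = red bs (lookup b)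
    p  = pivot b′
    W : Fin _ → Coords
    W i = red bs (V i)
    ih : Vanishing W x
    ih = red-vanishing bs V x h

  vec-Elim : ∀ bs i → Elim bs (vec bs i)
  vec-Elim ((b , a) ∷ bs) zero    = Elim-head b a bs
  vec-Elim (b ∷ bs)       (suc i) = Elim-weaken b bs (vec-Elim bs i)

  -- Integer elimination acts on relations with real coefficients too: `red bs` annihilates all
  -- vectors but the first, so the pivot entry of the first, a nonzero integer, times its
  -- coefficient is zero. That coefficient is then dropped and the argument repeated.
  indep⇒trivial : ∀ bs → Indep bs → ∀ x → Vanishing (vec bs) x → ∀ i → Null (seq (x i))
  indep⇒trivial ((b , a) ∷ bs) (b∉ , ind) x h = λ { zero → x₀-null ; (suc i) → indep⇒trivial bs ind (x ∘ suc) rest i }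
    where
    b′ = red bs (lookup b)
    p  = pivot b′
    x₀-null : Null (seq (x zero))
    x₀-null = apart⇒null (apart-const (toℚ (b′ p)) (λ e → b∉ (pivot≡0 b′ (toℚ≡0 (b′ p) e))))
      (null-cong (λ N → trans
        (cong (λ r → seq (x zero) N * toℚ (b′ p) + r) (sumF-zero λ i →
          trans (cong (λ z → seq (x (suc i)) N * toℚ z) (vec-Elim bs i p)) (ℚ.*-zeroʳ (seq (x (suc i)) N))))
        (trans (ℚ.+-identityʳ _) (ℚ.*-comm (seq (x zero) N) (toℚ (b′ p)))))
        (red-vanishing bs (vec ((b , a) ∷ bs)) x h p))
    rest : Vanishing (vec bs) (x ∘ suc)
    rest j = null-cong
      (λ N → solve 2 (λ y s → (y :+ s) :+ (:- y) := s) refl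
        (seq (x zero) N * toℚ (lookup b j)) (sumF (λ i → seq (x (suc i)) N * toℚ (vec bs i j))))
      (null-+ (h j) (null-cong (λ N → sym (ℚ.neg-distribʳ-* (seq (x zero) N) (toℚ (lookup b j))))
        (null-* (cauchy (fromℚ (- toℚ (lookup b j)))) x₀-null)))

  seq-linComb : ∀ {k} (a : Fin k → ℝ) (u : Fin k → Fin d → ℝ) j N →
    seq (linComb a u j) N ≡ sumF (λ t → seq (a t) N * seq (u t j) N)
  seq-linComb {zero}  a u j N = refl
  seq-linComb {suc k} a u j N = cong (λ r → seq (a zero) N * seq (u zero j) N + r) (seq-linComb (a ∘ suc) (u ∘ suc) j N)

  -- More than k vectors would have dependent coordinates in the basis, hence a nontrivial real
  -- relation, against `indep⇒trivial`. The claim is an inequality in ℕ, so the double negation can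
  -- be removed.
  rank≤ : ∀ U k → HasDimension U k → ∀ bs → Indep bs → InΛ (lattice U) bs → length bs ℕ.≤ k
  rank≤ U k _            []            _   _   = ℕ.z≤n
  rank≤ U k (u , basis) bs@(_ ∷ bs′) ind mem = decidable-stable (_ ℕ.≤? _) λ ≰k →
    dependent k (length bs′) (ℕ.≤-pred (ℕ.≰⇒> ≰k)) coef λ where
      (x , rel , i , xᵢ≢0) → xᵢ≢0 (indep⇒trivial bs ind x (vanishing x rel) i)
    where
    open IsBasis basis
    span : ∀ bs → InΛ (lattice U) bs → ∀ i → ∃[ a ] ∀ j → toℝ (vec bs i j) Defs.≈ linComb a u j
    span (b ∷ bs) (hb ∷ _)  zero    = spanning _ hb
    span (b ∷ bs) (_ ∷ hbs) (suc i) = span bs hbs i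
    coef : Fin (length bs) → Fin k → ℝ
    coef i = proj₁ (span bs mem i)
    vanishing : ∀ x → Relation coef x → Vanishing (vec bs) x
    vanishing x rel j = null-cong
      (λ N → trans (sym (sumF-+ (λ i → (toℚ (vec bs i j) - seq (linComb (coef i) u j) N) * seq (x i) N)
                           (λ i → seq (linComb (coef i) u j) N * seq (x i) N)))
        (sumF-cong λ i → solve 3 (λ v c x → (v :- c) :* x :+ c :* x := x :* v) refl
          (toℚ (vec bs i j)) (seq (linComb (coef i) u j) N) (seq (x i) N)))
      (null-+ (null-sum λ i → null-* {t = seq (x i)} (cauchy (x i)) (proj₂ (span bs mem i) j))
        (null-cong (λ N → trans (sumF-cong λ t → sym (sumF-* (λ i → seq (x i) N * seq (coef i t) N) (seq (u t j) N)))
            (trans (sumF-swap λ t i → seq (x i) N * seq (coef i t) N * seq (u t j) N)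
              (sumF-cong λ i → trans (sumF-cong λ t → solve 3 (λ x c u → x :* c :* u := c :* u :* x) refl
                  (seq (x i) N) (seq (coef i t) N) (seq (u t j) N))
                (trans (sumF-* (λ t → seq (coef i t) N * seq (u t j) N) (seq (x i) N))
                  (cong (_* seq (x i) N) (sym (seq-linComb (coef i) u j N)))))))
          (null-sum λ t → null-* (cauchy (u t j)) (rel t))))

-- Powers and logarithms

module _ where
  open import Data.Rational.Base renaming (∣_∣ to ∣_∣ℚ)
  open ℚ-Solver.+-*-Solver
  open ℚ.≤-Reasoning

  pow : ℚ → ℕ → ℚ
  pow x zero    = 1ℚ
  pow x (suc k) = x * pow x k

  seq-^ : ∀ x k N → seq (x Defs.^ k) N ≡ pow (seq x N) k
  seq-^ x zero    N = refl
  seq-^ x (suc k) N = cong (seq x N *_) (seq-^ x k N)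

  *-mono-≤ : ∀ {p q x y} → 0ℚ ≤ p → 0ℚ ≤ y → p ≤ q → x ≤ y → p * x ≤ q * y
  *-mono-≤ {p} {q} {x} {y} 0≤p 0≤y p≤q x≤y = ℚ.≤-trans
    (ℚ.*-monoˡ-≤-nonNeg p {{nonNegative 0≤p}} x≤y)
    (ℚ.*-monoʳ-≤-nonNeg y {{nonNegative 0≤y}} p≤q)

  0≤* : ∀ {p q} → 0ℚ ≤ p → 0ℚ ≤ q → 0ℚ ≤ p * q
  0≤* {p} {q} 0≤p 0≤q = subst (_≤ p * q) (ℚ.*-zeroˡ q) (ℚ.*-monoʳ-≤-nonNeg q {{nonNegative 0≤q}} 0≤p)

  0<* : ∀ {p q} → 0ℚ < p → 0ℚ < q → 0ℚ < p * q
  0<* {p} {q} 0<p 0<q = subst (_< p * q) (ℚ.*-zeroˡ q) (ℚ.*-monoˡ-<-pos q {{positive 0<q}} 0<p)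

  0<1 : 0ℚ < 1ℚ
  0<1 = ℚ.positive⁻¹ 1ℚ

  0≤pow : ∀ {x} k → 0ℚ ≤ x → 0ℚ ≤ pow x k
  0≤pow zero    0≤x = ℚ.<⇒≤ 0<1
  0≤pow (suc k) 0≤x = 0≤* 0≤x (0≤pow k 0≤x)

  0<pow : ∀ {x} k → 0ℚ < x → 0ℚ < pow x k
  0<pow zero    0<x = 0<1
  0<pow (suc k) 0<x = 0<* 0<x (0<pow k 0<x)

  pow-mono-≤ : ∀ {x y} k → 0ℚ ≤ x → x ≤ y → pow x k ≤ pow y k
  pow-mono-≤ zero    0≤x x≤y = ℚ.≤-refl
  pow-mono-≤ (suc k) 0≤x x≤y = *-mono-≤ 0≤x (0≤pow k (ℚ.≤-trans 0≤x x≤y)) x≤y (pow-mono-≤ k 0≤x x≤y)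

  pow-distrib-* : ∀ x y k → pow (x * y) k ≡ pow x k * pow y k
  pow-distrib-* x y zero    = refl
  pow-distrib-* x y (suc k) = trans (cong (x * y *_) (pow-distrib-* x y k))
    (solve 4 (λ x y z w → x :* y :* (z :* w) := x :* z :* (y :* w)) refl x y (pow x k) (pow y k))

  pow-superadditive : ∀ {x y} k → 0ℚ ≤ x → 0ℚ ≤ y → pow x (suc k) + pow y (suc k) ≤ pow (x + y) (suc k)
  pow-superadditive {x} {y} k 0≤x 0≤y = begin
    x * pow x k + y * pow y k
      ≤⟨ ℚ.+-mono-≤ (ℚ.*-monoˡ-≤-nonNeg x {{nonNegative 0≤x}} (pow-mono-≤ k 0≤x (x≤x+ x y 0≤y)))
                     (ℚ.*-monoˡ-≤-nonNeg y {{nonNegative 0≤y}} (pow-mono-≤ k 0≤y (subst (y ≤_) (ℚ.+-comm y x) (x≤x+ y x 0≤x)))) ⟩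
    x * pow (x + y) k + y * pow (x + y) k
      ≡⟨ ℚ.*-distribʳ-+ (pow (x + y) k) x y ⟨
    (x + y) * pow (x + y) k ∎
    where
    x≤x+ : ∀ x y → 0ℚ ≤ y → x ≤ x + y
    x≤x+ x y 0≤y = subst (_≤ x + y) (ℚ.+-identityʳ x) (ℚ.+-monoʳ-≤ x 0≤y)

  pow-≤ : ∀ {x} k → 0ℚ ≤ x → x ≤ 1ℚ → pow x (suc k) ≤ x
  pow-≤ {x} k 0≤x x≤1 = subst (x * pow x k ≤_) (ℚ.*-identityʳ x)
    (ℚ.*-monoˡ-≤-nonNeg x {{nonNegative 0≤x}} (pow≤1 k))
    where
    pow≤1 : ∀ k → pow x k ≤ 1ℚ
    pow≤1 zero    = ℚ.≤-refl
    pow≤1 (suc k) = ℚ.≤-trans (ℚ.*-monoˡ-≤-nonNeg x {{nonNegative 0≤x}} (pow≤1 k)) (subst (_≤ 1ℚ) (sym (ℚ.*-identityʳ x)) x≤1)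

  ≈-trans : ∀ x y z → x Defs.≈ y → y Defs.≈ z → x Defs.≈ z
  ≈-trans x y z h₁ h₂ = null-cong
    (λ N → solve 3 (λ a b c → (a :- b) :+ (b :- c) := a :- c) refl (seq x N) (seq y N) (seq z N))
    (null-+ {λ N → seq x N - seq y N} {λ N → seq y N - seq z N} h₁ h₂)

  ≈-^ : ∀ x y k → x Defs.≈ y → (x Defs.^ k) Defs.≈ (y Defs.^ k)
  ≈-^ x y zero    h = null-zero λ N → ℚ.+-inverseʳ 1ℚ
  ≈-^ x y (suc k) h = null-cong
    (λ N → solve 4 (λ x y p q → (x :- y) :* p :+ (p :- q) :* y := x :* p :- y :* q) refl
      (seq x N) (seq y N) (seq (x Defs.^ k) N) (seq (y Defs.^ k) N))
    (null-+ (null-* {λ N → seq x N - seq y N} (cauchy (x Defs.^ k)) h) (null-* {λ N → seq (x Defs.^ k) N - seq (y Defs.^ k) N} {seq y} (cauchy y) (≈-^ x y k h)))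

  ∣-∣≤⇒≤ : ∀ {x y δ} → ∣ x - y ∣ℚ ≤ δ → x ≤ y + δ
  ∣-∣≤⇒≤ {x} {y} {δ} h = begin
    x              ≡⟨ solve 2 (λ x y → x := y :+ (x :- y)) refl x y ⟩
    y + (x - y)    ≤⟨ ℚ.+-monoʳ-≤ y (ℚ.≤-trans (p≤∣p∣ (x - y)) h) ⟩
    y + δ          ∎
    where
    p≤∣p∣ : ∀ p → p ≤ ∣ p ∣ℚ
    p≤∣p∣ p with ℚ.≤-total 0ℚ p
    ... | inj₁ 0≤p = ℚ.≤-reflexive (sym (ℚ.0≤p⇒∣p∣≡p 0≤p))
    ... | inj₂ p≤0 = ℚ.≤-trans p≤0 (ℚ.0≤∣p∣ p)

  -- If m + ε < c y at a large index, multiply by b and take powers: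
  -- (m^Q + ε^Q) b^Q < c^Q (y b)^Q ≤ m^Q b^Q + O(δ), which fails for small δ.

  root-bound : ∀ (y b t : ℝ) (c κ : ℚ) → 0ℚ < c → c * κ ≡ 1ℚ → 1ℚ ≤ κ → (p M : ℚ) (k : ℕ) → 0ℚ ≤ M → let Q = suc k in
    0ℝ Defs.< b → Null (λ N → seq ((y Defs.* b) Defs.^ Q) N - p) → (b Defs.^ Q) Defs.≈ t →
    (∀ N → p ≤ κ * (pow M Q * seq t N)) →
    (fromℚ c Defs.* y) Defs.≤ fromℚ M
  root-bound y b t c κ 0<c c*κ 1≤κ p M k 0≤M (β , 0<β , N₀ , b≥β) hp ht bound ε 0<ε =
    let N₁ , h₁ = hp δ 0<δ
        N₂ , h₂ = ht δ 0<δ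
    in N₀ ℕ.+ (N₁ ℕ.+ N₂) , λ N le →
      at N (subst (_≤ seq b N) (ℚ.+-identityˡ β) (b≥β N (ℕ.m+n≤o⇒m≤o N₀ le)))
         (subst (λ z → ∣ z - p ∣ℚ ≤ δ) (seq-^ (y Defs.* b) Q N)
           (h₁ N (ℕ.m+n≤o⇒m≤o N₁ (ℕ.m+n≤o⇒n≤o N₀ le))))
         (subst (λ z → ∣ z - seq t N ∣ℚ ≤ δ) (seq-^ b Q N)
           (h₂ N (ℕ.m+n≤o⇒n≤o N₁ (ℕ.m+n≤o⇒n≤o N₀ le))))
    where
    Q = suc k
    0≤c : 0ℚ ≤ c
    0≤c = ℚ.<⇒≤ 0<c
    -- Yields c^Q ≤ c, so that `κ` itself, rather than its Q-th power, is cancelled.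
    c≤1 : c ≤ 1ℚ
    c≤1 = subst₂ _≤_ (ℚ.*-identityʳ c) c*κ (ℚ.*-monoˡ-≤-nonNeg c {{nonNegative 0≤c}} 1≤κ)
    MQ E : ℚ
    MQ = pow M Q
    E  = pow ε Q
    0≤MQ : 0ℚ ≤ MQ
    0≤MQ = 0≤pow Q 0≤M
    chosen : ∃[ δ ] 0ℚ < δ × δ * (MQ + 1ℚ) ≡ E * pow β Q
    -- The errors add up to at most δ from `p` and MQ δ from `t`. They must not exceed the surplus E
    -- B, which is at least E β^Q.
    chosen = scaleBy (MQ + 1ℚ) (E * pow β Q) (ℚ.+-mono-≤-< 0≤MQ 0<1) (0<* (0<pow Q 0<ε) (0<pow Q 0<β))
    δ = proj₁ chosen
    0<δ = proj₁ (proj₂ chosen)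
    δ-eq = proj₂ (proj₂ chosen)
    at : ∀ N → β ≤ seq b N → ∣ pow (seq y N * seq b N) Q - p ∣ℚ ≤ δ → ∣ pow (seq b N) Q - seq t N ∣ℚ ≤ δ →
      c * seq y N ≤ M + ε
    at N β≤b close-p close-t with c * seq y N ℚ.≤? M + ε
    ... | yes h = h
    ... | no ¬h = contradiction (ℚ.≤-<-trans lower (ℚ.<-≤-trans middle upper)) (ℚ.<-irrefl refl)
      where
      yN bN tN X B : ℚ
      yN = seq y N
      bN = seq b N
      tN = seq t N
      X  = M + ε
      B  = pow bN Q
      0<b : 0ℚ < bN
      0<b = ℚ.<-≤-trans 0<β β≤b
      0<X : 0ℚ < X
      0<X = ℚ.+-mono-≤-< 0≤M 0<ε
      0<y : 0ℚ < yN
      0<y = ℚ.*-cancelˡ-<-nonNeg c {{nonNegative 0≤c}} (subst (_< c * yN) (sym (ℚ.*-zeroʳ c)) (ℚ.<-trans 0<X (ℚ.≰⇒> ¬h)))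
      0<z : 0ℚ < yN * bN
      0<z = 0<* 0<y 0<b
      lower : (MQ + E) * B ≤ pow (X * bN) Q
      lower = begin
        (MQ + E) * B          ≤⟨ ℚ.*-monoʳ-≤-nonNeg B {{nonNegative (0≤pow Q (ℚ.<⇒≤ 0<b))}} (pow-superadditive k 0≤M (ℚ.<⇒≤ 0<ε)) ⟩
        pow X Q * B           ≡⟨ pow-distrib-* X bN Q ⟨
        pow (X * bN) Q        ∎
      pow-mono-< : ∀ {x z} → 0ℚ < x → x < z → pow x Q < pow z Q
      pow-mono-< {x} {z} 0<x x<z = ℚ.<-≤-trans
        (ℚ.*-monoˡ-<-pos (pow x k) {{positive (0<pow k 0<x)}} x<z)
        (ℚ.*-monoˡ-≤-nonNeg z {{nonNegative (ℚ.<⇒≤ (ℚ.<-trans 0<x x<z))}} (pow-mono-≤ k (ℚ.<⇒≤ 0<x) (ℚ.<⇒≤ x<z)))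
      middle : pow (X * bN) Q < pow (c * (yN * bN)) Q
      middle = pow-mono-< (0<* 0<X 0<b) (subst (X * bN <_) (ℚ.*-assoc c yN bN)
        (ℚ.*-monoˡ-<-pos bN {{positive 0<b}} (ℚ.≰⇒> ¬h)))
      upper : pow (c * (yN * bN)) Q ≤ (MQ + E) * B
      upper = begin
        pow (c * (yN * bN)) Q
          ≡⟨ pow-distrib-* c (yN * bN) Q ⟩
        pow c Q * pow (yN * bN) Q
          ≤⟨ ℚ.*-monoʳ-≤-nonNeg (pow (yN * bN) Q) {{nonNegative (0≤pow Q (ℚ.<⇒≤ 0<z))}} (pow-≤ k 0≤c c≤1) ⟩
        c * pow (yN * bN) Q
          ≤⟨ ℚ.*-monoˡ-≤-nonNeg c {{nonNegative 0≤c}} (ℚ.≤-trans (∣-∣≤⇒≤ close-p) (ℚ.+-monoˡ-≤ δ (bound N))) ⟩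
        c * (κ * (MQ * tN) + δ)
          ≡⟨ solve 4 (λ c κ x δ → c :* (κ :* x :+ δ) := (c :* κ) :* x :+ c :* δ) refl c κ (MQ * tN) δ ⟩
        (c * κ) * (MQ * tN) + c * δ
          ≤⟨ ℚ.+-mono-≤ (ℚ.≤-reflexive (trans (cong (_* (MQ * tN)) c*κ) (ℚ.*-identityˡ (MQ * tN))))
               (subst (c * δ ≤_) (ℚ.*-identityˡ δ) (ℚ.*-monoʳ-≤-nonNeg δ {{nonNegative (ℚ.<⇒≤ 0<δ)}} c≤1)) ⟩
        MQ * tN + δ
          ≤⟨ ℚ.+-monoˡ-≤ δ (ℚ.*-monoˡ-≤-nonNeg MQ {{nonNegative 0≤MQ}} (t≤ close-t)) ⟩
        MQ * (B + δ) + δ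
          ≡⟨ solve 3 (λ m b δ → m :* (b :+ δ) :+ δ := m :* b :+ δ :* (m :+ con 1ℚ)) refl MQ B δ ⟩
        MQ * B + δ * (MQ + 1ℚ)
          ≡⟨ cong (λ z → MQ * B + z) δ-eq ⟩
        MQ * B + E * pow β Q
          ≤⟨ ℚ.+-monoʳ-≤ (MQ * B) (ℚ.*-monoˡ-≤-nonNeg E {{nonNegative (0≤pow Q (ℚ.<⇒≤ 0<ε))}} (pow-mono-≤ Q (ℚ.<⇒≤ 0<β) β≤b)) ⟩
        MQ * B + E * B
          ≡⟨ ℚ.*-distribʳ-+ B MQ E ⟨
        (MQ + E) * B ∎
        where
        t≤ : ∣ B - tN ∣ℚ ≤ δ → tN ≤ B + δ
        t≤ h = ∣-∣≤⇒≤ {tN} {B} (subst (_≤ δ) (trans (sym (ℚ.∣-p∣≡∣p∣ (B - tN)))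
          (cong ∣_∣ℚ (solve 2 (λ b t → :- (b :- t) := t :- b) refl B tN))) h)

fromℕ : ℕ → ℚ
fromℕ n = toℚ (+ n)

fromℕ-* : ∀ m n → fromℕ (m ℕ.* n) ≡ fromℕ m ℚ.* fromℕ n
fromℕ-* m n = trans (cong toℚ (ℤ.pos-* m n)) (toℚ-* (+ m) (+ n))

fromℕ-mono : ∀ {m n} → m ℕ.≤ n → fromℕ m ℚ.≤ fromℕ n
fromℕ-mono {m} {n} h = Defs./-mono-≤ {m} {0} {n} {0} (ℕ.*-monoˡ-≤ 1 h)

pow-fromℕ : ∀ n k → pow (fromℕ n) k ≡ fromℕ (n ℕ.^ k)
pow-fromℕ n zero    = refl
pow-fromℕ n (suc k) = trans (cong (fromℕ n ℚ.*_) (pow-fromℕ n k)) (sym (fromℕ-* n (n ℕ.^ k)))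

module _ where
  open import Data.Rational.Base renaming (∣_∣ to ∣_∣ℚ)
  open ℚ.≤-Reasoning
  open Defs.LogCauchy

  -- There are L terms, each at least 1 / (2L), as in the usual proof that the harmonic series
  -- diverges.
  dyadic-block : ∀ b j → let l = suc j ; L = 2 ℕ.^ b ℕ.* l in
    ½ ≤ Defs.sumℚ L (λ i → u (l ℕ.+ ((2 ℕ.^ b ℕ.∸ 1) ℕ.* l ℕ.+ i)))
  dyadic-block b j = begin
    ½
      ≤⟨ Defs./-mono-≤ {1} {1} {L ℕ.* 1} {ℕ.pred (2 ℕ.* L)} (ℕ.≤-reflexive
           (trans (cong (1 ℕ.*_) 2L) (trans (ℕ.*-identityˡ (2 ℕ.* L)) (trans (ℕ.*-comm 2 L) (cong (ℕ._* 2) (sym (ℕ.*-identityʳ L))))))) ⟩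
    + (L ℕ.* 1) / suc (ℕ.pred (2 ℕ.* L))
      ≡⟨ Defs./1-* L 1 (ℕ.pred (2 ℕ.* L)) ⟨
    (+ L / 1) * u (ℕ.pred (2 ℕ.* L))
      ≡⟨ sumℚ-const L (u (ℕ.pred (2 ℕ.* L))) ⟨
    Defs.sumℚ L (λ _ → u (ℕ.pred (2 ℕ.* L)))
      ≤⟨ sumℚ-mono L (λ i i<L → u-anti (ℕ.≤-pred (subst (suc (l ℕ.+ ((2 ℕ.^ b ℕ.∸ 1) ℕ.* l ℕ.+ i)) ℕ.≤_) (sym 2L) (term i i<L)))) ⟩
    Defs.sumℚ L (λ i → u (l ℕ.+ ((2 ℕ.^ b ℕ.∸ 1) ℕ.* l ℕ.+ i))) ∎
    where
    l = suc j
    L = 2 ℕ.^ b ℕ.* l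
    instance
      L≢0 : ℕ.NonZero L
      L≢0 = ℕ.m*n≢0 (2 ℕ.^ b) l {{ℕ.m^n≢0 2 b}}
    2L : suc (ℕ.pred (2 ℕ.* L)) ≡ 2 ℕ.* L
    2L = ℕ.suc-pred (2 ℕ.* L) {{ℕ.m*n≢0 2 L}}
    l+M : l ℕ.+ (2 ℕ.^ b ℕ.∸ 1) ℕ.* l ≡ L
    l+M = cong (ℕ._* l) (ℕ.m+[n∸m]≡n {1} {2 ℕ.^ b} (ℕ.m^n>0 2 b))
    term : ∀ i → i ℕ.< L → suc (l ℕ.+ ((2 ℕ.^ b ℕ.∸ 1) ℕ.* l ℕ.+ i)) ℕ.≤ 2 ℕ.* L
    term i i<L = subst₂ ℕ._≤_ (trans (ℕ.+-suc L i) (cong suc (trans (cong (ℕ._+ i) (sym l+M)) (ℕ.+-assoc l _ i))))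
      (cong (L ℕ.+_) (sym (ℕ.+-identityʳ L))) (ℕ.+-monoʳ-≤ L i<L)

  -- Each doubling of the interval of integration adds a block of at least 1/2, for every step
  -- length of the Riemann sum.
  dyadic-sum : ∀ b j → fromℕ b * ½ ≤ S (suc j) ((2 ℕ.^ b ℕ.∸ 1) ℕ.* suc j)
  dyadic-sum zero    j = ℚ.≤-reflexive (ℚ.*-zeroˡ ½)
  dyadic-sum (suc b) j = begin
    fromℕ (suc b) * ½
      ≡⟨ cong (_* ½) (Defs./1-suc b) ⟩
    (fromℕ b + 1ℚ) * ½
      ≡⟨ ℚ.*-distribʳ-+ ½ (fromℕ b) 1ℚ ⟩
    fromℕ b * ½ + 1ℚ * ½
      ≤⟨ ℚ.+-mono-≤ (dyadic-sum b j) (subst (_≤ top-block) (sym (ℚ.*-identityˡ ½)) (dyadic-block b j)) ⟩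
    S l M + top-block
      ≡⟨ sumℚ-++ M L (λ i → u (l ℕ.+ i)) ⟨
    S l (M ℕ.+ L)
      ≡⟨ cong (S l) (trans (sym (ℕ.*-distribʳ-+ l (2 ℕ.^ b ℕ.∸ 1) (2 ℕ.^ b)))
           (cong (ℕ._* l) (trans (sym (ℕ.+-∸-comm (2 ℕ.^ b) (ℕ.m^n>0 2 b)))
             (cong (λ z → 2 ℕ.^ b ℕ.+ z ℕ.∸ 1) (sym (ℕ.+-identityʳ (2 ℕ.^ b))))))) ⟩
    S l ((2 ℕ.^ suc b ℕ.∸ 1) ℕ.* l) ∎
    where
    l = suc j
    L = 2 ℕ.^ b ℕ.* l
    M = (2 ℕ.^ b ℕ.∸ 1) ℕ.* l
    top-block = Defs.sumℚ L (λ i → u (l ℕ.+ (M ℕ.+ i)))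

  log-lower : ∀ n b j → 2 ℕ.^ b ℕ.≤ n → fromℕ b * ½ ≤ Defs.log-seq n j
  log-lower n b j h = begin
    fromℕ b * ½               ≤⟨ dyadic-sum b j ⟩
    S l M                     ≡⟨ ℚ.+-identityʳ (S l M) ⟨
    S l M + 0ℚ                ≤⟨ ℚ.+-monoʳ-≤ (S l M) (sumℚ-nonneg R (λ i → u (l ℕ.+ (M ℕ.+ i))) λ i → 0≤u (l ℕ.+ (M ℕ.+ i))) ⟩
    S l M + Defs.sumℚ R (λ i → u (l ℕ.+ (M ℕ.+ i)))   ≡⟨ sumℚ-++ M R (λ i → u (l ℕ.+ i)) ⟨
    S l (M ℕ.+ R)             ≡⟨ cong (S l) (ℕ.m+[n∸m]≡n (ℕ.*-monoˡ-≤ l (ℕ.∸-monoˡ-≤ 1 h))) ⟩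
    S l ((n ℕ.∸ 1) ℕ.* l)     ∎
    where
    l = suc j
    M = (2 ℕ.^ b ℕ.∸ 1) ℕ.* l
    R = (n ℕ.∸ 1) ℕ.* l ℕ.∸ M
    sumℚ-nonneg : ∀ n f → (∀ i → 0ℚ ≤ f i) → 0ℚ ≤ Defs.sumℚ n f
    sumℚ-nonneg zero    f h = ℚ.≤-refl
    sumℚ-nonneg (suc n) f h = ℚ.+-mono-≤ (sumℚ-nonneg n f h) (h n)

dyadic-scale : ∀ n → 1 ℕ.≤ n → ∃[ b ] 2 ℕ.^ b ℕ.≤ n × n ℕ.< 2 ℕ.^ suc b
dyadic-scale (suc zero)    _ = 0 , ℕ.≤-refl , ℕ.≤-refl
dyadic-scale (suc (suc n)) _ with dyadic-scale (suc n) (ℕ.s≤s ℕ.z≤n)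
... | b , lo , hi with ℕ.m≤n⇒m<n∨m≡n hi
...   | inj₁ lt = b , ℕ.≤-trans lo (ℕ.n≤1+n (suc n)) , lt
...   | inj₂ eq = suc b , ℕ.≤-reflexive (sym eq) , subst (ℕ._< 2 ℕ.^ suc (suc b)) (sym eq)
    (ℕ.^-monoʳ-< 2 (ℕ.s≤s (ℕ.s≤s ℕ.z≤n)) (ℕ.n<1+n (suc b)))

-- Induction on `X`: the root is raised by one only when X overtakes its power, and suc q ≤ 2q then
-- gives the upper bound.
root-approx : ∀ k X → 1 ℕ.≤ X → ∃[ q ] 1 ℕ.≤ q × X ℕ.≤ q ℕ.^ suc k × q ℕ.^ suc k ℕ.≤ 2 ℕ.^ suc k ℕ.* X
root-approx k (suc zero) _ = 1 , ℕ.≤-refl , ℕ.≤-reflexive (sym (ℕ.^-zeroˡ (suc k))) ,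
  ℕ.≤-trans (ℕ.≤-reflexive (ℕ.^-zeroˡ (suc k))) (ℕ.≤-trans (ℕ.m^n>0 2 (suc k)) (ℕ.≤-reflexive (sym (ℕ.*-identityʳ (2 ℕ.^ suc k)))))
root-approx k (suc (suc X)) _ with root-approx k (suc X) (ℕ.s≤s ℕ.z≤n)
... | q , 1≤q , lo , hi with suc (suc X) ℕ.≤? q ℕ.^ suc k
...   | yes le = q , 1≤q , le , ℕ.≤-trans hi (ℕ.*-monoʳ-≤ (2 ℕ.^ suc k) (ℕ.n≤1+n (suc X)))
...   | no ¬le = suc q , ℕ.s≤s ℕ.z≤n , ℕ.≤-trans (ℕ.s≤s lo) (ℕ.^-monoˡ-< (suc k) (ℕ.n<1+n q)) , (begin
    suc q ℕ.^ suc k              ≤⟨ ℕ.^-monoˡ-≤ (suc k) (ℕ.+-mono-≤ 1≤q (ℕ.≤-reflexive (sym (ℕ.+-identityʳ q)))) ⟩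
    (2 ℕ.* q) ℕ.^ suc k          ≡⟨ ^-distribʳ-* (suc k) 2 q ⟩
    2 ℕ.^ suc k ℕ.* q ℕ.^ suc k  ≤⟨ ℕ.*-monoʳ-≤ (2 ℕ.^ suc k) (ℕ.<⇒≤ (ℕ.≰⇒> ¬le)) ⟩
    2 ℕ.^ suc k ℕ.* suc (suc X)  ∎)
  where open ℕ.≤-Reasoning

unique-vectors : ∀ {X : Set} {n} (r : Fin n → List X) → (∀ i → Unique (r i)) → Unique (vectors r)
unique-vectors {n = zero}  r h = [] ∷ []
unique-vectors {n = suc n} r h = unique-product _∷_ (λ { refl → refl , refl }) (h zero) (unique-vectors (r ∘ suc) (h ∘ suc))

length-vectors-≡ : ∀ {X : Set} {n} (xs : List X) → length (vectors {n = n} (λ _ → xs)) ≡ length xs ℕ.^ n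
length-vectors-≡ {n = zero}  xs = refl
length-vectors-≡ {n = suc n} xs = trans (length-product _∷_ xs _) (cong (length xs ℕ.*_) (length-vectors-≡ {n = n} xs))

fromTake : ∀ {X : Set} n (xs : List X) → n ℕ.≤ length xs → ∃[ v ] Vec.toList {n = n} v ≡ take n xs
fromTake zero    xs       h = [] , refl
fromTake (suc n) (x ∷ xs) (ℕ.s≤s h) = let v , e = fromTake n xs h in x ∷ v , cong (x ∷_) e

lookup-All : ∀ {X : Set} {P : X → Set} {n} (v : Vec X n) → All P (Vec.toList v) → ∀ i → P (lookup v i)
lookup-All (x ∷ v) (p ∷ ps) zero    = p
lookup-All (x ∷ v) (p ∷ ps) (suc i) = lookup-All v ps i

-- The lower bound

module LowerBound (m k′ e′ : ℕ) (k≤e′ : suc k′ ℕ.≤ e′) (e≤d : suc e′ ℕ.≤ suc m) where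
  open Elimination m using (d; Coords)
  private
    k = suc k′
    e = suc e′

  countC^e : ℕ → ℕ
  countC^e i = countC m i ℕ.^ e

  -- In `edgeK` the 2 is that of `independent-set`, `suc` ensures positivity, and (2^d)^k accounts
  -- for 2^A ≤ 2n. In `setK` one power 2^e′ comes from (2q)^e′ and the other from rounding the root
  -- `q`.
  edgeK setK : ℕ
  edgeK = 2 ℕ.* suc (edgesK m countC^e k) ℕ.* (2 ℕ.^ d) ℕ.^ k
  setK  = 2 ℕ.^ e′ ℕ.* 2 ℕ.^ e′ ℕ.* edgeK

  edgeK≥1 : 1 ℕ.≤ edgeK
  edgeK≥1 = ℕ.*-mono-≤ {1} {2 ℕ.* suc (edgesK m countC^e k)} (ℕ.*-mono-≤ {1} {2} {1} (ℕ.s≤s ℕ.z≤n) (ℕ.s≤s ℕ.z≤n))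
    (ℕ.m^n>0 (2 ℕ.^ d) {{ℕ.m^n≢0 2 d}} k)

  setK≥1 : 1 ℕ.≤ setK
  setK≥1 = ℕ.*-mono-≤ (ℕ.*-mono-≤ (ℕ.m^n>0 2 e′) (ℕ.m^n>0 2 e′)) edgeK≥1

  module _ (n A : ℕ) (n≤2^A : n ℕ.≤ 2 ℕ.^ A) where

    grid : List (Grid n d)
    grid = vectors (λ _ → allFin n)

    ∈-grid : ∀ p → p ∈ˡ grid
    ∈-grid p = ∈-vectors (λ _ → allFin n) p λ i → ∈-allFin (lookup p i)

    grid-unique : Unique grid
    grid-unique = unique-vectors {n = d} (λ _ → allFin n) λ _ → allFin⁺ n

    length-grid : length grid ≡ n ℕ.^ d
    length-grid = trans (length-vectors-≡ {n = d} (allFin n)) (cong (λ l → l ℕ.^ d) (List.length-tabulate {n = n} id))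

    ι : Grid n d → Coords
    ι p j = + suc (toℕ (lookup p j))

    ι-injective : ∀ {p q} → (∀ j → ι p j ≡ ι q j) → p ≡ q
    ι-injective {p} {q} h = ext p q λ j → Fin.toℕ-injective (ℕ.suc-injective (ℤ.+-injective (h j)))
      where
      ext : ∀ {d} (p q : Grid n d) → (∀ j → lookup p j ≡ lookup q j) → p ≡ q
      ext []      []      h = refl
      ext (x ∷ p) (y ∷ q) h = cong₂ _∷_ (h zero) (ext p q (h ∘ suc))

    ι≤2^A : ∀ (p : Grid n d) j → suc (toℕ (lookup p j)) ℕ.≤ 2 ℕ.^ A
    ι≤2^A p j = ℕ.≤-trans (Fin.toℕ<n (lookup p j)) n≤2^A

    ι-spread : ∀ p q j → ℤ.∣ ι p j ℤ.- ι q j ∣ ℕ.< 2 ℕ.^ A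
    ι-spread p q j = subst (ℕ._< 2 ℕ.^ A) (ℕ.*-identityʳ ℤ.∣ ι p j ℤ.- ι q j ∣)
      (∣-∣*-< (ℤ.∣ ι p j ∣) (ℤ.∣ ι q j ∣) 1 (2 ℕ.^ A) (bound p q) (bound q p))
      where
      bound : ∀ (p q : Grid n d) → suc (toℕ (lookup p j)) ℕ.* 1 ℕ.< suc (toℕ (lookup q j)) ℕ.* 1 ℕ.+ 2 ℕ.^ A
      bound p q = ℕ.+-mono-≤ (ℕ.s≤s (ℕ.z≤n {toℕ (lookup q j) ℕ.* 1}))
        (subst (ℕ._≤ 2 ℕ.^ A) (sym (ℕ.*-identityʳ (suc (toℕ (lookup p j))))) (ι≤2^A p j))

    open Enumeration m A e grid ι using (edges; Rate; length-edges)

    _≟ᵍ_ : DecidableEquality (Grid n d)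
    _≟ᵍ_ = ≡-dec (Fin._≟_ {n})

    open Alteration _≟ᵍ_ using (independent-set)

    hyperedges : List (List (Grid n d))
    hyperedges = filter (unique? _≟ᵍ_) (map Vec.toList (edges countC^e k))

    hyperedges-are-edges : All (λ ε → Unique ε × length ε ≡ e) hyperedges
    hyperedges-are-edges = All.tabulate λ {ε} hε →
      let ∈map , u = ∈-filter⁻ (unique? _≟ᵍ_) {xs = map Vec.toList (edges countC^e k)} hε
          v , _ , eq = ∈-map⁻ Vec.toList ∈map
      in u , trans (cong length eq) (length-toList v)

    length-hyperedges : ∀ {ℓ} → Rate ℓ → length hyperedges ℕ.≤ edgesK m countC^e k ℕ.* (ℓ ℕ.* ((2 ℕ.^ A) ℕ.^ d) ℕ.^ k)
    length-hyperedges R = ℕ.≤-trans (List.length-filter (unique? _≟ᵍ_) (map Vec.toList (edges countC^e k)))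
      (ℕ.≤-trans (ℕ.≤-reflexive (List.length-map Vec.toList (edges countC^e k))) (length-edges R countC^e k))

    -- If T had r or more points, its first e would be distinct points of `U`, hence a hyperedge
    -- inside `S`.
    admissible : ∀ r → e ℕ.≤ r → ∀ S → All (λ ε → ¬ All (_∈ˡ S) ε) hyperedges → Admissible k r S
    admissible r e≤r S independent U dim T uT T⊆S T⊆U = decidable-stable (_ ℕ.≤? _) λ ¬≤ →
      let e≤T : e ℕ.≤ length T
          e≤T = ℕ.≤-trans e≤r (ℕ.≤-trans (ℕ.m≤n+m∸n r 1) (ℕ.≰⇒> ¬≤))
          v , v≡ = fromTake e T e≤T
          taken : ∀ {P : Grid n d → Set} → All P T → All P (Vec.toList v)
          taken h = subst (All _) (sym v≡) (AllP.take⁺ e h)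
      in ∈-edges grid-unique ι-injective ι-spread v (λ i → ∈-grid (lookup v i))
           (lookup-All v (taken T⊆U)) (λ i j → ι≤2^A (lookup {n = e} v i) j)
           -- Grid coordinates start at 1, so no grid point is the zero vector.
           (zero , λ h → case h zero of λ ()) λ v∈ →
           All.lookup independent
             (∈-filter⁺ (unique? _≟ᵍ_) (∈-map⁺ Vec.toList v∈) (subst Unique (sym v≡) (take⁺ e uT)))
             (taken (All.tabulate T⊆S))
      where
      open RankBound m
      open Saturation m A e grid ι (lattice U) k (rank≤ U k dim)

    -- The density is 1/q with q about Y^(1/e′), where Y is twice the bound on hyperedges per grid
    -- point. Taking e′-th powers of N ≤ 2q ∣S∣ removes the root, and the factor N^k′ of Y cancels.
    large-set : ∀ {ℓ} → Rate ℓ → 1 ℕ.≤ ℓ → 1 ℕ.≤ n → 2 ℕ.^ A ℕ.≤ 2 ℕ.* n → ∀ r → e ℕ.≤ r →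
      ∃[ S ] Unique S × Admissible k r S × n ℕ.^ (d ℕ.* (e ℕ.∸ k)) ℕ.≤ setK ℕ.* (ℓ ℕ.* length S ℕ.^ e′)
    large-set {ℓ} R 1≤ℓ 1≤n 2^A≤2n r e≤r =
      let e″ , e′≡ = pred-of e′ k≤e′
          q , 1≤q , lo , hi = subst (λ z → ∃[ q ] 1 ℕ.≤ q × Y ℕ.≤ q ℕ.^ z × q ℕ.^ z ℕ.≤ 2 ℕ.^ z ℕ.* Y)
            (sym e′≡) (root-approx e″ Y Y≥1)
          S , uS , _ , ind , big = independent-set q e′ {{ℕ.>-nonZero 1≤q}} grid grid-unique hyperedges hyperedges-are-edges
            (begin
              2 ℕ.* length hyperedges             ≤⟨ few ⟩
              Y ℕ.* n ℕ.^ d                       ≤⟨ ℕ.*-monoˡ-≤ (n ℕ.^ d) lo ⟩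
              q ℕ.^ e′ ℕ.* n ℕ.^ d                ≡⟨ cong (q ℕ.^ e′ ℕ.*_) length-grid ⟨
              q ℕ.^ e′ ℕ.* length grid            ∎)
      in S , uS , admissible r e≤r S ind , ℕ.*-cancelˡ-≤ (N ℕ.^ k′) (begin
        N ℕ.^ k′ ℕ.* n ℕ.^ (d ℕ.* (e′ ℕ.∸ k′))
          ≡⟨ cong (N ℕ.^ k′ ℕ.*_) (ℕ.^-*-assoc n d (e′ ℕ.∸ k′)) ⟨
        N ℕ.^ k′ ℕ.* N ℕ.^ (e′ ℕ.∸ k′)
          ≡⟨ ℕ.^-distribˡ-+-* N k′ (e′ ℕ.∸ k′) ⟨
        N ℕ.^ (k′ ℕ.+ (e′ ℕ.∸ k′))
          ≡⟨ cong (N ℕ.^_) (ℕ.m+[n∸m]≡n (ℕ.≤-trans (ℕ.n≤1+n k′) k≤e′)) ⟩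
        N ℕ.^ e′
          ≤⟨ ℕ.^-monoˡ-≤ e′ (subst (ℕ._≤ 2 ℕ.* q ℕ.* length S) length-grid big) ⟩
        (2 ℕ.* q ℕ.* length S) ℕ.^ e′
          ≡⟨ trans (^-distribʳ-* e′ (2 ℕ.* q) (length S)) (cong (ℕ._* length S ℕ.^ e′) (^-distribʳ-* e′ 2 q)) ⟩
        2 ℕ.^ e′ ℕ.* q ℕ.^ e′ ℕ.* length S ℕ.^ e′
          ≤⟨ ℕ.*-monoˡ-≤ (length S ℕ.^ e′) (ℕ.*-monoʳ-≤ (2 ℕ.^ e′) hi) ⟩
        2 ℕ.^ e′ ℕ.* (2 ℕ.^ e′ ℕ.* Y) ℕ.* length S ℕ.^ e′
          ≡⟨ eq₁ (2 ℕ.^ e′) edgeK ℓ (N ℕ.^ k′) (length S ℕ.^ e′) ⟩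
        N ℕ.^ k′ ℕ.* (setK ℕ.* (ℓ ℕ.* length S ℕ.^ e′)) ∎)
      where
      open ℕ.≤-Reasoning
      N Y : ℕ
      N = n ℕ.^ d
      Y = edgeK ℕ.* (ℓ ℕ.* N ℕ.^ k′)
      instance
        n≢0 : ℕ.NonZero n
        n≢0 = ℕ.>-nonZero 1≤n
        N≢0 : ℕ.NonZero N
        N≢0 = ℕ.m^n≢0 n d
        N^k′≢0 : ℕ.NonZero (N ℕ.^ k′)
        N^k′≢0 = ℕ.m^n≢0 N k′
      pred-of : ∀ x {k′} → suc k′ ℕ.≤ x → ∃[ x′ ] x ≡ suc x′
      pred-of (suc x) _ = x , refl
      Y≥1 : 1 ℕ.≤ Y
      Y≥1 = ℕ.*-mono-≤ edgeK≥1 (ℕ.*-mono-≤ 1≤ℓ (ℕ.m^n>0 N k′))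
      eq₁ : ∀ p c ℓ x s → p ℕ.* (p ℕ.* (c ℕ.* (ℓ ℕ.* x))) ℕ.* s ≡ x ℕ.* (p ℕ.* p ℕ.* c ℕ.* (ℓ ℕ.* s))
      eq₁ = ℕ-Ring.solve-∀
      eq₂ : ∀ c ℓ t x y → 2 ℕ.* (c ℕ.* (ℓ ℕ.* (t ℕ.* (x ℕ.* y)))) ≡ 2 ℕ.* c ℕ.* t ℕ.* (ℓ ℕ.* y) ℕ.* x
      eq₂ = ℕ-Ring.solve-∀
      few : 2 ℕ.* length hyperedges ℕ.≤ Y ℕ.* n ℕ.^ d
      few = begin
        2 ℕ.* length hyperedges
          ≤⟨ ℕ.*-monoʳ-≤ 2 (length-hyperedges R) ⟩
        2 ℕ.* (edgesK m countC^e k ℕ.* (ℓ ℕ.* ((2 ℕ.^ A) ℕ.^ d) ℕ.^ k))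
          ≤⟨ ℕ.*-monoʳ-≤ 2 (ℕ.*-mono-≤ (ℕ.n≤1+n (edgesK m countC^e k)) (ℕ.*-monoʳ-≤ ℓ (ℕ.^-monoˡ-≤ k (ℕ.^-monoˡ-≤ d 2^A≤2n)))) ⟩
        2 ℕ.* (suc (edgesK m countC^e k) ℕ.* (ℓ ℕ.* ((2 ℕ.* n) ℕ.^ d) ℕ.^ k))
          ≡⟨ cong (λ z → 2 ℕ.* (suc (edgesK m countC^e k) ℕ.* (ℓ ℕ.* z)))
               (trans (cong (ℕ._^ k) (^-distribʳ-* d 2 n)) (^-distribʳ-* k (2 ℕ.^ d) N)) ⟩
        2 ℕ.* (suc (edgesK m countC^e k) ℕ.* (ℓ ℕ.* ((2 ℕ.^ d) ℕ.^ k ℕ.* (N ℕ.* N ℕ.^ k′))))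
          ≡⟨ eq₂ (suc (edgesK m countC^e k)) ℓ ((2 ℕ.^ d) ℕ.^ k) N (N ℕ.^ k′) ⟩
        Y ℕ.* N ∎

-- From the finite bound to the asymptotic rates

open Enumeration using (Rate; e≡d; e<d)
open Defs using (IsPower; IsLogRate; g₃; g₂; r<d; r≮d; k≡d-1; k≢d-1; _=Ω_)

f-lin-bound : ∀ m k′ e′ k≤e′ e≤d n A {ℓ} → n ℕ.≤ 2 ℕ.^ A → 2 ℕ.^ A ℕ.≤ 2 ℕ.* n → 1 ℕ.≤ n → 1 ℕ.≤ ℓ →
  (∀ points ι → Rate m A (suc e′) {Grid n (suc m)} points ι ℓ) →
  ∀ r M → suc e′ ℕ.≤ r → f-lin (suc m) (suc k′) r n M →
  n ℕ.^ (suc m ℕ.* (e′ ℕ.∸ k′)) ℕ.≤ LowerBound.setK m k′ e′ k≤e′ e≤d ℕ.* (ℓ ℕ.* M ℕ.^ e′)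
f-lin-bound m k′ e′ k≤e′ e≤d n A {ℓ} lo hi 1≤n 1≤ℓ R r M e≤r F =
  let S , uS , adm , bound = large-set n A lo (R _ _) 1≤ℓ 1≤n hi r e≤r
  in ℕ.≤-trans bound (ℕ.*-monoʳ-≤ setK (ℕ.*-monoʳ-≤ ℓ (ℕ.^-monoˡ-≤ e′ (f-lin.maximal F S uS adm))))
  where open LowerBound m k′ e′ k≤e′ e≤d

=Ω-intro : ∀ {f g} κ → 1 ℕ.≤ κ →
  (∀ n → 2 ℕ.≤ n → ∀ M y → f n M → g n y → ∀ c → 0ℚ ℚ.< c → c ℚ.* fromℕ κ ≡ 1ℚ → (fromℚ c Defs.* y) Defs.≤ fromℚ (fromℕ M)) →
  f =Ω g
=Ω-intro κ 1≤κ h = fromℚ c , (c , 0<c , 0 , λ _ _ → ℚ.≤-reflexive (ℚ.+-identityˡ c)) , 2 ,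
  λ n 2≤n M y F G → h n 2≤n M y F G c 0<c (ℚ.*-inverseˡ (fromℕ κ) {{ℚ.pos⇒nonZero (fromℕ κ) {{κ>0}}}})
  where
  κ>0 : ℚ.Positive (fromℕ κ)
  κ>0 = ℚ.positive (ℚ.<-≤-trans 0<1 (fromℕ-mono 1≤κ))
  c : ℚ
  c = (ℚ.1/ fromℕ κ) {{ℚ.pos⇒nonZero (fromℕ κ) {{κ>0}}}}
  0<c : 0ℚ ℚ.< c
  0<c = ℚ.positive⁻¹ c {{ℚ.1/pos⇒pos (fromℕ κ) {{κ>0}}}}

seq-fromℕ^ : ∀ n p N → seq (Defs.fromℕ n Defs.^ p) N ≡ fromℕ (n ℕ.^ p)
seq-fromℕ^ n p N = trans (seq-^ (Defs.fromℕ n) p N) (pow-fromℕ n p)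

power-rate : ∀ m k′ e″ → suc k′ ℕ.≤ suc e″ → suc (suc e″) ℕ.< suc m → let e′ = suc e″ in
  f-lin (suc m) (suc k′) (suc e′) =Ω (λ n y → IsPower (Defs.fromℕ n) (suc m ℕ.* (e′ ℕ.∸ k′)) e′ y)
power-rate m k′ e″ k≤e′ e<d′ = =Ω-intro κ
  (ℕ.*-mono-≤ {1} {2} (ℕ.s≤s ℕ.z≤n) setK≥1) λ n 2≤n M y F (_ , y^≈) c 0<c cκ≡1 →
  let b , lo , hi = dyadic-scale n (ℕ.≤-trans (ℕ.n≤1+n 1) 2≤n)
      -- The scale A is `suc b`, since n < 2^(suc b) ≤ 2n.
      nat-bound = f-lin-bound m k′ e′ k≤e′ (ℕ.<⇒≤ e<d′) n (suc b) {2} (ℕ.<⇒≤ hi) (ℕ.*-monoʳ-≤ 2 lo)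
        (ℕ.≤-trans (ℕ.n≤1+n 1) 2≤n) (ℕ.s≤s ℕ.z≤n) (λ _ _ → e<d e<d′) (suc e′) M ℕ.≤-refl F
      p = fromℕ (n ℕ.^ (suc m ℕ.* (e′ ℕ.∸ k′)))
  -- There is no logarithm to divide by, so the denominator and its power are both 1.
  in root-bound y 1ℝ 1ℝ c (fromℕ κ) 0<c cκ≡1 (fromℕ-mono (ℕ.*-mono-≤ {1} {2} (ℕ.s≤s ℕ.z≤n) setK≥1)) p (fromℕ M) e″
    (fromℕ-mono (ℕ.z≤n {M}))
    (1ℚ , 0<1 , 0 , λ _ _ → ℚ.≤-refl)
    (null-cong (λ N → cong (λ z → seq ((y Defs.* 1ℝ) Defs.^ e′) N ℚ.- z) (seq-fromℕ^ n (suc m ℕ.* (e′ ℕ.∸ k′)) N))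
      (≈-trans ((y Defs.* 1ℝ) Defs.^ e′) (y Defs.^ e′) (Defs.fromℕ n Defs.^ (suc m ℕ.* (e′ ℕ.∸ k′)))
        (≈-^ (y Defs.* 1ℝ) y e′ (≡⇒≈ {y Defs.* 1ℝ} {y} λ N → ℚ.*-identityʳ (seq y N))) y^≈))
    (≡⇒≈ {1ℝ Defs.^ e′} {1ℝ} λ N → trans (seq-fromℕ^ 1 e′ N) (cong fromℕ (ℕ.^-zeroˡ e′)))
    (λ N → ℚ.≤-trans (fromℕ-mono nat-bound) (ℚ.≤-reflexive (trans
      (cong fromℕ (eq setK (M ℕ.^ e′)))
      (trans (fromℕ-* κ (M ℕ.^ e′ ℕ.* 1)) (cong (fromℕ κ ℚ.*_) (trans (fromℕ-* (M ℕ.^ e′) 1)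
        (cong (ℚ._* 1ℚ) (sym (pow-fromℕ M e′)))))))))
  where
  e′ = suc e″
  open LowerBound m k′ e′ k≤e′ (ℕ.<⇒≤ e<d′)
  κ = 2 ℕ.* setK
  eq : ∀ s x → s ℕ.* (2 ℕ.* x) ≡ 2 ℕ.* s ℕ.* (x ℕ.* 1)
  eq = ℕ-Ring.solve-∀

log-rate : ∀ m′ k′ → suc k′ ℕ.≤ suc m′ → ∀ r → suc (suc m′) ℕ.≤ r →
  f-lin (suc (suc m′)) (suc k′) r =Ω IsLogRate (suc (suc m′)) (suc k′)
log-rate m′ k′ k≤m r d≤r = =Ω-intro κ κ≥1 λ n 2≤n M y F (a , b , (_ , a^≈) , (_ , b^≈) , 0<b , yb≈a) c 0<c cκ≡1 →
  let β , lo , hi = dyadic-scale n (ℕ.≤-trans (ℕ.n≤1+n 1) 2≤n)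
      1≤β = scale≥1 n β 2≤n hi
      nat-bound = f-lin-bound m k′ m k≤m ℕ.≤-refl n (suc β) {suc (suc β)} (ℕ.<⇒≤ hi) (ℕ.*-monoʳ-≤ 2 lo)
        (ℕ.≤-trans (ℕ.n≤1+n 1) 2≤n) (ℕ.s≤s ℕ.z≤n) (λ _ _ → e≡d refl) r M d≤r F
      P = suc m ℕ.* (m ℕ.∸ k′)
  in root-bound y b (Defs.log n) c (fromℕ κ) 0<c cκ≡1 (fromℕ-mono κ≥1) (fromℕ (n ℕ.^ P)) (fromℕ M) m′
    (fromℕ-mono (ℕ.z≤n {M})) 0<b
    (null-cong (λ N → cong (λ z → seq ((y Defs.* b) Defs.^ m) N ℚ.- z) (seq-fromℕ^ n P N))
      (≈-trans ((y Defs.* b) Defs.^ m) (a Defs.^ m) (Defs.fromℕ n Defs.^ P) (≈-^ (y Defs.* b) a m yb≈a) a^≈))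
    (≈-trans (b Defs.^ m) (Defs.log n Defs.^ 1) (Defs.log n) b^≈
      (≡⇒≈ {Defs.log n Defs.^ 1} {Defs.log n} λ N → ℚ.*-identityʳ (Defs.log-seq n N)))
    (λ N → ℚ.≤-trans (fromℕ-mono (ℕ.≤-trans nat-bound
        (ℕ.*-monoʳ-≤ setK (ℕ.*-monoˡ-≤ (M ℕ.^ m) (β+2≤3β β 1≤β)))))
      (subst (ℚ._≤ fromℕ κ ℚ.* (pow (fromℕ M) m ℚ.* Defs.log-seq n N)) (sym (regroup β M))
        (ℚ.*-monoˡ-≤-nonNeg (fromℕ κ) {{ℚ.nonNegative (fromℕ-mono (ℕ.z≤n {κ}))}}
          (ℚ.*-monoˡ-≤-nonNeg (pow (fromℕ M) m) {{ℚ.nonNegative (0≤pow m (fromℕ-mono (ℕ.z≤n {M})))}}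
            (log-lower n β N lo)))))
  where
  m = suc m′
  open LowerBound m k′ m k≤m ℕ.≤-refl
  -- The factor `ℓ` is β + 2 ≤ 3β, and β ≤ 2 log n by `log-lower`.
  κ = 6 ℕ.* setK
  κ≥1 : 1 ℕ.≤ κ
  κ≥1 = ℕ.*-mono-≤ {1} {6} (ℕ.s≤s ℕ.z≤n) setK≥1
  scale≥1 : ∀ n β → 2 ℕ.≤ n → n ℕ.< 2 ℕ.^ suc β → 1 ℕ.≤ β
  scale≥1 n zero    2≤n hi = contradiction (ℕ.<-≤-trans hi 2≤n) (ℕ.<-irrefl refl)
  scale≥1 n (suc β) _   _  = ℕ.s≤s ℕ.z≤n
  β+2≤3β : ∀ β → 1 ℕ.≤ β → suc (suc β) ℕ.≤ 3 ℕ.* β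
  β+2≤3β β 1≤β = ℕ.≤-trans (ℕ.≤-reflexive (ℕ.+-comm 2 β)) (ℕ.+-monoʳ-≤ β (ℕ.*-monoʳ-≤ 2 1≤β))
  regroup : ∀ β M → fromℕ (setK ℕ.* (3 ℕ.* β ℕ.* M ℕ.^ m)) ≡ fromℕ κ ℚ.* (pow (fromℕ M) m ℚ.* (fromℕ β ℚ.* ½))
  regroup β M = begin
    fromℕ (setK ℕ.* (3 ℕ.* β ℕ.* M ℕ.^ m))
      ≡⟨ trans (cong fromℕ (eqℕ setK β (M ℕ.^ m))) (trans (fromℕ-* (3 ℕ.* setK) (M ℕ.^ m ℕ.* β))
           (cong (fromℕ (3 ℕ.* setK) ℚ.*_) (fromℕ-* (M ℕ.^ m) β))) ⟩
    fromℕ (3 ℕ.* setK) ℚ.* (fromℕ (M ℕ.^ m) ℚ.* fromℕ β)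
      ≡⟨ solve 4 (λ s x b h → s :* (x :* b) := (con 1ℚ :* s) :* (x :* b)) refl (fromℕ (3 ℕ.* setK)) (fromℕ (M ℕ.^ m)) (fromℕ β) ½ ⟩
    (1ℚ ℚ.* fromℕ (3 ℕ.* setK)) ℚ.* (fromℕ (M ℕ.^ m) ℚ.* fromℕ β)
      ≡⟨ cong (λ z → (z ℚ.* fromℕ (3 ℕ.* setK)) ℚ.* (fromℕ (M ℕ.^ m) ℚ.* fromℕ β)) half ⟨
    (fromℕ 2 ℚ.* ½ ℚ.* fromℕ (3 ℕ.* setK)) ℚ.* (fromℕ (M ℕ.^ m) ℚ.* fromℕ β)
      ≡⟨ solve 5 (λ t h s x b → (t :* h :* s) :* (x :* b) := (t :* s) :* (x :* (b :* h))) refl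
           (fromℕ 2) ½ (fromℕ (3 ℕ.* setK)) (fromℕ (M ℕ.^ m)) (fromℕ β) ⟩
    (fromℕ 2 ℚ.* fromℕ (3 ℕ.* setK)) ℚ.* (fromℕ (M ℕ.^ m) ℚ.* (fromℕ β ℚ.* ½))
      ≡⟨ cong₂ (λ s x → s ℚ.* (x ℚ.* (fromℕ β ℚ.* ½)))
           (trans (sym (fromℕ-* 2 (3 ℕ.* setK))) (cong fromℕ (sym (ℕ.*-assoc 2 3 setK)))) (sym (pow-fromℕ M m)) ⟩
    fromℕ κ ℚ.* (pow (fromℕ M) m ℚ.* (fromℕ β ℚ.* ½)) ∎
    where
    open ≡-Reasoning
    open ℚ-Solver.+-*-Solver
    half : fromℕ 2 ℚ.* ½ ≡ 1ℚ
    half = refl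
    eqℕ : ∀ s b x → s ℕ.* (3 ℕ.* b ℕ.* x) ≡ 3 ℕ.* s ℕ.* (x ℕ.* b)
    eqℕ = ℕ-Ring.solve-∀

=Ω-mono : ∀ {f g g′} → (∀ n y → g′ n y → g n y) → f =Ω g → f =Ω g′
=Ω-mono h (c , 0<c , N , bound) = c , 0<c , N , λ n N≤n M y F G → bound n N≤n M y F (h n y G)

open Defs
open import Data.Nat.Base renaming (_<_ to _<ℕ_; _≤_ to _≤ℕ_) using ()

three-parameter : (d k r : ℕ) → 1 ≤ℕ k → k <ℕ d → suc k ≤ℕ r → f-lin d k r =Ω g₃ d k r
three-parameter (suc (suc m′)) (suc k′) (suc zero) _ _ (ℕ.s≤s ())
three-parameter (suc zero) (suc k′) r _ (ℕ.s≤s ()) _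
-- The tuples counted have e = r points if r < d and e = d points otherwise.
three-parameter (suc (suc m′)) (suc k′) (suc (suc e″)) _ (ℕ.s≤s k≤m) (ℕ.s≤s k≤e′) with suc (suc e″) ℕ.<? suc (suc m′)
... | yes lt = =Ω-mono (λ { n y (r<d _ P) → P ; n y (r≮d ≮ _) → contradiction lt ≮ }) (power-rate (suc m′) k′ e″ k≤e′ lt)
... | no ≮   = =Ω-mono (λ { n y (r<d lt _) → contradiction lt ≮ ; n y (r≮d _ L) → L })
    (log-rate m′ k′ k≤m (suc (suc e″)) (ℕ.≮⇒≥ ≮))

-- For r = k + 1 the condition r < d means k ≠ d - 1, and then d (r - k) / (r - 1) is d / k.
g₂⇒g₃ : (d k : ℕ) → k <ℕ d → ∀ n y → g₂ d k n y → g₃ d k (suc k) n y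
g₂⇒g₃ (suc d′) k k<d n y (k≡d-1 refl L) = r≮d (ℕ.<-irrefl refl) L
g₂⇒g₃ (suc d′) k k<d n y (k≢d-1 ≢ P) = r<d (ℕ.s≤s (ℕ.≤∧≢⇒< (ℕ.≤-pred k<d) ≢))
  (subst (λ z → IsPower (Defs.fromℕ n) z k y)
    (sym (trans (cong (suc d′ ℕ.*_) (ℕ.m+n∸n≡m 1 k)) (ℕ.*-identityʳ (suc d′)))) P)

theorem1p2 : (d k r : ℕ) → 1 ≤ℕ d → 1 ≤ℕ k → 1 ≤ℕ r → k <ℕ d → suc k ≤ℕ r →
    (f-lin d k r =Ω g₃ d k r) × (r ≡ suc k → f-lin d k (suc k) =Ω g₂ d k)
theorem1p2 d k r _ 1≤k _ k<d k<r = three-parameter d k r 1≤k k<d k<r ,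
  λ _ → =Ω-mono (g₂⇒g₃ d k k<d) (three-parameter d k (suc k) 1≤k k<d ℕ.≤-refl)
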